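{- Let $p$ be a prime and let $d$ be an integer with $d\mid p-1$ and $1<d<p-1$. Let $\mu_d\subset\mathbb F_p$ be the set of $d$-th roots of unity in $\mathbb F_p$. If $A,B\subseteq\mathbb F_p$ satisfy $A+B=\mu_d$ (where $A+B=\{a+b:a\in A,b\in B\}$) and $|A|,|B|>1$, then $|A|=|B|=\sqrt d$. -}

module Defs where

open import Data.Nat using (ℕ; _+_; _^_; NonZero)
open import Data.Nat.DivMod using (_mod_)
open import Data.Fin using (Fin; toℕ)
open import Data.Fin.Subset using (Subset; _∈_)
open import Data.Product using (Σ; _×_)
open import Relation.Binary.PropositionalEquality using (_≡_)

-- The prime field F_p is modelled as Fin p (residues 0..p-1), with
-- arithmetic modulo p.
𝔽 : ℕ → Set
𝔽 p = Fin p

_+𝔽_ : ∀ {p} .{{_ : NonZero p}} → 𝔽 p → 𝔽 p → 𝔽 p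
_+𝔽_ {p} a b = (toℕ a + toℕ b) mod p

pow : ∀ {p} .{{_ : NonZero p}} → 𝔽 p → ℕ → 𝔽 p
pow {p} x d = (toℕ x ^ d) mod p

IsRootOfUnity : ∀ {p} .{{_ : NonZero p}} → ℕ → 𝔽 p → Set
IsRootOfUnity {p} d x = pow x d ≡ (1 mod p)

SumsetEq : ∀ {p} .{{_ : NonZero p}} → Subset p → Subset p → (𝔽 p → Set) → Set
SumsetEq {p} A B S = ∀ (c : 𝔽 p) →
  (S c → Σ (𝔽 p) λ a → Σ (𝔽 p) λ b → a ∈ A × b ∈ B × (a +𝔽 b) ≡ c)
  × ((Σ (𝔽 p) λ a → Σ (𝔽 p) λ b → a ∈ A × b ∈ B × (a +𝔽 b) ≡ c) → S c)

{-# OPTIONS --safe #-}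
module Submission where

open import Defs
open import Algebra.Bundles using (CommutativeRing; RawRing)
open import Algebra.Structures using (IsCommutativeRing)
import Algebra.Properties.AbelianGroup
import Algebra.Properties.CommutativeSemiring.Exp
import Algebra.Properties.Ring
import Algebra.Properties.Semiring.Mult
import Algebra.Properties.Semiring.Mult.TCOptimised
import Algebra.Solver.Ring
import Algebra.Solver.Ring.AlmostCommutativeRing as ACR
open import Data.Empty using (⊥-elim)
open import Data.Integer as ℤ using (ℤ; +_; -[1+_]; _⊖_)
import Data.Integer.Properties as ℤ
open import Data.List using (List; []; _∷_; length; foldr; map; filter; applyUpTo)
open import Data.List.Membership.Propositional using (_∈_)
open import Data.List.Properties using (length-map; length-applyUpTo)
open import Data.List.Relation.Unary.All as All using (All; []; _∷_)
import Data.List.Relation.Unary.All.Properties as All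
open import Data.List.Relation.Unary.AllPairs as AllPairs using (AllPairs; []; _∷_)
import Data.List.Relation.Unary.AllPairs.Properties as AllPairs
open import Data.List.Relation.Unary.Any using (here; there)
open import Data.Maybe using (Maybe; just; nothing)
open import Data.Nat as ℕ using (ℕ; zero; suc; z≤n; s≤s)
import Data.Nat.Properties as ℕ
open import Data.Product using (Σ; ∃; _×_; _,_; proj₁; proj₂)
open import Data.Sum using (_⊎_; inj₁; inj₂)
open import Function using (_∘_)
import Level
open Level using (_⊔_)
open import Relation.Binary.PropositionalEquality as ≡ using (_≡_)
import Relation.Binary.Reasoning.Setoid
open import Relation.Nullary using (¬_; Dec; yes; no)
open import Relation.Nullary.Decidable using (¬?)
open import Relation.Unary using (Pred; Decidable)

-- Write P = ∏ (X - b) and Q = ∏ (X + a) over b ∈ B, a ∈ A, with n = |B|, m = |A|.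
-- As in Hanson and Petridis, a divided difference of (X + z)^(d+m-1) over the
-- nodes z ∈ A gives a polynomial of degree d with a zero of order m at every
-- b ∈ B.  Hence mn ≤ d, so mn = d because A + B = μ_d, and this polynomial is a
-- multiple of P^m.  Comparing its Taylor coefficients of orders m and m + 1 at b
-- gives m(m+1) P″Q ≡ 2(d-1) P′Q′ modulo P.  With the same statement for A and B
-- exchanged, m(m+1) P″Q - 2(d-1) P′Q′ + n(n+1) PQ″ is divisible by PQ, and it
-- vanishes for reasons of degree.
--
-- Translate so that the elements of A sum to 0.  If P = X^n + e X^(n-k) + … and
-- Q = X^m + e′ X^(m-k) + …, the factorisation X^d - 1 = ∏ P(X - a) gives
-- m e + (-1)^k n e′ = 0, and together with the differential equation
-- m k (m-n)(k+3) e = 0 or m k (m+n+2)(k-1) e = 0, according to the parity of k.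
-- All these factors are nonzero modulo p unless m = n (or k = 1), so m ≠ n
-- forces P = X^n, which is absurd since P has two distinct roots.

-- Why the zeros have order m: at a point b of B every (b + z)^d is 1, so the exponent d + s acts as
-- the exponent s, and (b + z)^s is a polynomial of degree s in z. A divided difference over m nodes
-- kills it for s < m - 1 and yields a constant for s = m - 1, while in X it lowers the degree from
-- d + m - 1 to d. Differentiation only lowers the exponent, so these values describe all
-- derivatives at b, and subtracting one constant completes the zero. The code uses the negatives of
-- the elements of A as nodes. Sums become differences b - z, both P and Q are products of factors X
-- - c, and exchanging A and B merely replaces the value 1 by (-1)^d. The constant obstacle is
-- characteristic p: integers that are divided by must be shown invertible. The room comes from 2d ≤
-- p - 1 (since d is a proper divisor of p - 1), from m, n ≤ d, and from m + n ≤ mn = d. Centring is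
-- needed because the factor k - 1 says nothing at k = 1; there the vanishing sum of the nodes takes
-- over.

-- Integers in a commutative ring, and ring identities with integer coefficients.

module IntegerCoefficients {c ℓ} (R : CommutativeRing c ℓ) where

  open CommutativeRing R
  open Algebra.Properties.Ring ring
    using (-0#≈0#; -‿distribˡ-*; -‿distribʳ-*; -‿involutive)
  open Algebra.Properties.AbelianGroup +-abelianGroup using (⁻¹-∙-comm)
  open Algebra.Properties.Semiring.Mult semiring using (×-homo-+; ×1-homo-*)
    renaming (_×_ to _·_)
  open Relation.Binary.Reasoning.Setoid setoid

  ι : ℕ → Carrier
  ι n = n · 1#

  ι-+ : ∀ m n → ι (m ℕ.+ n) ≈ ι m + ι n
  ι-+ = ×-homo-+ 1#

  ι-* : ∀ m n → ι (m ℕ.* n) ≈ ι m * ι n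
  ι-* = ×1-homo-*

  private
    module T = Algebra.Properties.Semiring.Mult.TCOptimised semiring

    -- Unlike ι 1, this reduces to 1# at 1.
    ι′ : ℕ → Carrier
    ι′ n = n T.× 1#

  ιℤ : ℤ → Carrier
  ιℤ (+ n)    = ι′ n
  ιℤ -[1+ n ] = - ι′ (suc n)

  cancel-suc : ∀ a b → a - b ≈ (1# + a) - (1# + b)
  cancel-suc a b = sym (begin
    (1# + a) + - (1# + b)     ≈⟨ +-cong (+-comm 1# a) (sym (⁻¹-∙-comm 1# b)) ⟩
    (a + 1#) + (- 1# + - b)   ≈⟨ +-assoc a 1# _ ⟩
    a + (1# + (- 1# + - b))   ≈⟨ +-congˡ (sym (+-assoc 1# (- 1#) (- b))) ⟩
    a + ((1# + - 1#) + - b)   ≈⟨ +-congˡ (+-congʳ (-‿inverseʳ 1#)) ⟩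
    a + (0# + - b)            ≈⟨ +-congˡ (+-identityˡ _) ⟩
    a + - b                   ∎)

  ιℤ-⊖ : ∀ m n → ιℤ (m ⊖ n) ≈ ι′ m - ι′ n
  ιℤ-⊖ m       zero    = sym (trans (+-congˡ -0#≈0#) (+-identityʳ _))
  ιℤ-⊖ zero    (suc n) = sym (+-identityˡ _)
  ιℤ-⊖ (suc m) (suc n) rewrite ℤ.[1+m]⊖[1+n]≡m⊖n m n =
    trans (ιℤ-⊖ m n) (trans (cancel-suc (ι′ m) (ι′ n))
      (sym (+-cong (T.1+× m 1#) (-‿cong (T.1+× n 1#)))))

  ιℤ-+ : ∀ i j → ιℤ (i ℤ.+ j) ≈ ιℤ i + ιℤ j
  ιℤ-+ (+ m)    (+ n)    = T.×-homo-+ 1# m n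
  ιℤ-+ (+ m)    -[1+ n ] = ιℤ-⊖ m (suc n)
  ιℤ-+ -[1+ m ] (+ n)    = trans (ιℤ-⊖ n (suc m)) (+-comm _ _)
  ιℤ-+ -[1+ m ] -[1+ n ] = trans (-‿cong eq) (sym (⁻¹-∙-comm _ _))
    where
    eq : ι′ (suc (suc (m ℕ.+ n))) ≈ ι′ (suc m) + ι′ (suc n)
    eq = trans (reflexive (≡.cong ι′ (≡.sym (ℕ.+-suc (suc m) n)))) (T.×-homo-+ 1# (suc m) (suc n))

  ιℤ-neg : ∀ i → ιℤ (ℤ.- i) ≈ - ιℤ i
  ιℤ-neg (+ zero)  = sym -0#≈0#
  ιℤ-neg (+ suc n) = refl
  ιℤ-neg -[1+ n ]  = sym (-‿involutive _)

  ιℤ-*⁺ : ∀ m n → ιℤ (+ m ℤ.* + n) ≈ ι′ m * ι′ n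
  ιℤ-*⁺ m n rewrite ≡.sym (ℤ.pos-* m n) = T.×1-homo-* m n

  ιℤ-* : ∀ i j → ιℤ (i ℤ.* j) ≈ ιℤ i * ιℤ j
  ιℤ-* (+ m)    (+ n)    = ιℤ-*⁺ m n
  ιℤ-* (+ m)    -[1+ n ] rewrite ≡.sym (ℤ.neg-distribʳ-* (+ m) (+ suc n)) =
    trans (ιℤ-neg (+ m ℤ.* + suc n)) (trans (-‿cong (ιℤ-*⁺ m (suc n))) (-‿distribʳ-* _ _))
  ιℤ-* -[1+ m ] (+ n)    rewrite ≡.sym (ℤ.neg-distribˡ-* (+ suc m) (+ n)) =
    trans (ιℤ-neg (+ suc m ℤ.* + n)) (trans (-‿cong (ιℤ-*⁺ (suc m) n)) (-‿distribˡ-* _ _))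
  ιℤ-* -[1+ m ] -[1+ n ] = trans (ιℤ-*⁺ (suc m) (suc n))
    (sym (trans (sym (-‿distribˡ-* _ _))
         (trans (-‿cong (sym (-‿distribʳ-* _ _))) (-‿involutive _))))

  private
    ℤ-rawRing : RawRing _ _
    ℤ-rawRing = record
      { Carrier = ℤ ; _≈_ = _≡_ ; _+_ = ℤ._+_ ; _*_ = ℤ._*_ ; -_ = ℤ.-_
      ; 0# = + 0 ; 1# = + 1 }

    morphism : ℤ-rawRing ACR.-Raw-AlmostCommutative⟶ ACR.fromCommutativeRing R
    morphism = record
      { ⟦_⟧ = ιℤ ; +-homo = ιℤ-+ ; *-homo = ιℤ-* ; -‿homo = ιℤ-neg
      ; 0-homo = refl ; 1-homo = refl }

    dec : ∀ i j → Maybe (ιℤ i ≈ ιℤ j)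
    dec i j with i ℤ.≟ j
    ... | yes ≡.refl = just refl
    ... | no  _      = nothing

  open Algebra.Solver.Ring ℤ-rawRing (ACR.fromCommutativeRing R) morphism dec public
    using (solve; _:=_; _:+_; _:*_; _:-_; :-_; con)

-- Divisibility, units, residue rings and comaximality.

module Ideals {c ℓ} (R : CommutativeRing c ℓ) where

  open CommutativeRing R
  open IntegerCoefficients R public
  open Algebra.Properties.CommutativeSemiring.Exp commutativeSemiring public
    using (_^_; ^-congˡ; ^-homo-*; ^-assocʳ; ^-distrib-*)
  open Relation.Binary.Reasoning.Setoid setoid

  infix 4 _∣_ _≈[_]_

  _∣_ : Carrier → Carrier → Set (c ⊔ ℓ)
  a ∣ f = Σ Carrier λ q → f ≈ a * q

  IsUnit : Carrier → Set (c ⊔ ℓ)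
  IsUnit x = Σ Carrier λ y → x * y ≈ 1#

  ∣-resp : ∀ {a f g} → f ≈ g → a ∣ f → a ∣ g
  ∣-resp f≈g (q , e) = q , trans (sym f≈g) e

  ∣-respˡ : ∀ {a b f} → a ≈ b → a ∣ f → b ∣ f
  ∣-respˡ a≈b (q , e) = q , trans e (*-congʳ a≈b)

  ∣-zero : ∀ {a} → a ∣ 0#
  ∣-zero = 0# , sym (zeroʳ _)

  ∣-+ : ∀ {a f g} → a ∣ f → a ∣ g → a ∣ f + g
  ∣-+ (q , e) (r , e′) = q + r , trans (+-cong e e′) (sym (distribˡ _ _ _))

  ∣-*ˡ : ∀ {a f} g → a ∣ f → a ∣ g * f
  ∣-*ˡ {a} {f} g (q , e) = g * q , trans (*-congˡ e)
    (solve 3 (λ a g q → g :* (a :* q) := a :* (g :* q)) refl a g q)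

  ∣-trans : ∀ {a b f} → a ∣ b → b ∣ f → a ∣ f
  ∣-trans (q , e) (r , e′) = q * r , trans e′ (trans (*-congʳ e) (*-assoc _ _ _))

  ∣-neg : ∀ {a f} → a ∣ f → a ∣ - f
  ∣-neg {a} (q , e) = - q , trans (-‿cong e)
    (solve 2 (λ a q → :- (a :* q) := a :* (:- q)) refl a q)

  unit-resp : ∀ {x y} → x ≈ y → IsUnit x → IsUnit y
  unit-resp x≈y (z , e) = z , trans (*-congʳ (sym x≈y)) e

  unit-1 : IsUnit 1#
  unit-1 = 1# , *-identityˡ 1#

  unit-* : ∀ {x y} → IsUnit x → IsUnit y → IsUnit (x * y)
  unit-* {x} {y} (x′ , e) (y′ , e′) = x′ * y′ , (begin
    x * y * (x′ * y′)   ≈⟨ solve 4 (λ x y z w → x :* y :* (z :* w) := x :* z :* (y :* w)) refl x y x′ y′ ⟩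
    x * x′ * (y * y′)   ≈⟨ *-cong e e′ ⟩
    1# * 1#             ≈⟨ *-identityˡ 1# ⟩
    1#                  ∎)

  unit-^ : ∀ {x} n → IsUnit x → IsUnit (x ^ n)
  unit-^ zero    u = unit-1
  unit-^ (suc n) u = unit-* u (unit-^ n u)

  unit-neg : ∀ {x} → IsUnit x → IsUnit (- x)
  unit-neg {x} (y , e) = - y ,
    trans (solve 2 (λ x y → (:- x) :* (:- y) := x :* y) refl x y) e

  unit-factorˡ : ∀ {x y} → IsUnit (x * y) → IsUnit x
  unit-factorˡ {x} {y} (z , e) = y * z , trans (sym (*-assoc x y z)) e

  unit-cancel : ∀ {x y} → IsUnit x → x * y ≈ 0# → y ≈ 0#
  unit-cancel {x} {y} (z , e) xy≈0 = begin
    y             ≈⟨ sym (*-identityˡ y) ⟩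
    1# * y        ≈⟨ *-congʳ (sym e) ⟩
    x * z * y     ≈⟨ solve 3 (λ x y z → x :* z :* y := z :* (x :* y)) refl x y z ⟩
    z * (x * y)   ≈⟨ *-congˡ xy≈0 ⟩
    z * 0#        ≈⟨ zeroʳ z ⟩
    0#            ∎

  unit-∣ : ∀ {a x f} → IsUnit x → a ∣ x * f → a ∣ f
  unit-∣ {a} {x} {f} (y , e) d = ∣-resp (begin
    y * (x * f)  ≈⟨ solve 3 (λ x y f → y :* (x :* f) := x :* y :* f) refl x y f ⟩
    x * y * f    ≈⟨ *-congʳ e ⟩
    1# * f       ≈⟨ *-identityˡ f ⟩
    f            ∎) (∣-*ˡ y d)

  -‿≈0 : ∀ {x y} → x ≈ y → x - y ≈ 0#
  -‿≈0 {x} {y} e = trans (+-congʳ e) (-‿inverseʳ y)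

  ≈-from-0 : ∀ {x y} → x - y ≈ 0# → x ≈ y
  ≈-from-0 {x} {y} e = begin
    x            ≈⟨ solve 2 (λ x y → x := (x :- y) :+ y) refl x y ⟩
    (x - y) + y  ≈⟨ +-congʳ e ⟩
    0# + y       ≈⟨ +-identityˡ y ⟩
    y            ∎

  -- A record, so that both sides can be inferred from a proof.
  record _≈[_]_ (x a y : Carrier) : Set (c ⊔ ℓ) where
    constructor mod
    field divides : a ∣ x - y

  open _≈[_]_ public

  ≈⇒≈[] : ∀ {a x y} → x ≈ y → x ≈[ a ] y
  ≈⇒≈[] e = mod (∣-resp (sym (-‿≈0 e)) ∣-zero)

  abstract
    quotient-isCommutativeRing : ∀ a → IsCommutativeRing (λ x y → x ≈[ a ] y) _+_ _*_ -_ 0# 1#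
    quotient-isCommutativeRing a = record
      { isRing = record
          { +-isAbelianGroup = record
            { isGroup = record
              { isMonoid = record
                { isSemigroup = record
                  { isMagma = record
                    { isEquivalence = record
                      { refl  = ≈⇒≈[] refl
                      ; sym   = λ {x} {y} (mod d) → mod (∣-resp (solve 2 (λ x y → :- (x :- y) := y :- x) refl x y) (∣-neg d))
                      ; trans = λ {x} {y} {z} (mod d) (mod d′) → mod (∣-resp
                          (solve 3 (λ x y z → (x :- y) :+ (y :- z) := x :- z) refl x y z) (∣-+ d d′))
                      }
                    ; ∙-cong = λ {x} {y} {u} {v} (mod d) (mod d′) → mod (∣-resp
                        (solve 4 (λ x y u v → (x :- y) :+ (u :- v) := (x :+ u) :- (y :+ v)) refl x y u v) (∣-+ d d′))
                    }
                  ; assoc = λ x y z → ≈⇒≈[] (+-assoc x y z)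
                  }
                ; identity = (λ x → ≈⇒≈[] (+-identityˡ x)) , (λ x → ≈⇒≈[] (+-identityʳ x))
                }
              ; inverse = (λ x → ≈⇒≈[] (-‿inverseˡ x)) , (λ x → ≈⇒≈[] (-‿inverseʳ x))
              ; ⁻¹-cong = λ {x} {y} (mod d) → mod (∣-resp
                  (solve 2 (λ x y → :- (x :- y) := (:- x) :- (:- y)) refl x y) (∣-neg d))
              }
            ; comm = λ x y → ≈⇒≈[] (+-comm x y)
            }
          ; *-cong = λ {x} {y} {u} {v} (mod d) (mod d′) → mod (∣-resp
              (solve 4 (λ x y u v → u :* (x :- y) :+ y :* (u :- v) := (x :* u) :- (y :* v)) refl x y u v)
              (∣-+ (∣-*ˡ u d) (∣-*ˡ y d′)))
          ; *-assoc = λ x y z → ≈⇒≈[] (*-assoc x y z)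
          ; *-identity = (λ x → ≈⇒≈[] (*-identityˡ x)) , (λ x → ≈⇒≈[] (*-identityʳ x))
          ; distrib = (λ x y z → ≈⇒≈[] (distribˡ x y z)) , (λ x y z → ≈⇒≈[] (distribʳ x y z))
          }
        ; *-comm = λ x y → ≈⇒≈[] (*-comm x y)
        }

  -- The carrier stays the same and only the equality becomes coarser. Lemmas on commutative rings
  -- thus apply to residues directly, and reduction modulo `a` is the identity on elements.
  quotient : Carrier → CommutativeRing c (c ⊔ ℓ)
  quotient a = record { isCommutativeRing = quotient-isCommutativeRing a }

  ∣⇒≈0 : ∀ {a x} → a ∣ x → x ≈[ a ] 0#
  ∣⇒≈0 {a} {x} d = mod (∣-resp (solve 1 (λ x → x := x :- con (+ 0)) refl x) d)

  ≈0⇒∣ : ∀ {a x} → x ≈[ a ] 0# → a ∣ x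
  ≈0⇒∣ {a} {x} (mod d) = ∣-resp (solve 1 (λ x → x :- con (+ 0) := x) refl x) d

module Coprimality {c ℓ} (R : CommutativeRing c ℓ) where

  open CommutativeRing R
  open Ideals R
  private module Q a = Ideals (quotient a)

  -- Comaximality: some combination of `a` and `x` equals 1. This makes sense over any commutative
  -- ring and suffices for cancelling and multiplying divisors.
  Coprime : Carrier → Carrier → Set (c ⊔ ℓ)
  Coprime a x = Q.IsUnit a x

  -- The equation x y - 1 = a q, read modulo `x`, says that - q is an inverse of `a`.
  coprime-sym : ∀ {a x} → Coprime a x → Coprime x a
  coprime-sym {a} {x} (y , mod (q , e)) = - q , mod (- y , (begin
    a * (- q) - 1#        ≈⟨ solve 2 (λ a q → a :* (:- q) :- con (+ 1) := :- (a :* q) :- con (+ 1)) refl a q ⟩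
    - (a * q) - 1#        ≈⟨ +-congʳ (-‿cong (sym e)) ⟩
    - (x * y - 1#) - 1#   ≈⟨ solve 2 (λ x y → :- (x :* y :- con (+ 1)) :- con (+ 1) := x :* (:- y)) refl x y ⟩
    x * (- y)             ∎))
    where open Relation.Binary.Reasoning.Setoid setoid

  coprime-*ʳ : ∀ {a x y} → Coprime a x → Coprime a y → Coprime a (x * y)
  coprime-*ʳ {a} = Q.unit-* a

  coprime-^ʳ : ∀ {a x} n → Coprime a x → Coprime a (x ^ n)
  coprime-^ʳ {a} zero    u = Q.unit-1 a
  coprime-^ʳ {a} (suc n) u = Q.unit-* a u (coprime-^ʳ n u)

  coprime-^ : ∀ {a x} m n → Coprime a x → Coprime (a ^ m) (x ^ n)
  coprime-^ m n u = coprime-sym (coprime-^ʳ m (coprime-sym (coprime-^ʳ n u)))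

  coprime-resp : ∀ {a x y} → x ≈[ a ] y → Coprime a x → Coprime a y
  coprime-resp {a} = Q.unit-resp a

  unit⇒coprime : ∀ {a x} → IsUnit x → Coprime a x
  unit⇒coprime (y , e) = y , ≈⇒≈[] e

  coprime-∣ : ∀ {a x f} → Coprime a x → a ∣ x * f → a ∣ f
  coprime-∣ {a} u d = ≈0⇒∣ (Q.unit-cancel a u (∣⇒≈0 d))

  -- Write f = x q; since `x` is invertible modulo `a`, the divisor `a` passes on to q.
  coprime-*-∣ : ∀ {a x f} → Coprime a x → a ∣ f → x ∣ f → a * x ∣ f
  coprime-*-∣ {a} {x} {f} u d (q , e) = r , (begin
    f            ≈⟨ e ⟩
    x * q        ≈⟨ *-congˡ (proj₂ a∣q) ⟩
    x * (a * r)  ≈⟨ solve 3 (λ x a r → x :* (a :* r) := a :* x :* r) refl x a r ⟩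
    a * x * r    ∎)
    where
    open Relation.Binary.Reasoning.Setoid setoid
    a∣q = coprime-∣ u (∣-resp e d)
    r = proj₁ a∣q

-- Polynomial rings: an interface and its model by finitely supported sequences.

-- All later arguments use only these facts. Products are controlled through the ring laws and
-- multiplication by constants and by `X`, without a convolution formula. `shift f` is (f - f(0)) /
-- X.
record PolynomialRing {c ℓ} (K : CommutativeRing c ℓ) : Set (Level.suc (c ⊔ ℓ)) where
  private
    module K = CommutativeRing K
  open IntegerCoefficients K using (ι)
  field
    polynomials : CommutativeRing (c ⊔ ℓ) ℓ
  open CommutativeRing polynomials
  field
    coef       : Carrier → ℕ → K.Carrier
    ext        : ∀ {f g} → (∀ i → coef f i K.≈ coef g i) → f ≈ g
    coef-cong  : ∀ {f g} → f ≈ g → ∀ i → coef f i K.≈ coef g i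
    bounded    : ∀ f → ∃ λ N → ∀ i → N ℕ.≤ i → coef f i K.≈ K.0#
    coef-0     : ∀ i → coef 0# i K.≈ K.0#
    coef-+     : ∀ f g i → coef (f + g) i K.≈ coef f i K.+ coef g i
    coef-neg   : ∀ f i → coef (- f) i K.≈ K.- coef f i
    C          : K.Carrier → Carrier
    C-cong     : ∀ {a b} → a K.≈ b → C a ≈ C b
    C-0        : C K.0# ≈ 0#
    C-1        : C K.1# ≈ 1#
    C-+        : ∀ a b → C (a K.+ b) ≈ C a + C b
    C-*        : ∀ a b → C (a K.* b) ≈ C a * C b
    C-neg      : ∀ a → C (K.- a) ≈ - C a
    coef-C₀    : ∀ a → coef (C a) 0 K.≈ a
    coef-C₊    : ∀ a i → coef (C a) (suc i) K.≈ K.0#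
    coef-C*    : ∀ a f i → coef (C a * f) i K.≈ a K.* coef f i
    X          : Carrier
    coef-X*₀   : ∀ f → coef (X * f) 0 K.≈ K.0#
    coef-X*₊   : ∀ f i → coef (X * f) (suc i) K.≈ coef f i
    shift      : Carrier → Carrier
    coef-shift : ∀ f i → coef (shift f) i K.≈ coef f (suc i)
    D          : Carrier → Carrier
    coef-D     : ∀ f i → coef (D f) i K.≈ ι (suc i) K.* coef f (suc i)

module FiniteSequences {c ℓ} (K : CommutativeRing c ℓ) where

  open CommutativeRing K
  open IntegerCoefficients K
  open Algebra.Properties.Ring ring using (-0#≈0#)
  open Relation.Binary.Reasoning.Setoid setoid

  private
    Seq : Set c
    Seq = ℕ → Carrier

  convolve : Seq → Seq → Seq
  convolve f g zero    = f 0 * g 0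
  convolve f g (suc n) = f 0 * g (suc n) + convolve (f ∘ suc) g n

  convolve-cong : ∀ {f f′ g g′ : Seq} → (∀ i → f i ≈ f′ i) → (∀ i → g i ≈ g′ i) →
                  ∀ n → convolve f g n ≈ convolve f′ g′ n
  convolve-cong p q zero    = *-cong (p 0) (q 0)
  convolve-cong p q (suc n) = +-cong (*-cong (p 0) (q (suc n))) (convolve-cong (p ∘ suc) q n)

  convolve-0ˡ : ∀ {f : Seq} g → (∀ i → f i ≈ 0#) → ∀ n → convolve f g n ≈ 0#
  convolve-0ˡ g z zero    = trans (*-congʳ (z 0)) (zeroˡ _)
  convolve-0ˡ g z (suc n) =
    trans (+-cong (trans (*-congʳ (z 0)) (zeroˡ _)) (convolve-0ˡ g (z ∘ suc) n)) (+-identityˡ _)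

  -- `convolve` recurses on the first sequence; this is the mirrored recursion on the second one,
  -- and switching between the two gives commutativity.
  convolve-sucʳ : ∀ f g n → convolve f g (suc n) ≈ convolve f (g ∘ suc) n + f (suc n) * g 0
  convolve-sucʳ f g zero    = refl
  convolve-sucʳ f g (suc n) =
    trans (+-congˡ (convolve-sucʳ (f ∘ suc) g n)) (sym (+-assoc _ _ _))

  convolve-comm : ∀ f g n → convolve f g n ≈ convolve g f n
  convolve-comm f g zero    = *-comm _ _
  convolve-comm f g (suc n) = begin
    f 0 * g (suc n) + convolve (f ∘ suc) g n   ≈⟨ +-comm _ _ ⟩
    convolve (f ∘ suc) g n + f 0 * g (suc n)   ≈⟨ +-cong (convolve-comm (f ∘ suc) g n) (*-comm _ _) ⟩
    convolve g (f ∘ suc) n + g (suc n) * f 0   ≈⟨ sym (convolve-sucʳ g f n) ⟩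
    convolve g f (suc n)                       ∎

  convolve-distribʳ : ∀ h f g n →
    convolve (λ i → f i + g i) h n ≈ convolve f h n + convolve g h n
  convolve-distribʳ h f g zero    = distribʳ _ _ _
  convolve-distribʳ h f g (suc n) = trans (+-congˡ (convolve-distribʳ h (f ∘ suc) (g ∘ suc) n))
    (solve 5 (λ a b z x y → (a :+ b) :* z :+ (x :+ y) := (a :* z :+ x) :+ (b :* z :+ y)) refl
      (f 0) (g 0) (h (suc n)) (convolve (f ∘ suc) h n) (convolve (g ∘ suc) h n))

  convolve-scaleˡ : ∀ a f g n → convolve (λ i → a * f i) g n ≈ a * convolve f g n
  convolve-scaleˡ a f g zero    = *-assoc _ _ _
  convolve-scaleˡ a f g (suc n) = trans (+-congˡ (convolve-scaleˡ a (f ∘ suc) g n))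
    (solve 4 (λ a x y z → a :* x :* y :+ a :* z := a :* (x :* y :+ z)) refl
      a (f 0) (g (suc n)) (convolve (f ∘ suc) g n))

  convolve-assoc : ∀ f g h n → convolve (convolve f g) h n ≈ convolve f (convolve g h) n
  convolve-assoc f g h zero    = *-assoc _ _ _
  convolve-assoc f g h (suc n) = begin
    f 0 * g 0 * h (suc n) + convolve (λ i → f 0 * g (suc i) + convolve (f ∘ suc) g i) h n
      ≈⟨ +-congˡ (convolve-distribʳ h (λ i → f 0 * g (suc i)) (convolve (f ∘ suc) g) n) ⟩
    f 0 * g 0 * h (suc n) + (convolve (λ i → f 0 * g (suc i)) h n + convolve (convolve (f ∘ suc) g) h n)
      ≈⟨ +-congˡ (+-cong (convolve-scaleˡ (f 0) (g ∘ suc) h n) (convolve-assoc (f ∘ suc) g h n)) ⟩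
    f 0 * g 0 * h (suc n) + (f 0 * convolve (g ∘ suc) h n + convolve (f ∘ suc) (convolve g h) n)
      ≈⟨ solve 5 (λ a b z x y → a :* b :* z :+ (a :* x :+ y) := a :* (b :* z :+ x) :+ y) refl
          (f 0) (g 0) (h (suc n)) (convolve (g ∘ suc) h n) (convolve (f ∘ suc) (convolve g h) n) ⟩
    f 0 * (g 0 * h (suc n) + convolve (g ∘ suc) h n) + convolve (f ∘ suc) (convolve g h) n ∎

  constant : Carrier → Seq
  constant a zero    = a
  constant a (suc i) = 0#

  convolve-constantˡ : ∀ a g n → convolve (constant a) g n ≈ a * g n
  convolve-constantˡ a g zero    = refl
  convolve-constantˡ a g (suc n) = trans (+-congˡ (convolve-0ˡ g (λ _ → refl) n)) (+-identityʳ _)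

  VanishesFrom : ℕ → Seq → Set ℓ
  VanishesFrom N f = ∀ i → N ℕ.≤ i → f i ≈ 0#

  convolve-vanishes : ∀ M N f g → VanishesFrom M f → VanishesFrom N g → VanishesFrom (M ℕ.+ N) (convolve f g)
  convolve-vanishes zero    N f g z w n _ = convolve-0ˡ g (λ i → z i z≤n) n
  convolve-vanishes (suc M) N f g z w (suc n) (s≤s le) = trans
    (+-cong (trans (*-congˡ (w (suc n) (ℕ.≤-trans (ℕ.m≤n+m N M) (ℕ.m≤n⇒m≤1+n le)))) (zeroʳ _))
            (convolve-vanishes M N (f ∘ suc) g (λ i i≥M → z (suc i) (s≤s i≥M)) w n le))
    (+-identityˡ _)

  record Poly : Set (c ⊔ ℓ) where
    constructor poly
    field
      seq     : Seq
      bound   : ℕ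
      vanishes : VanishesFrom bound seq

  open Poly

  record _≋_ (f g : Poly) : Set ℓ where
    constructor pointwise
    field at : ∀ i → seq f i ≈ seq g i

  open _≋_

  const : Carrier → Poly
  const a = poly (constant a) 1 λ { (suc i) _ → refl }

  _⊕_ _⊗_ : Poly → Poly → Poly
  poly f M z ⊕ poly g N w = poly (λ i → f i + g i) (M ℕ.+ N) λ i le → trans
    (+-cong (z i (ℕ.≤-trans (ℕ.m≤m+n M N) le)) (w i (ℕ.≤-trans (ℕ.m≤n+m N M) le))) (+-identityˡ _)
  poly f M z ⊗ poly g N w = poly (convolve f g) (M ℕ.+ N) (convolve-vanishes M N f g z w)

  ⊖_ : Poly → Poly
  ⊖ poly f M z = poly (λ i → - f i) M λ i le → trans (-‿cong (z i le)) -0#≈0#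

  𝟘 : Poly
  𝟘 = poly (λ _ → 0#) 0 λ _ _ → refl

  shiftUp : Seq → Seq
  shiftUp f zero    = 0#
  shiftUp f (suc i) = f i

  𝕏 : Poly
  𝕏 = poly (shiftUp (constant 1#)) 2 λ { (suc zero) (s≤s ()) ; (suc (suc i)) _ → refl }

  𝕏⊗₊ : ∀ g n → convolve (shiftUp (constant 1#)) g (suc n) ≈ g n
  𝕏⊗₊ g n = trans (+-cong (zeroˡ _) (trans (convolve-constantˡ 1# g n) (*-identityˡ _))) (+-identityˡ _)

  abstract
    poly-isCommutativeRing : IsCommutativeRing _≋_ _⊕_ _⊗_ ⊖_ 𝟘 (const 1#)
    poly-isCommutativeRing = record
      { isRing = record
        { +-isAbelianGroup = record
          { isGroup = record
            { isMonoid = record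
              { isSemigroup = record
                { isMagma = record
                  { isEquivalence = record
                    { refl  = pointwise λ i → refl
                    ; sym   = λ p → pointwise λ i → sym (at p i)
                    ; trans = λ p q → pointwise λ i → trans (at p i) (at q i)
                    }
                  ; ∙-cong = λ p q → pointwise λ i → +-cong (at p i) (at q i)
                  }
                ; assoc = λ f g h → pointwise λ i → +-assoc _ _ _
                }
              ; identity = (λ f → pointwise λ i → +-identityˡ _) , (λ f → pointwise λ i → +-identityʳ _)
              }
            ; inverse = (λ f → pointwise λ i → -‿inverseˡ _) , (λ f → pointwise λ i → -‿inverseʳ _)
            ; ⁻¹-cong = λ p → pointwise λ i → -‿cong (at p i)
            }
          ; comm = λ f g → pointwise λ i → +-comm _ _
          }
        ; *-cong = λ p q → pointwise (convolve-cong (at p) (at q))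
        ; *-assoc = λ f g h → pointwise (convolve-assoc (seq f) (seq g) (seq h))
        ; *-identity = idˡ , λ f → pointwise λ i →
            trans (convolve-comm (seq f) (constant 1#) i) (at (idˡ f) i)
        ; distrib = (λ h f g → pointwise λ i → trans (convolve-comm (seq h) _ i)
                        (trans (convolve-distribʳ (seq h) (seq f) (seq g) i)
                          (+-cong (convolve-comm (seq f) (seq h) i) (convolve-comm (seq g) (seq h) i))))
                  , (λ h f g → pointwise (convolve-distribʳ (seq h) (seq f) (seq g)))
        }
      ; *-comm = λ f g → pointwise (convolve-comm (seq f) (seq g))
      }
      where
      idˡ : ∀ f → (const 1# ⊗ f) ≋ f
      idˡ f = pointwise λ i → trans (convolve-constantˡ 1# (seq f) i) (*-identityˡ _)

  polynomialRing : PolynomialRing K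
  polynomialRing = record
    { polynomials = record { isCommutativeRing = poly-isCommutativeRing }
    ; coef       = seq
    ; ext        = pointwise
    ; coef-cong  = at
    ; bounded    = λ f → bound f , vanishes f
    ; coef-0     = λ i → refl
    ; coef-+     = λ f g i → refl
    ; coef-neg   = λ f i → refl
    ; C          = const
    ; C-cong     = λ e → pointwise λ { zero → e ; (suc i) → refl }
    ; C-0        = pointwise λ { zero → refl ; (suc i) → refl }
    ; C-1        = pointwise λ i → refl
    ; C-+        = λ a b → pointwise λ { zero → refl ; (suc i) → sym (+-identityˡ _) }
    ; C-*        = λ a b → pointwise λ
        { zero    → sym (convolve-constantˡ a (constant b) 0)
        ; (suc i) → sym (trans (convolve-constantˡ a (constant b) (suc i)) (zeroʳ _)) }
    ; C-neg      = λ a → pointwise λ { zero → refl ; (suc i) → sym -0#≈0# }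
    ; coef-C₀    = λ a → refl
    ; coef-C₊    = λ a i → refl
    ; coef-C*    = λ a f → convolve-constantˡ a (seq f)
    ; X          = 𝕏
    ; coef-X*₀   = λ f → zeroˡ _
    ; coef-X*₊   = λ f i → 𝕏⊗₊ (seq f) i
    ; shift      = λ f → poly (seq f ∘ suc) (bound f) λ i le → vanishes f (suc i) (ℕ.m≤n⇒m≤1+n le)
    ; coef-shift = λ f i → refl
    ; D          = λ f → poly (λ i → ι (suc i) * seq f (suc i)) (bound f) λ i le →
        trans (*-congˡ (vanishes f (suc i) (ℕ.m≤n⇒m≤1+n le))) (zeroʳ _)
    ; coef-D     = λ f i → refl
    }

-- Degrees, derivatives and products of linear factors.

module Polynomials {c ℓ} (K : CommutativeRing c ℓ) (𝒫 : PolynomialRing K) where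

  module K where
    open CommutativeRing K public
    open Ideals K public

  open PolynomialRing 𝒫 public
  open CommutativeRing polynomials public hiding (zero)
  open Ideals polynomials public
  open Coprimality polynomials public
  private module KR = Relation.Binary.Reasoning.Setoid K.setoid
  open Relation.Binary.Reasoning.Setoid setoid

  coef-- : ∀ f g i → coef (f - g) i K.≈ coef f i K.- coef g i
  coef-- f g i = K.trans (coef-+ f (- g) i) (K.+-congˡ (coef-neg g i))

  -- The recursion principle for polynomials: `shift` lowers a degree bound by one, and both `top-*`
  -- and the Leibniz rule are inductions along this splitting.
  decompose : ∀ f → f ≈ C (coef f 0) + X * shift f
  decompose f = ext λ
    { zero    → K.sym (K.trans (coef-+ _ _ 0) (K.trans (K.+-cong (coef-C₀ _) (coef-X*₀ _)) (K.+-identityʳ _)))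
    ; (suc i) → K.sym (K.trans (coef-+ _ _ (suc i))
        (K.trans (K.+-cong (coef-C₊ _ i) (K.trans (coef-X*₊ _ i) (coef-shift f i))) (K.+-identityˡ _))) }

  -- Degree bounds and leading coefficients

  infix 4 _<°_

  record _<°_ (f : Carrier) (N : ℕ) : Set ℓ where
    constructor deg
    field vanish : ∀ i → N ℕ.≤ i → coef f i K.≈ K.0#

  open _<°_ public

  -- The coefficient `a` may be zero: this is a degree bound together with the coefficient at the
  -- bound, so sums and products need no case distinction when leading terms cancel.
  record Top (N : ℕ) (a : K.Carrier) (f : Carrier) : Set ℓ where
    constructor mkTop
    field
      top   : coef f N K.≈ a
      above : f <° suc N

  open Top public

  Monic : ℕ → Carrier → Set ℓ
  Monic N f = Top N K.1# f

  <°-resp : ∀ {f g N} → f ≈ g → f <° N → g <° N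
  <°-resp e z = deg λ i le → K.trans (K.sym (coef-cong e i)) (vanish z i le)

  <°-mono : ∀ {f M N} → M ℕ.≤ N → f <° M → f <° N
  <°-mono le z = deg λ i le′ → vanish z i (ℕ.≤-trans le le′)

  <°-0 : ∀ {N} → 0# <° N
  <°-0 = deg λ i _ → coef-0 i

  <°0⇒≈0 : ∀ {f} → f <° 0 → f ≈ 0#
  <°0⇒≈0 z = ext λ i → K.trans (vanish z i z≤n) (K.sym (coef-0 i))

  <°-C : ∀ a → C a <° 1
  <°-C a = deg λ { (suc i) _ → coef-C₊ a i }

  <°1⇒C : ∀ {f} → f <° 1 → f ≈ C (coef f 0)
  <°1⇒C z = ext λ { zero    → K.sym (coef-C₀ _)
                  ; (suc i) → K.trans (vanish z (suc i) (s≤s z≤n)) (K.sym (coef-C₊ _ i)) }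

  <°-+ : ∀ {f g N} → f <° N → g <° N → f + g <° N
  <°-+ z w = deg λ i le →
    K.trans (coef-+ _ _ i) (K.trans (K.+-cong (vanish z i le) (vanish w i le)) (K.+-identityˡ _))

  <°-neg : ∀ {f N} → f <° N → - f <° N
  <°-neg z = deg λ i le → K.trans (coef-neg _ i)
    (K.trans (K.-‿cong (vanish z i le)) (K.solve 0 (K.:- K.con (+ 0) K.:= K.con (+ 0)) K.refl))

  <°-C* : ∀ {f N} a → f <° N → C a * f <° N
  <°-C* a z = deg λ i le → K.trans (coef-C* a _ i) (K.trans (K.*-congˡ (vanish z i le)) (K.zeroʳ a))

  <°-X* : ∀ {f N} → f <° N → X * f <° suc N
  <°-X* z = deg λ { (suc i) (s≤s le) → K.trans (coef-X*₊ _ i) (vanish z i le) }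

  <°-X*⁻¹ : ∀ {f N} → X * f <° suc N → f <° N
  <°-X*⁻¹ z = deg λ i le → K.trans (K.sym (coef-X*₊ _ i)) (vanish z (suc i) (s≤s le))

  <°-lower : ∀ {f N} → f <° suc N → coef f N K.≈ K.0# → f <° N
  <°-lower {f} {N} z e = deg go
    where
    go : ∀ i → N ℕ.≤ i → coef f i K.≈ K.0#
    go i le with N ℕ.≟ i
    ... | yes ≡.refl = e
    ... | no  N≢i    = vanish z i (ℕ.≤∧≢⇒< le N≢i)

  top-resp : ∀ {N a b f g} → a K.≈ b → f ≈ g → Top N a f → Top N b g
  top-resp p e (mkTop t z) = mkTop (K.trans (K.sym (coef-cong e _)) (K.trans t p)) (<°-resp e z)

  <°⇒top : ∀ {N f} → f <° N → Top N K.0# f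
  <°⇒top z = mkTop (vanish z _ ℕ.≤-refl) (<°-mono (ℕ.n≤1+n _) z)

  top-coef : ∀ {N f} → f <° suc N → Top N (coef f N) f
  top-coef z = mkTop K.refl z

  top-unique : ∀ {N a b f} → Top N a f → Top N b f → a K.≈ b
  top-unique s t = K.trans (K.sym (top s)) (top t)

  top-+ : ∀ {N a b f g} → Top N a f → Top N b g → Top N (a K.+ b) (f + g)
  top-+ (mkTop t z) (mkTop u w) = mkTop (K.trans (coef-+ _ _ _) (K.+-cong t u)) (<°-+ z w)

  top-+ˡ : ∀ {N a f g} → Top N a f → g <° N → Top N a (f + g)
  top-+ˡ t z = top-resp (K.+-identityʳ _) refl (top-+ t (<°⇒top z))

  top-C* : ∀ {N b f} a → Top N b f → Top N (a K.* b) (C a * f)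
  top-C* a (mkTop t z) = mkTop (K.trans (coef-C* a _ _) (K.*-congˡ t)) (<°-C* a z)

  top-X* : ∀ {N a f} → Top N a f → Top (suc N) a (X * f)
  top-X* (mkTop t z) = mkTop (K.trans (coef-X*₊ _ _) t) (<°-X* z)

  top-1 : Monic 0 1#
  top-1 = mkTop (K.trans (coef-cong (sym C-1) 0) (coef-C₀ _)) (<°-resp C-1 (<°-C _))

  top-* : ∀ {M N a b f g} → Top M a f → Top N b g → Top (M ℕ.+ N) (a K.* b) (f * g)
  top-* {zero} {N} {a} {b} {f} {g} s t = top-resp (K.*-congʳ (top s)) (*-congʳ (sym (<°1⇒C (above s)))) (top-C* (coef f 0) t)
  top-* {suc M} {N} {a} {b} {f} {g} s t = top-resp K.refl (begin
      X * (shift f * g) + C (coef f 0) * g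
        ≈⟨ solve 4 (λ x s c g → x :* (s :* g) :+ c :* g := (c :+ x :* s) :* g) refl X (shift f) (C (coef f 0)) g ⟩
      (C (coef f 0) + X * shift f) * g
        ≈⟨ *-congʳ (sym (decompose f)) ⟩
      f * g ∎)
    (top-+ˡ (top-X* (top-* {M} shifted t)) (<°-C* (coef f 0) (<°-mono (s≤s (ℕ.m≤n+m N M)) (above t))))
    where
    shifted : Top M a (shift f)
    shifted = mkTop (K.trans (coef-shift f M) (top s))
                    (deg λ i le → K.trans (coef-shift f i) (vanish (above s) (suc i) (s≤s le)))

  <°-* : ∀ {M N f g} → f <° suc M → g <° suc N → f * g <° suc (M ℕ.+ N)
  <°-* z w = above (top-* (top-coef z) (top-coef w))

  monic-* : ∀ {M N f g} → Monic M f → Monic N g → Monic (M ℕ.+ N) (f * g)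
  monic-* s t = top-resp (K.*-identityˡ _) refl (top-* s t)

  monic-^ : ∀ {N f} m → Monic N f → Monic (m ℕ.* N) (f ^ m)
  monic-^ zero    t = top-1
  monic-^ (suc m) t = monic-* t (monic-^ m t)

  monic-X^ : ∀ N → Monic N (X ^ N)
  monic-X^ zero    = top-1
  monic-X^ (suc N) = top-X* (monic-X^ N)

  <°-X^*⁻¹ : ∀ {N f} k → X ^ k * f <° k ℕ.+ N → f <° N
  <°-X^*⁻¹ zero    z = <°-resp (*-identityˡ _) z
  <°-X^*⁻¹ (suc k) z = <°-X^*⁻¹ k (<°-X*⁻¹ (<°-resp (*-assoc _ _ _) z))

  -- As `f` is monic, the top coefficient of `g` is also that of the product, so it vanishes as long
  -- as it lies above the claimed bound. Any initial bound for `g` can therefore be lowered step by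
  -- step, even if K has zero divisors.
  monic-cancel : ∀ {M N f g} → Monic M f → f * g <° M ℕ.+ N → g <° N
  monic-cancel {M} {N} {f} {g} s z = descend (proj₁ (bounded g))
    (deg λ i le → proj₂ (bounded g) i (ℕ.≤-trans (ℕ.m≤n+m _ N) le))
    where
    descend : ∀ j → g <° N ℕ.+ j → g <° N
    descend zero    w = <°-mono (ℕ.≤-reflexive (ℕ.+-identityʳ N)) w
    descend (suc j) w = descend j (<°-lower w′ (K.trans (K.sym (K.*-identityˡ _))
      (K.trans (K.sym (top (top-* s (top-coef w′)))) (vanish z _ (ℕ.+-monoʳ-≤ M (ℕ.m≤m+n N j))))))
      where
      w′ : g <° suc (N ℕ.+ j)
      w′ = <°-mono (ℕ.≤-reflexive (ℕ.+-suc N j)) w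

  monic-regular : ∀ {M f g} → Monic M f → f * g ≈ 0# → g ≈ 0#
  monic-regular s e = <°0⇒≈0 (monic-cancel s (<°-resp (sym e) <°-0))

  monic-injective : ∀ {M f g h} → Monic M f → f * g ≈ f * h → g ≈ h
  monic-injective {f = f} {g} {h} s e = ≈-from-0 (monic-regular s
    (trans (solve 3 (λ f g h → f :* (g :- h) := f :* g :- f :* h) refl f g h) (-‿≈0 e)))

  -- This is what counts roots below: a product of linear factors is monic, so its divisibility
  -- bounds the number of factors. If M exceeded N, the quotient would vanish, and with it the unit
  -- `u`.
  monic-∣-degree : ∀ {M N u f g} → ¬ K.1# K.≈ K.0# → Monic M f → Top N u g → K.IsUnit u → f ∣ g → M ℕ.≤ N
  monic-∣-degree {M} {N} {u} {f} {g} 1≉0 s t (v , uv≈1) (q , e) with M ℕ.≤? N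
  ... | yes le = le
  ... | no ¬le = ⊥-elim (1≉0 (K.trans (K.sym uv≈1) (K.trans (K.*-congʳ u≈0) (K.zeroˡ v))))
    where
    q≈0 : q ≈ 0#
    q≈0 = <°0⇒≈0 (monic-cancel s (<°-mono (ℕ.≤-trans (ℕ.≰⇒> ¬le) (ℕ.≤-reflexive (≡.sym (ℕ.+-identityʳ M))))
            (<°-resp e (above t))))
    u≈0 : u K.≈ K.0#
    u≈0 = K.trans (K.sym (top t)) (K.trans (coef-cong (trans e (trans (*-congˡ q≈0) (zeroʳ f))) N) (coef-0 N))

  -- The quotient has degree below 1 by `monic-cancel`, hence is a constant, and the top
  -- coefficients identify it.
  monic-∣-same : ∀ {N u f g} → Monic N f → Top N u g → f ∣ g → g ≈ C u * f
  monic-∣-same {N} {u} {f} {g} s t (q , e) = trans e (trans (*-comm f q) (*-congʳ (trans q≈C (C-cong q₀≈u))))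
    where
    q<1 : q <° 1
    q<1 = monic-cancel s (<°-mono (ℕ.≤-reflexive (ℕ.+-comm 1 N)) (<°-resp e (above t)))
    q≈C : q ≈ C (coef q 0)
    q≈C = <°1⇒C q<1
    q₀≈u : coef q 0 K.≈ u
    q₀≈u = K.trans (K.sym (K.*-identityʳ _)) (top-unique (top-* (top-coef q<1) s) (top-resp K.refl (trans e (*-comm f q)) t))

  -- The formal derivative

  κ : ℕ → Carrier
  κ n = C (K.ι n)

  κ-suc : ∀ n → κ (suc n) ≈ 1# + κ n
  κ-suc n = trans (C-+ _ _) (+-congʳ C-1)

  κ-1 : κ 1 ≈ 1#
  κ-1 = trans (C-cong (K.+-identityʳ _)) C-1

  D-cong : ∀ {f g} → f ≈ g → D f ≈ D g
  D-cong e = ext λ i → K.trans (coef-D _ i) (K.trans (K.*-congˡ (coef-cong e (suc i))) (K.sym (coef-D _ i)))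

  D-+ : ∀ f g → D (f + g) ≈ D f + D g
  D-+ f g = ext λ i → K.trans (coef-D _ i) (K.trans (K.*-congˡ (coef-+ f g _))
    (K.trans (K.distribˡ _ _ _) (K.sym (K.trans (coef-+ _ _ i) (K.+-cong (coef-D f i) (coef-D g i))))))

  D-C : ∀ a → D (C a) ≈ 0#
  D-C a = ext λ i → K.trans (coef-D _ i)
    (K.trans (K.*-congˡ (coef-C₊ a i)) (K.trans (K.zeroʳ _) (K.sym (coef-0 i))))

  D-C* : ∀ a f → D (C a * f) ≈ C a * D f
  D-C* a f = ext λ i → KR.begin
    coef (D (C a * f)) i                         KR.≈⟨ coef-D _ i ⟩
    K.ι (suc i) K.* coef (C a * f) (suc i)       KR.≈⟨ K.*-congˡ (coef-C* a f _) ⟩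
    K.ι (suc i) K.* (a K.* coef f (suc i))       KR.≈⟨ K.solve 3 (λ n a x → n K.:* (a K.:* x) K.:= a K.:* (n K.:* x)) K.refl _ a _ ⟩
    a K.* (K.ι (suc i) K.* coef f (suc i))       KR.≈⟨ K.*-congˡ (K.sym (coef-D f i)) ⟩
    a K.* coef (D f) i                           KR.≈⟨ K.sym (coef-C* a _ i) ⟩
    coef (C a * D f) i                           KR.∎

  D-X* : ∀ f → D (X * f) ≈ f + X * D f
  D-X* f = ext λ
    { zero    → K.trans (coef-D _ 0) (K.trans (K.*-cong (K.+-identityʳ _) (coef-X*₊ f 0))
        (K.trans (K.*-identityˡ _)
          (K.sym (K.trans (coef-+ _ _ 0) (K.trans (K.+-congˡ (coef-X*₀ _)) (K.+-identityʳ _))))))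
    ; (suc i) → KR.begin
        coef (D (X * f)) (suc i)                          KR.≈⟨ coef-D _ (suc i) ⟩
        (K.1# K.+ K.ι (suc i)) K.* coef (X * f) (suc (suc i)) KR.≈⟨ K.*-congˡ (coef-X*₊ f _) ⟩
        (K.1# K.+ K.ι (suc i)) K.* coef f (suc i)
          KR.≈⟨ K.solve 2 (λ n x → (K.con (+ 1) K.:+ n) K.:* x K.:= x K.:+ n K.:* x) K.refl _ _ ⟩
        coef f (suc i) K.+ K.ι (suc i) K.* coef f (suc i) KR.≈⟨ K.+-congˡ (K.sym (coef-D f i)) ⟩
        coef f (suc i) K.+ coef (D f) i                   KR.≈⟨ K.+-congˡ (K.sym (coef-X*₊ _ i)) ⟩
        coef f (suc i) K.+ coef (X * D f) (suc i)         KR.≈⟨ K.sym (coef-+ _ _ (suc i)) ⟩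
        coef (f + X * D f) (suc i)                        KR.∎ }

  D-* : ∀ f g → D (f * g) ≈ D f * g + f * D g
  D-* f g = leibniz (proj₁ (bounded f)) f (deg (proj₂ (bounded f)))
    where
    leibniz : ∀ N f → f <° N → D (f * g) ≈ D f * g + f * D g
    leibniz zero f z = begin
      D (f * g)              ≈⟨ D-cong (trans (*-congʳ f≈0) (zeroˡ g)) ⟩
      D 0#                   ≈⟨ D-0 ⟩
      0#                     ≈⟨ solve 2 (λ g g′ → con (+ 0) := con (+ 0) :* g :+ con (+ 0) :* g′) refl g (D g) ⟩
      0# * g + 0# * D g      ≈⟨ +-cong (*-congʳ (sym (trans (D-cong f≈0) D-0))) (*-congʳ (sym f≈0)) ⟩
      D f * g + f * D g      ∎
      where
      f≈0 = <°0⇒≈0 z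
      D-0 = trans (D-cong (sym C-0)) (D-C _)
    leibniz (suc N) f z = begin
      D (f * g)                                      ≈⟨ D-cong (*-congʳ (decompose f)) ⟩
      D ((c₀ + X * s) * g)                           ≈⟨ D-cong (solve 4 (λ c x s g → (c :+ x :* s) :* g := c :* g :+ x :* (s :* g)) refl c₀ X s g) ⟩
      D (c₀ * g + X * (s * g))                       ≈⟨ D-+ _ _ ⟩
      D (c₀ * g) + D (X * (s * g))                   ≈⟨ +-cong (D-C* _ g) (D-X* _) ⟩
      c₀ * D g + (s * g + X * D (s * g))             ≈⟨ +-congˡ (+-congˡ (*-congˡ (leibniz N s s<N))) ⟩
      c₀ * D g + (s * g + X * (D s * g + s * D g))   ≈⟨ solve 6 (λ c x s s′ g g′ → c :* g′ :+ (s :* g :+ x :* (s′ :* g :+ s :* g′))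
                                                          := (con (+ 0) :+ (s :+ x :* s′)) :* g :+ (c :+ x :* s) :* g′) refl c₀ X s (D s) g (D g) ⟩
      (0# + (s + X * D s)) * g + (c₀ + X * s) * D g  ≈⟨ +-congʳ (*-congʳ (+-cong (sym (D-C _)) (sym (D-X* s)))) ⟩
      (D c₀ + D (X * s)) * g + (c₀ + X * s) * D g    ≈⟨ +-congʳ (*-congʳ (sym (D-+ _ _))) ⟩
      D (c₀ + X * s) * g + (c₀ + X * s) * D g        ≈⟨ +-cong (*-congʳ (D-cong (sym (decompose f)))) (*-congʳ (sym (decompose f))) ⟩
      D f * g + f * D g                              ∎
      where
      c₀ = C (coef f 0)
      s  = shift f
      s<N : s <° N
      s<N = deg λ i le → K.trans (coef-shift f i) (vanish z (suc i) (s≤s le))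

  D-1 : D 1# ≈ 0#
  D-1 = trans (D-cong (sym C-1)) (D-C _)

  D-neg : ∀ f → D (- f) ≈ - D f
  D-neg f = ext λ i → K.trans (coef-D _ i) (K.trans (K.*-congˡ (coef-neg f _))
    (K.trans (K.solve 2 (λ n x → n K.:* (K.:- x) K.:= K.:- (n K.:* x)) K.refl _ _)
      (K.sym (K.trans (coef-neg _ i) (K.-‿cong (coef-D f i))))))

  D-- : ∀ f g → D (f - g) ≈ D f - D g
  D-- f g = trans (D-+ f (- g)) (+-congˡ (D-neg g))

  D-^ : ∀ f n → D (f ^ suc n) ≈ κ (suc n) * (f ^ n * D f)
  D-^ f zero = begin
    D (f * 1#)              ≈⟨ D-cong (*-identityʳ f) ⟩
    D f                     ≈⟨ solve 1 (λ x → x := con (+ 1) :* (con (+ 1) :* x)) refl (D f) ⟩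
    1# * (1# * D f)         ≈⟨ *-congʳ (sym κ-1) ⟩
    κ 1 * (1# * D f)        ∎
  D-^ f (suc n) = begin
    D (f * f ^ suc n)                               ≈⟨ D-* f _ ⟩
    D f * f ^ suc n + f * D (f ^ suc n)             ≈⟨ +-congˡ (*-congˡ (D-^ f n)) ⟩
    D f * (f * f ^ n) + f * (κ (suc n) * (f ^ n * D f))
      ≈⟨ solve 4 (λ f p d k → d :* (f :* p) :+ f :* (k :* (p :* d)) := (con (+ 1) :+ k) :* (f :* p :* d)) refl f (f ^ n) (D f) (κ (suc n)) ⟩
    (1# + κ (suc n)) * (f ^ suc n * D f)            ≈⟨ *-congʳ (sym (κ-suc (suc n))) ⟩
    κ (suc (suc n)) * (f ^ suc n * D f)             ∎

  <°-D : ∀ {f N} → f <° suc N → D f <° N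
  <°-D z = deg λ i le → K.trans (coef-D _ i) (K.trans (K.*-congˡ (vanish z (suc i) (s≤s le))) (K.zeroʳ _))

  -- Products of linear factors

  π : K.Carrier → Carrier
  π a = X - C a

  Π : List K.Carrier → Carrier
  Π []       = 1#
  Π (a ∷ as) = π a * Π as

  -- Invertible differences make the linear factors pairwise comaximal and supply the denominators
  -- of divided differences.
  Distinct : List K.Carrier → Set (c ⊔ ℓ)
  Distinct = AllPairs (λ a b → K.IsUnit (a K.- b))

  monic-X+C : ∀ a → Monic 1 (X + C a)
  monic-X+C a = top-+ˡ (top-resp K.refl (*-identityʳ X) (monic-X^ 1)) (<°-C a)

  monic-π : ∀ a → Monic 1 (π a)
  monic-π a = top-+ˡ (top-resp K.refl (*-identityʳ X) (monic-X^ 1)) (<°-neg (<°-C a))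

  monic-Π : ∀ as → Monic (length as) (Π as)
  monic-Π []       = top-1
  monic-Π (a ∷ as) = monic-* (monic-π a) (monic-Π as)

  D-X : D X ≈ 1#
  D-X = begin
    D X             ≈⟨ D-cong (sym (*-identityʳ X)) ⟩
    D (X * 1#)      ≈⟨ D-X* 1# ⟩
    1# + X * D 1#   ≈⟨ +-congˡ (trans (*-congˡ D-1) (zeroʳ X)) ⟩
    1# + 0#         ≈⟨ +-identityʳ 1# ⟩
    1#              ∎

  D-π : ∀ a → D (π a) ≈ 1#
  D-π a = begin
    D (X - C a)     ≈⟨ D-- X (C a) ⟩
    D X - D (C a)   ≈⟨ +-cong D-X (-‿cong (D-C a)) ⟩
    1# - 0#         ≈⟨ solve 0 (con (+ 1) :- con (+ 0) := con (+ 1)) refl ⟩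
    1#              ∎

  -- Reduction modulo X - a plays the role of evaluation at a throughout.
  X≈C[π] : ∀ a → X ≈[ π a ] C a
  X≈C[π] a = mod (1# , sym (*-identityʳ _))

  C-- : ∀ a b → C (a K.- b) ≈ C a - C b
  C-- a b = trans (C-+ _ _) (+-congˡ (C-neg b))

  C-^ : ∀ a n → C (a K.^ n) ≈ C a ^ n
  C-^ a zero    = C-1
  C-^ a (suc n) = trans (C-* _ _) (*-congˡ (C-^ a n))

  C-unit : ∀ {a} → K.IsUnit a → IsUnit (C a)
  C-unit (b , e) = C b , trans (sym (C-* _ _)) (trans (C-cong e) C-1)

  -- Modulo X - a, the polynomial X - b is the constant a - b.
  π-coprime : ∀ {a b} → K.IsUnit (a K.- b) → Coprime (π a) (π b)
  π-coprime {a} {b} u = coprime-resp (Qa.trans (≈⇒≈[] (C-- a b)) (Qa.+-congʳ (Qa.sym (X≈C[π] a)))) (unit⇒coprime (C-unit u))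
    where module Qa = CommutativeRing (quotient (π a))

  Π-coprime : ∀ {a bs} → All (λ b → K.IsUnit (a K.- b)) bs → Coprime (π a) (Π bs)
  Π-coprime []       = unit⇒coprime unit-1
  Π-coprime (u ∷ us) = coprime-*ʳ (π-coprime u) (Π-coprime us)

  Π^-∣ : ∀ {as f} m → Distinct as → All (λ a → π a ^ m ∣ f) as → Π as ^ m ∣ f
  Π^-∣ {[]} {f} m [] [] = unit-∣ {x = 1# ^ m} (unit-^ m unit-1) (f , refl)
  Π^-∣ {a ∷ as} m (u ∷ us) (d ∷ ds) =
    ∣-respˡ (sym (^-distrib-* (π a) (Π as) m)) (coprime-*-∣ (coprime-^ m m (Π-coprime u)) d (Π^-∣ m us ds))

  Π-∣ : ∀ {as f} → Distinct as → All (λ a → π a ∣ f) as → Π as ∣ f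
  Π-∣ us ds = ∣-respˡ (*-identityʳ _) (Π^-∣ 1 us (All.map (∣-respˡ (sym (*-identityʳ _))) ds))

  -- The coprimality of the quotient expresses that `a` is a simple root.
  Cofactor : Carrier → K.Carrier → Set (c ⊔ ℓ)
  Cofactor f a = Σ Carrier λ g → f ≈ π a * g × Coprime (π a) g

  Π-cofactors : ∀ {as} → Distinct as → All (Cofactor (Π as)) as
  Π-cofactors {[]}     []       = []
  Π-cofactors {a ∷ as} (u ∷ us) = (Π as , refl , Π-coprime u) ∷
    All.zipWith (λ { {b} (v , g , e , w) → π a * g
                   , trans (*-congˡ e) (solve 3 (λ a b g → a :* (b :* g) := b :* (a :* g)) refl (π a) (π b) g)
                   , coprime-*ʳ (coprime-sym (π-coprime v)) w }) (u , Π-cofactors us)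

  π∣-^ : ∀ {a u w} n → u ≈[ π a ] C w → u ^ n ≈[ π a ] C (w K.^ n)
  π∣-^ {a} {u} {w} n e = Qa.trans (go n) (≈⇒≈[] (sym (C-^ w n)))
    where
    module Qa = CommutativeRing (quotient (π a))
    go : ∀ n → u ^ n ≈[ π a ] C w ^ n
    go zero    = Qa.refl
    go (suc n) = Qa.*-cong e (go n)

-- Zeros of higher order and their behaviour under integration.

module Multiplicity {c ℓ} (K : CommutativeRing c ℓ) (𝒫 : PolynomialRing K) where

  open Polynomials K 𝒫
  open Relation.Binary.Reasoning.Setoid setoid

  D-π^* : ∀ b s q → D (π b ^ suc s * q) ≈ π b ^ s * (κ (suc s) * q + π b * D q)
  D-π^* b s q = begin
    D (π b ^ suc s * q)                                            ≈⟨ D-* _ q ⟩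
    D (π b ^ suc s) * q + π b ^ suc s * D q                        ≈⟨ +-congʳ (*-congʳ (trans (D-^ _ s) (*-congˡ (*-congˡ (D-π b))))) ⟩
    κ (suc s) * (π b ^ s * 1#) * q + π b * π b ^ s * D q
      ≈⟨ solve 5 (λ k p x q q′ → k :* (p :* con (+ 1)) :* q :+ x :* p :* q′ := p :* (k :* q :+ x :* q′)) refl (κ (suc s)) (π b ^ s) (π b) q (D q) ⟩
    π b ^ s * (κ (suc s) * q + π b * D q)                          ∎

  -- Integration raises the order of a zero by one. If g = (X - b)^s h, then D g is (X - b)^(s-1)
  -- times s h + (X - b) D h; one more factor X - b in D g forces X - b to divide s h, and s is
  -- invertible.
  π^-raise : ∀ {b g} s → (∀ {j} → j ℕ.< s → K.IsUnit (K.ι (suc j))) →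
             π b ∣ g → π b ^ s ∣ D g → π b ^ suc s ∣ g
  π^-raise zero    u d _ = ∣-respˡ (sym (*-identityʳ _)) d
  π^-raise {b} {g} (suc s) u d (r , e) = t , (begin
    g                          ≈⟨ e′ ⟩
    π b ^ suc s * h            ≈⟨ *-congˡ (proj₂ π∣h) ⟩
    π b ^ suc s * (π b * t)    ≈⟨ solve 3 (λ x y t → y :* (x :* t) := x :* y :* t) refl (π b) (π b ^ suc s) t ⟩
    π b ^ suc (suc s) * t      ∎)
    where
    IH : π b ^ suc s ∣ g
    IH = π^-raise {b} {g} s (λ lt → u (ℕ.m<n⇒m<1+n lt)) d
           (π b * r , trans e (solve 3 (λ x p r → x :* p :* r := p :* (x :* r)) refl (π b) (π b ^ s) r))
    h = proj₁ IH
    e′ = proj₂ IH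
    eq : κ (suc s) * h + π b * D h ≈ π b * r
    eq = monic-injective (monic-^ s (monic-π b)) (begin
      π b ^ s * (κ (suc s) * h + π b * D h)  ≈⟨ sym (D-π^* b s h) ⟩
      D (π b ^ suc s * h)                    ≈⟨ D-cong (sym e′) ⟩
      D g                                    ≈⟨ e ⟩
      π b * π b ^ s * r                      ≈⟨ solve 3 (λ x p r → x :* p :* r := p :* (x :* r)) refl (π b) (π b ^ s) r ⟩
      π b ^ s * (π b * r)                    ∎)
    π∣κh : π b ∣ κ (suc s) * h
    π∣κh = r - D h , (begin
      κ (suc s) * h                              ≈⟨ solve 2 (λ y z → y := (y :+ z) :- z) refl _ (π b * D h) ⟩
      (κ (suc s) * h + π b * D h) - π b * D h    ≈⟨ +-congʳ eq ⟩
      π b * r - π b * D h                        ≈⟨ solve 3 (λ x y z → x :* y :- x :* z := x :* (y :- z)) refl (π b) r (D h) ⟩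
      π b * (r - D h)                            ∎)
    π∣h : π b ∣ h
    π∣h = unit-∣ (C-unit (u ℕ.≤-refl)) π∣κh
    t = proj₁ π∣h

  -- If y has a zero of order s at b, the second Taylor coefficient of y at b
  -- relative to the first one is determined by y₀, the s-th derivative of y
  -- up to a constant.
  Local : K.Carrier → Carrier → ℕ → Carrier → Set (c ⊔ ℓ)
  Local b y₀ s y = Σ Carrier λ q → y ≈ π b ^ s * q × κ (suc s) * D q * y₀ ≈[ π b ] D y₀ * q

  local-∣ : ∀ {b y₀ s y} → Local b y₀ s y → π b ^ s ∣ y
  local-∣ (q , e , _) = q , e

  local-zero : ∀ b y₀ → Local b y₀ 0 y₀
  local-zero b y₀ = y₀ , sym (*-identityˡ y₀) ,
    ≈⇒≈[] (*-congʳ (trans (*-congʳ κ-1) (*-identityˡ _)))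

  -- With g = (X - b)^(s+1) r, cancelling (X - b)^s in D g = a f gives (s+1) r ≡ a q modulo X - b,
  -- and differentiating once more gives (s+2) D r ≡ a D q. Both quotients thus change by compatible
  -- factors, and the relation to `y₀` survives.
  local-suc : ∀ {b y₀ f g} s → (∀ {j} → j ℕ.≤ s → K.IsUnit (K.ι (suc j))) → ∀ a →
              D g ≈ C a * f → π b ∣ g → Local b y₀ s f → Local b y₀ (suc s) g
  local-suc {b} {y₀} {f} {g} s u a e d (q , f≈ , rel) = r , g≈ , conclusion
    where
    raised : π b ^ suc s ∣ g
    raised = π^-raise {b} {g} s (λ lt → u (ℕ.<⇒≤ lt)) d
      (C a * q , trans e (trans (*-congˡ f≈) (solve 3 (λ a p q → a :* (p :* q) := p :* (a :* q)) refl (C a) (π b ^ s) q)))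
    r = proj₁ raised
    g≈ = proj₂ raised
    k₁ = κ (suc s)
    k₂ = κ (suc (suc s))
    eq₁ : k₁ * r + π b * D r ≈ C a * q
    eq₁ = monic-injective (monic-^ s (monic-π b)) (begin
      π b ^ s * (k₁ * r + π b * D r)   ≈⟨ sym (D-π^* b s r) ⟩
      D (π b ^ suc s * r)              ≈⟨ D-cong (sym g≈) ⟩
      D g                              ≈⟨ e ⟩
      C a * f                          ≈⟨ *-congˡ f≈ ⟩
      C a * (π b ^ s * q)              ≈⟨ solve 3 (λ a p q → a :* (p :* q) := p :* (a :* q)) refl (C a) (π b ^ s) q ⟩
      π b ^ s * (C a * q)              ∎)
    eq₂ : k₂ * D r + π b * D (D r) ≈ C a * D q
    eq₂ = begin
      k₂ * D r + π b * D (D r)                        ≈⟨ +-congʳ (*-congʳ (κ-suc (suc s))) ⟩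
      (1# + k₁) * D r + π b * D (D r)                 ≈⟨ solve 4 (λ k r′ x r″ → (con (+ 1) :+ k) :* r′ :+ x :* r″ := k :* r′ :+ (con (+ 1) :* r′ :+ x :* r″)) refl k₁ (D r) (π b) (D (D r)) ⟩
      k₁ * D r + (1# * D r + π b * D (D r))           ≈⟨ +-cong (sym (D-C* _ r)) (+-congʳ (*-congʳ (sym (D-π b)))) ⟩
      D (k₁ * r) + (D (π b) * D r + π b * D (D r))    ≈⟨ +-congˡ (sym (D-* _ _)) ⟩
      D (k₁ * r) + D (π b * D r)                      ≈⟨ sym (D-+ _ _) ⟩
      D (k₁ * r + π b * D r)                          ≈⟨ D-cong eq₁ ⟩
      D (C a * q)                                     ≈⟨ D-C* a q ⟩
      C a * D q                                       ∎
    module Q where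
      open CommutativeRing (quotient (π b)) public
      open Ideals (quotient (π b)) public using (unit-cancel; -‿≈0; ≈-from-0)
    π≈0 : π b ≈[ π b ] 0#
    π≈0 = ∣⇒≈0 (1# , sym (*-identityʳ _))
    drop : ∀ x y → x + π b * y ≈[ π b ] x
    drop x y = Q.trans (Q.+-congˡ (Q.trans (Q.*-congʳ π≈0) (Q.zeroˡ y))) (Q.+-identityʳ x)
    -- Multiplied by s + 1, the claim follows from eq₁ and eq₂ modulo π b.
    scaled : k₁ * (k₂ * D r * y₀) ≈[ π b ] k₁ * (D y₀ * r)
    scaled = Q.trans (≈⇒≈[] (solve 4 (λ k l r y → k :* (l :* r :* y) := k :* y :* (l :* r)) refl k₁ k₂ (D r) y₀))
      (Q.trans (Q.*-congˡ (Q.trans (Q.sym (drop _ (D (D r)))) (≈⇒≈[] eq₂)))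
      (Q.trans (≈⇒≈[] (solve 4 (λ k y a q → k :* y :* (a :* q) := a :* (k :* q :* y)) refl k₁ y₀ (C a) (D q)))
      (Q.trans (Q.*-congˡ rel)
      (Q.trans (≈⇒≈[] (solve 3 (λ a y q → a :* (y :* q) := y :* (a :* q)) refl (C a) (D y₀) q))
      (Q.trans (Q.*-congˡ (Q.trans (≈⇒≈[] (sym eq₁)) (drop _ (D r))))
      (≈⇒≈[] (solve 3 (λ k y r → y :* (k :* r) := k :* (y :* r)) refl k₁ (D y₀) r)))))))
    conclusion : k₂ * D r * y₀ ≈[ π b ] D y₀ * r
    conclusion = Q.≈-from-0 (Q.unit-cancel (unit⇒coprime (C-unit (u ℕ.≤-refl)))
      (Q.trans (≈⇒≈[] (solve 3 (λ k x y → k :* (x :- y) := k :* x :- k :* y) refl k₁ (k₂ * D r * y₀) (D y₀ * r))) (Q.-‿≈0 scaled)))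

-- Divided differences.

module DividedDifferences {c ℓ} (K : CommutativeRing c ℓ) (𝒫 : PolynomialRing K)
  (_⁻¹ : CommutativeRing.Carrier K → CommutativeRing.Carrier K)
  (⁻¹-inverse : ∀ {x} → Ideals.IsUnit K x →
    CommutativeRing._≈_ K (CommutativeRing._*_ K x (x ⁻¹)) (CommutativeRing.1# K)) where

  open Polynomials K 𝒫
  open Relation.Binary.Reasoning.Setoid setoid

  -- The divided difference of g at the nodes a ∷ as, up to the sign (-1)^|as|
  -- which makes the recurrence Δ-recurrence free of signs.
  Δ : K.Carrier → List K.Carrier → (K.Carrier → Carrier) → Carrier
  Δ a []       g = g a
  Δ a (b ∷ as) g = Δ b as (λ z → C ((a K.- z) ⁻¹) * (g z - g a))

  Δ-cong : ∀ {g h} a as → All (λ z → g z ≈ h z) (a ∷ as) → Δ a as g ≈ Δ a as h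
  Δ-cong a []       (e ∷ []) = e
  Δ-cong a (b ∷ as) (e ∷ es) = Δ-cong b as (All.map (λ e′ → *-congˡ (+-cong e′ (-‿cong e))) es)

  Δ-cong[] : ∀ {g h p} a as → All (λ z → g z ≈[ p ] h z) (a ∷ as) → Δ a as g ≈[ p ] Δ a as h
  Δ-cong[] a []       (e ∷ []) = e
  Δ-cong[] {p = p} a (b ∷ as) (e ∷ es) =
    Δ-cong[] b as (All.map (λ e′ → Q.*-congˡ (Q.+-cong e′ (Q.-‿cong e))) es)
    where module Q = CommutativeRing (quotient p)

  Δ-+ : ∀ {g h} a as → Δ a as (λ z → g z + h z) ≈ Δ a as g + Δ a as h
  Δ-+ a [] = refl
  Δ-+ {g} {h} a (b ∷ as) = trans
    (Δ-cong b as (All.universal (λ z → solve 5 (λ k x y u v → k :* ((x :+ y) :- (u :+ v)) := k :* (x :- u) :+ k :* (y :- v)) refl _ (g z) (h z) (g a) (h a)) _))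
    (Δ-+ b as)

  Δ-* : ∀ {g} u a as → Δ a as (λ z → u * g z) ≈ u * Δ a as g
  Δ-* u a [] = refl
  Δ-* {g} u a (b ∷ as) = trans
    (Δ-cong b as (All.universal (λ z → solve 4 (λ k u x y → k :* (u :* x :- u :* y) := u :* (k :* (x :- y))) refl _ u (g z) (g a)) _))
    (Δ-* u b as)

  Δ-D : ∀ {g} a as → D (Δ a as g) ≈ Δ a as (λ z → D (g z))
  Δ-D a [] = refl
  Δ-D {g} a (b ∷ as) = trans (Δ-D b as)
    (Δ-cong b as (All.universal (λ z → trans (D-C* _ _) (*-congˡ (D-- (g z) (g a)))) _))

  Δ-<° : ∀ {g N} a as → (∀ z → g z <° N) → Δ a as g <° N
  Δ-<° a []       lt = lt a
  Δ-<° a (b ∷ as) lt = Δ-<° b as (λ z → <°-C* _ (<°-+ (lt z) (<°-neg (lt a))))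

  Δ-0 : ∀ a as → Δ a as (λ _ → 0#) ≈ 0#
  Δ-0 a as = trans (Δ-cong a as (All.universal (λ z → sym (zeroˡ 0#)) _)) (trans (Δ-* {λ _ → 0#} 0# a as) (zeroˡ _))

  -- The Leibniz rule for divided differences when one factor, u - z, is linear in the node: its own
  -- divided difference over two nodes is -1, which the sign convention turns into 1.
  Δ-recurrence : ∀ {u g} a b as → Distinct (a ∷ b ∷ as) →
    Δ a (b ∷ as) (λ z → (u - C z) * g z) ≈ (u - C a) * Δ a (b ∷ as) g + Δ b as g
  Δ-recurrence {u} {g} a b as (us ∷ _) = begin
    Δ b as (λ z → C ((a K.- z) ⁻¹) * ((u - C z) * g z - (u - C a) * g a))
      ≈⟨ Δ-cong b as (All.map step us) ⟩
    Δ b as (λ z → (u - C a) * (C ((a K.- z) ⁻¹) * (g z - g a)) + g z)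
      ≈⟨ Δ-+ b as ⟩
    Δ b as (λ z → (u - C a) * (C ((a K.- z) ⁻¹) * (g z - g a))) + Δ b as g
      ≈⟨ +-congʳ (Δ-* (u - C a) b as) ⟩
    (u - C a) * Δ b as (λ z → C ((a K.- z) ⁻¹) * (g z - g a)) + Δ b as g ∎
    where
    step : ∀ {z} → K.IsUnit (a K.- z) →
      C ((a K.- z) ⁻¹) * ((u - C z) * g z - (u - C a) * g a) ≈ (u - C a) * (C ((a K.- z) ⁻¹) * (g z - g a)) + g z
    step {z} v = begin
      k * ((u - C z) * g z - (u - C a) * g a)
        -- Splitting (u - z) x - (u - a) y as (u - a)(x - y) + (a - z) x isolates the term in which
        -- `k` cancels.
        ≈⟨ solve 6 (λ k u z a x y → k :* ((u :- z) :* x :- (u :- a) :* y) := (u :- a) :* (k :* (x :- y)) :+ (a :- z) :* k :* x) refl k u (C z) (C a) (g z) (g a) ⟩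
      (u - C a) * (k * (g z - g a)) + (C a - C z) * k * g z
        ≈⟨ +-congˡ (*-congʳ (trans (*-congʳ (sym (C-- a z))) (trans (sym (C-* _ _)) (trans (C-cong (⁻¹-inverse v)) C-1)))) ⟩
      (u - C a) * (k * (g z - g a)) + 1# * g z
        ≈⟨ +-congˡ (*-identityˡ _) ⟩
      (u - C a) * (k * (g z - g a)) + g z ∎
      where k = C ((a K.- z) ⁻¹)

  Δ-1 : ∀ a b as → Δ a (b ∷ as) (λ _ → 1#) ≈ 0#
  Δ-1 a b as = trans (Δ-cong b as (All.universal (λ z → trans (*-congˡ (-‿inverseʳ 1#)) (zeroʳ _)) _)) (Δ-0 b as)

  -- In the node z the power has degree s, and more than s + 1 nodes annihilate it.
  Δ-low : ∀ u a as s → Distinct (a ∷ as) → s ℕ.< length as → Δ a as (λ z → (u - C z) ^ s) ≈ 0#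
  Δ-low u a (b ∷ as) zero    ds        lt       = Δ-1 a b as
  Δ-low u a (b ∷ as) (suc s) ds@(_ ∷ ds′) (s≤s lt) = begin
    Δ a (b ∷ as) (λ z → (u - C z) ^ suc s)
      ≈⟨ Δ-recurrence {u} {λ z → (u - C z) ^ s} a b as ds ⟩
    (u - C a) * Δ a (b ∷ as) (λ z → (u - C z) ^ s) + Δ b as (λ z → (u - C z) ^ s)
      ≈⟨ +-cong (*-congˡ (Δ-low u a (b ∷ as) s ds (ℕ.m<n⇒m<1+n lt))) (Δ-low u b as s ds′ lt) ⟩
    (u - C a) * 0# + 0#
      ≈⟨ trans (+-identityʳ _) (zeroʳ _) ⟩
    0# ∎

  -- Here the divided difference reads off the leading coefficient in z, which is (-1)^|as|; the
  -- sign built into `Δ` cancels it.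
  Δ-one : ∀ u a as → Distinct (a ∷ as) → Δ a as (λ z → (u - C z) ^ length as) ≈ 1#
  Δ-one u a []       ds = refl
  Δ-one u a (b ∷ as) ds@(_ ∷ ds′) = begin
    Δ a (b ∷ as) (λ z → (u - C z) ^ suc s)
      ≈⟨ Δ-recurrence {u} {λ z → (u - C z) ^ s} a b as ds ⟩
    (u - C a) * Δ a (b ∷ as) (λ z → (u - C z) ^ s) + Δ b as (λ z → (u - C z) ^ s)
      ≈⟨ +-cong (*-congˡ (Δ-low u a (b ∷ as) s ds ℕ.≤-refl)) (Δ-one u b as ds′) ⟩
    (u - C a) * 0# + 1#
      ≈⟨ trans (+-congʳ (zeroʳ _)) (+-identityˡ _) ⟩
    1# ∎
    where s = length as

  -- As a family in N these polynomials differentiate like the powers of X, by `D-ΔX^`. Zeros and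
  -- leading terms are therefore found by integrating from small N upwards.
  ΔX^ : K.Carrier → List K.Carrier → ℕ → Carrier
  ΔX^ a as N = Δ a as (λ z → π z ^ N)

  D-ΔX^ : ∀ a as N → D (ΔX^ a as (suc N)) ≈ κ (suc N) * ΔX^ a as N
  D-ΔX^ a as N = begin
    D (ΔX^ a as (suc N))                        ≈⟨ Δ-D a as ⟩
    Δ a as (λ z → D (π z ^ suc N))              ≈⟨ Δ-cong a as (All.universal (λ z → trans (D-^ (π z) N) (*-congˡ (trans (*-congˡ (D-π z)) (*-identityʳ _)))) _) ⟩
    Δ a as (λ z → κ (suc N) * π z ^ N)          ≈⟨ Δ-* (κ (suc N)) a as ⟩
    κ (suc N) * ΔX^ a as N                      ∎

  ΔX^-<° : ∀ a as N → ΔX^ a as N <° suc N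
  ΔX^-<° a as N = Δ-<° a as (λ z → <°-mono (s≤s (ℕ.≤-reflexive (ℕ.*-identityʳ N))) (above (monic-^ N (monic-π z))))

  -- The unit is the binomial coefficient of j + |as| over j: the step from j to j + 1 multiplies it
  -- by (j + |as| + 1) / (j + 1), and both integers are below p.
  ΔX^-top : ∀ p → (∀ {n} → suc n ℕ.< p → K.IsUnit (K.ι (suc n))) → ∀ a as → Distinct (a ∷ as) →
            ∀ j → j ℕ.+ length as ℕ.< p → Σ K.Carrier λ u → K.IsUnit u × Top j u (ΔX^ a as (j ℕ.+ length as))
  ΔX^-top p unit a as ds zero    lt = K.1# , K.unit-1 , top-resp K.refl (sym (Δ-one X a as ds)) top-1
  ΔX^-top p unit a as ds (suc j) lt with ΔX^-top p unit a as ds j (ℕ.<⇒≤ lt)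
  ... | u , u-unit , t = v , v-unit , mkTop top′ (deg above′)
    where
    N = j ℕ.+ length as
    F = ΔX^ a as (suc N)
    derivative : ∀ i → K.ι (suc i) K.* coef F (suc i) K.≈ K.ι (suc N) K.* coef (ΔX^ a as N) i
    derivative i = K.trans (K.sym (coef-D F i)) (K.trans (coef-cong (D-ΔX^ a as N) i) (coef-C* _ _ i))
    j<p : suc j ℕ.< p
    j<p = ℕ.≤-<-trans (s≤s (ℕ.m≤m+n j (length as))) lt
    i⁻¹ = proj₁ (unit j<p)
    v = i⁻¹ K.* (K.ι (suc N) K.* u)
    v-unit : K.IsUnit v
    v-unit = K.unit-* (K.ι (suc j) , K.trans (K.*-comm _ _) (proj₂ (unit j<p))) (K.unit-* (unit lt) u-unit)
    top′ : coef F (suc j) K.≈ v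
    top′ = K.trans (K.sym (K.*-identityˡ _)) (K.trans (K.*-congʳ (K.sym (proj₂ (unit j<p))))
      (K.trans (K.solve 3 (λ i k x → i K.:* k K.:* x K.:= k K.:* (i K.:* x)) K.refl (K.ι (suc j)) i⁻¹ _)
        (K.*-congˡ (K.trans (derivative j) (K.*-congˡ (top t))))))
    above′ : ∀ i → suc (suc j) ℕ.≤ i → coef F i K.≈ K.0#
    -- The derivative determines a coefficient only if its index is invertible. From index p on, the
    -- crude bound `ΔX^-<°` takes over, because the exponent itself is below p.
    above′ (suc i) (s≤s le) with suc i ℕ.<? p
    ... | yes i<p = K.unit-cancel (unit i<p) (K.trans (derivative i)
            (K.trans (K.*-congˡ (vanish (above t) i le)) (K.zeroʳ _)))
    ... | no  i≮p = vanish (ΔX^-<° a as (suc N)) (suc i) (ℕ.≤-trans lt (ℕ.≮⇒≥ i≮p))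

-- Fields of characteristic p and the auxiliary polynomial with high-order zeros.

record FieldOfCharacteristic {c ℓ} (p : ℕ) (K : CommutativeRing c ℓ) : Set (c ⊔ ℓ) where
  open CommutativeRing K
  open Ideals K
  field
    _⁻¹       : Carrier → Carrier
    ⁻¹-inverse : ∀ {x} → IsUnit x → x * x ⁻¹ ≈ 1#
    1≉0       : ¬ 1# ≈ 0#
    ι-unit    : ∀ {n} → suc n ℕ.< p → IsUnit (ι (suc n))
    ι-zero    : ι p ≈ 0#
    unit?     : ∀ x → ¬ x ≈ 0# → IsUnit x
    _≟_       : ∀ x y → Dec (x ≈ y)

module HansonPetridis {c ℓ} (K : CommutativeRing c ℓ) (𝒫 : PolynomialRing K)
  (p : ℕ) (F : FieldOfCharacteristic p K) where

  open FieldOfCharacteristic F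
  open Polynomials K 𝒫
  open Multiplicity K 𝒫
  open DividedDifferences K 𝒫 _⁻¹ ⁻¹-inverse
  open Relation.Binary.Reasoning.Setoid setoid

  private
    module Q b = CommutativeRing (quotient (π b))
    module QI b = Ideals (quotient (π b))

  -- A node z is the negative of an element of A, so b - z is an element of A + B and ε is 1; with A
  -- and B exchanged the difference changes sign and ε becomes (-1)^d.
  PowerIs : ℕ → K.Carrier → K.Carrier → K.Carrier → Set ℓ
  PowerIs d ε b z = (b K.- z) K.^ d K.≈ ε

  π≈C- : ∀ b z → π z ≈[ π b ] C (b K.- z)
  π≈C- b z = Q.trans b (Q.+-congʳ b (X≈C[π] b)) (≈⇒≈[] (sym (C-- b z)))

  π^≈ε : ∀ d {ε b z} → PowerIs d ε b z → π z ^ d ≈[ π b ] C ε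
  π^≈ε d {ε} {b} {z} h = Q.trans b (π∣-^ d (π≈C- b z)) (≈⇒≈[] (C-cong h))

  -- Modulo X - b, the d-th power of each X - z is the same constant ε, which leaves the divided
  -- difference by linearity.
  ΔX^-reduce : ∀ d {ε b} a as → All (PowerIs d ε b) (a ∷ as) →
               ∀ s → ΔX^ a as (d ℕ.+ s) ≈[ π b ] C ε * ΔX^ a as s
  ΔX^-reduce d {ε} {b} a as hs s = Q.trans b
    (Δ-cong[] a as (All.map (λ {z} h → Q.trans b (≈⇒≈[] (^-homo-* (π z) d s)) (Q.*-congʳ b (π^≈ε d h))) hs))
    (≈⇒≈[] (Δ-* (C ε) a as))

  -- Modulo X - b the powers π z ^ (d-1) and π z ^ (d-2) act as ε/(b-z) and
  -- ε/(b-z)², whose divided differences are explicit.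
  ΔX^-inverse : ∀ {e ε b} → K.IsUnit ε → ∀ a as → Distinct (a ∷ as) → All (PowerIs (suc (suc e)) ε b) (a ∷ as) →
    Coprime (π b) (Π (a ∷ as) * ΔX^ a as (suc e)) ×
    Π (a ∷ as) * ΔX^ a as e ≈[ π b ] D (Π (a ∷ as)) * ΔX^ a as (suc e)
  ΔX^-inverse {e} {ε} {b} u a [] ds (h ∷ []) =
    coprime-resp (Q.trans b (Q.sym b (π^≈ε (suc (suc e)) {ε} {b} {a} h)) (≈⇒≈[] (*-congʳ (sym (*-identityʳ _))))) (unit⇒coprime (C-unit u)) ,
    ≈⇒≈[] (begin
      π a * 1# * π a ^ e            ≈⟨ solve 2 (λ x y → x :* con (+ 1) :* y := con (+ 1) :* (x :* y)) refl (π a) (π a ^ e) ⟩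
      1# * (π a * π a ^ e)          ≈⟨ *-congʳ (sym (trans (D-cong (*-identityʳ _)) (D-π a))) ⟩
      D (π a * 1#) * (π a * π a ^ e) ∎)
  ΔX^-inverse {e} {ε} {b} u a as@(a′ ∷ as′) ds@(_ ∷ ds′) hs@(_ ∷ hs′) =
    coprime-resp (Q.sym b Qf≈) (QI.unit-neg b (proj₁ IH)) , Qg≈
    where
    IH = ΔX^-inverse {e} {ε} {b} u a′ as′ ds′ hs′
    q = Π as
    f = ΔX^ a as (suc e)
    g = ΔX^ a as e
    f′ = ΔX^ a′ as′ (suc e)
    g′ = ΔX^ a′ as′ e
    -- The exponent d reduces to ε times the divided difference of 1, which is 0 over two or more
    -- nodes; the recurrence then relates the exponents d - 1 for the long and the short list.
    πf : π a * f ≈[ π b ] - f′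
    πf = QI.≈-from-0 b (Q.trans b (≈⇒≈[] (begin
        π a * f - (- f′)        ≈⟨ solve 2 (λ x y → x :- (:- y) := x :+ y) refl (π a * f) f′ ⟩
        π a * f + f′            ≈⟨ sym (Δ-recurrence {X} {λ z → π z ^ suc e} a a′ as′ ds) ⟩
        ΔX^ a as (suc (suc e))  ≈⟨ reflexive (≡.cong (ΔX^ a as) (≡.sym (ℕ.+-identityʳ (suc (suc e))))) ⟩
        ΔX^ a as (suc (suc e) ℕ.+ 0) ∎))
      (Q.trans b (ΔX^-reduce (suc (suc e)) a as hs 0) (≈⇒≈[] (trans (*-congˡ (Δ-1 a a′ as′)) (zeroʳ _)))))
    -- The same recurrence one exponent lower; its left side is the exponent d - 1, so no reduction
    -- modulo X - b is involved.
    πg : π a * g ≈ f - g′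
    πg = begin
      π a * g              ≈⟨ solve 2 (λ x y → x := (x :+ y) :- y) refl (π a * g) g′ ⟩
      (π a * g + g′) - g′  ≈⟨ +-congʳ (sym (Δ-recurrence {X} {λ z → π z ^ e} a a′ as′ ds)) ⟩
      f - g′               ∎
    Qf≈ : π a * q * f ≈[ π b ] - (q * f′)
    Qf≈ = Q.trans b (≈⇒≈[] (solve 3 (λ x y z → x :* y :* z := y :* (x :* z)) refl (π a) q f))
      (Q.trans b (Q.*-congˡ b πf) (≈⇒≈[] (solve 2 (λ x y → x :* (:- y) := :- (x :* y)) refl q f′)))
    Qg≈ : π a * q * g ≈[ π b ] D (π a * q) * f
    Qg≈ = Q.trans b (≈⇒≈[] (begin
        π a * q * g               ≈⟨ solve 3 (λ x y z → x :* y :* z := y :* (x :* z)) refl (π a) q g ⟩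
        q * (π a * g)             ≈⟨ *-congˡ πg ⟩
        q * (f - g′)              ≈⟨ solve 3 (λ q f g → q :* (f :- g) := q :* f :- q :* g) refl q f g′ ⟩
        q * f - q * g′            ∎))
      (Q.trans b (Q.+-congˡ b (Q.-‿cong b (proj₂ IH)))
      (Q.trans b (≈⇒≈[] (solve 4 (λ q f d g → q :* f :- d :* g := q :* f :+ d :* (:- g)) refl q f (D q) f′))
      (Q.trans b (Q.+-congˡ b (Q.*-congˡ b (Q.sym b πf)))
      (≈⇒≈[] (begin
        q * f + D q * (π a * f)       ≈⟨ solve 4 (λ q f d x → q :* f :+ d :* (x :* f) := (con (+ 1) :* q :+ x :* d) :* f) refl q f (D q) (π a) ⟩
        (1# * q + π a * D q) * f      ≈⟨ *-congʳ (+-congʳ (*-congʳ (sym (D-π a)))) ⟩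
        (D (π a) * q + π a * D q) * f ≈⟨ *-congʳ (sym (D-* _ _)) ⟩
        D (π a * q) * f               ∎)))))

  -- The parameter ε allows a second use with A and B exchanged. `small` puts the exponent d + m - 1
  -- below p.
  module Stepanov (e : ℕ) (a : K.Carrier) (as bs : List K.Carrier) (ε : K.Carrier) (ε-unit : K.IsUnit ε)
    (as-distinct : Distinct (a ∷ as)) (bs-distinct : Distinct bs)
    (powers : All (λ b → All (PowerIs (suc (suc e)) ε b) (a ∷ as)) bs)
    (small : suc (suc e) ℕ.+ length as ℕ.< p) where

    private
      d = suc (suc e)
      l = length as
      m = suc l
      F′ = ΔX^ a as

    -- The exponent d + m - 1 is written as m + (d - 1), since G arises from exponent d - 1 by m
    -- integrations; ε is the common value at the points of B.
    G : Carrier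
    G = F′ (m ℕ.+ suc e) - C ε

    exponent : ∀ s → suc s ℕ.+ suc e ≡ d ℕ.+ s
    exponent s = ≡.cong suc (ℕ.+-comm s (suc e))

    j-unit : ∀ {s} → s ℕ.≤ l → ∀ {j} → j ℕ.≤ s → K.IsUnit (K.ι (suc j))
    j-unit s≤l j≤s = ι-unit (ℕ.≤-<-trans (ℕ.≤-trans (s≤s (ℕ.≤-trans j≤s s≤l)) (ℕ.+-monoˡ-≤ l (s≤s (z≤n {suc e})))) small)

    -- Each integration meets a zero at b: exponent d + s reduces to s, where `Δ-low` gives 0 as
    -- long as s < l. At s = l `Δ-one` gives the value ε, which the constant in `G` removes.
    G-local : ∀ {b} → All (PowerIs d ε b) (a ∷ as) → Local b (F′ (suc e)) m G
    G-local {b} hs = local-suc l (j-unit ℕ.≤-refl) _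
      (trans (D-- _ _) (trans (+-congˡ (-‿cong (D-C ε))) (trans (solve 1 (λ x → x :- con (+ 0) := x) refl _) (D-ΔX^ a as (l ℕ.+ suc e)))))
      (divides (Q.trans b (≈⇒≈[] (reflexive (≡.cong F′ (exponent l))))
        (Q.trans b (ΔX^-reduce d a as hs l) (≈⇒≈[] (trans (*-congˡ (Δ-one X a as as-distinct)) (*-identityʳ _))))))
      (tower l ℕ.≤-refl)
      where
      tower : ∀ s → s ℕ.≤ l → Local b (F′ (suc e)) s (F′ (s ℕ.+ suc e))
      tower zero    _   = local-zero b _
      tower (suc s) s<l = local-suc s (j-unit (ℕ.<⇒≤ s<l)) _ (D-ΔX^ a as (s ℕ.+ suc e))
        (≈0⇒∣ (Q.trans b (≈⇒≈[] (reflexive (≡.cong F′ (exponent s))))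
          (Q.trans b (ΔX^-reduce d a as hs s) (≈⇒≈[] (trans (*-congˡ (Δ-low X a as s as-distinct s<l)) (zeroʳ _))))))
        (tower s (ℕ.<⇒≤ s<l))

    P^m∣G : Π bs ^ m ∣ G
    P^m∣G = Π^-∣ m bs-distinct (All.map π^m∣G powers)
      where
      π^m∣G : ∀ {b} → All (PowerIs d ε b) (a ∷ as) → π b ^ m ∣ G
      π^m∣G {b} hs = local-∣ {b} {F′ (suc e)} {m} {G} (G-local {b} hs)

    G-top : Σ K.Carrier λ u → K.IsUnit u × Top d u G
    G-top = proj₁ F-top , proj₁ (proj₂ F-top) ,
      top-+ˡ (top-resp K.refl (reflexive (≡.cong F′ (≡.sym (exponent l)))) (proj₂ (proj₂ F-top)))
             (<°-neg (<°-mono (s≤s z≤n) (<°-C ε)))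
      where F-top = ΔX^-top p ι-unit a as as-distinct d small

    size-bound : m ℕ.* length bs ℕ.≤ d
    size-bound = monic-∣-degree 1≉0 (monic-^ m (monic-Π bs)) (proj₂ (proj₂ G-top)) (proj₁ (proj₂ G-top)) P^m∣G

    P Q′ : Carrier
    P  = Π bs
    Q′ = Π (a ∷ as)

    half-equation : Carrier
    half-equation = κ m * κ (suc m) * (D (D P) * Q′) - κ 2 * κ (suc e) * (D P * D Q′)

    -- Once mn = d, G is a constant times P^m. With P = (X - b) P₁ the quotient q in `Local` is
    -- therefore v P₁^m, so the relation there becomes one between D P₁ and the divided differences
    -- of exponents d - 1 and d - 2. Modulo X - b, moreover, D P is P₁ and D (D P) is 2 D P₁.
    P∣half-equation : m ℕ.* length bs ≡ d → P ∣ half-equation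
    P∣half-equation md = Π-∣ bs-distinct (All.zipWith (λ { {b} (hs , cof) → at b hs cof }) (powers , Π-cofactors bs-distinct))
      where
      v = proj₁ G-top
      v-unit = proj₁ (proj₂ G-top)
      G≈ : G ≈ C v * P ^ m
      G≈ = monic-∣-same (≡.subst (λ N → Monic N (P ^ m)) md (monic-^ m (monic-Π bs))) (proj₂ (proj₂ G-top)) P^m∣G
      at : ∀ b → All (PowerIs d ε b) (a ∷ as) → Cofactor P b → π b ∣ half-equation
      at b hs (P₁ , P≈ , P₁-unit) = conclusion
        where
        module B where
          open CommutativeRing (quotient (π b)) public
          open Ideals (quotient (π b)) public
        f = F′ (suc e)
        g = F′ e
        loc = G-local hs
        q = proj₁ loc
        inv = ΔX^-inverse {e} ε-unit a as as-distinct hs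
        k₁ = κ m
        k₂ = κ (suc m)
        q≈ : q ≈ C v * P₁ ^ m
        q≈ = monic-injective (monic-^ m (monic-π b)) (begin
          π b ^ m * q                ≈⟨ sym (proj₁ (proj₂ loc)) ⟩
          G                          ≈⟨ G≈ ⟩
          C v * P ^ m                ≈⟨ *-congˡ (trans (^-congˡ m P≈) (^-distrib-* (π b) P₁ m)) ⟩
          C v * (π b ^ m * P₁ ^ m)   ≈⟨ solve 3 (λ v x y → v :* (x :* y) := x :* (v :* y)) refl (C v) (π b ^ m) (P₁ ^ m) ⟩
          π b ^ m * (C v * P₁ ^ m)   ∎)
        U = C v * P₁ ^ l
        Dq≈ : D q ≈ U * (k₁ * D P₁)
        Dq≈ = begin
          D q                               ≈⟨ D-cong q≈ ⟩
          D (C v * P₁ ^ m)                  ≈⟨ D-C* v _ ⟩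
          C v * D (P₁ ^ m)                  ≈⟨ *-congˡ (D-^ P₁ l) ⟩
          C v * (k₁ * (P₁ ^ l * D P₁))      ≈⟨ solve 4 (λ v k p x → v :* (k :* (p :* x)) := v :* p :* (k :* x)) refl (C v) k₁ (P₁ ^ l) (D P₁) ⟩
          U * (k₁ * D P₁)                   ∎
        U-unit : Coprime (π b) U
        U-unit = coprime-*ʳ (unit⇒coprime (C-unit v-unit)) (coprime-^ʳ l P₁-unit)
        cancel : ∀ {u x y} → Coprime (π b) u → u * x ≈[ π b ] u * y → x ≈[ π b ] y
        cancel {u} {x} {y} w h = B.≈-from-0 (B.unit-cancel w
          (B.trans (≈⇒≈[] (solve 3 (λ u x y → u :* (x :- y) := u :* x :- u :* y) refl u x y)) (B.-‿≈0 h)))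
        -- The relation in `Local` after cancelling v P₁^(m-1), which is a unit modulo X - b because
        -- b is a simple root of P.
        rel₁ : k₂ * (k₁ * D P₁) * f ≈[ π b ] κ (suc e) * g * P₁
        rel₁ = cancel U-unit (B.trans (≈⇒≈[] (begin
            U * (k₂ * (k₁ * D P₁) * f)       ≈⟨ solve 4 (λ u k x f → u :* (k :* x :* f) := k :* (u :* x) :* f) refl U k₂ (k₁ * D P₁) f ⟩
            k₂ * (U * (k₁ * D P₁)) * f       ≈⟨ *-congʳ (*-congˡ (sym Dq≈)) ⟩
            k₂ * D q * f                     ∎))
          (B.trans (proj₂ (proj₂ loc)) (≈⇒≈[] (begin
            D f * q                                      ≈⟨ *-cong (D-ΔX^ a as e) q≈ ⟩
            κ (suc e) * g * (C v * (P₁ * P₁ ^ l))        ≈⟨ solve 4 (λ x v p r → x :* (v :* (p :* r)) := v :* r :* (x :* p)) refl (κ (suc e) * g) (C v) P₁ (P₁ ^ l) ⟩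
            U * (κ (suc e) * g * P₁)                     ∎))))
        f-unit : Coprime (π b) f
        f-unit = B.unit-factorˡ (coprime-resp (≈⇒≈[] (*-comm _ _)) (proj₁ inv))
        -- Multiplication by Q′ allows `ΔX^-inverse` to trade Q′ g for D Q′ f; then f cancels and no
        -- divided difference is left.
        rel₂ : k₂ * (k₁ * D P₁) * Q′ ≈[ π b ] κ (suc e) * P₁ * D Q′
        rel₂ = cancel f-unit (B.trans (≈⇒≈[] (solve 3 (λ f x q → f :* (x :* q) := x :* f :* q) refl f (k₂ * (k₁ * D P₁)) Q′))
          (B.trans (B.*-congʳ rel₁)
          (B.trans (≈⇒≈[] (solve 4 (λ k g x q → k :* g :* x :* q := k :* x :* (q :* g)) refl (κ (suc e)) g P₁ Q′))
          (B.trans (B.*-congˡ (proj₂ inv))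
          (≈⇒≈[] (solve 4 (λ k x q f → k :* x :* (q :* f) := f :* (k :* x :* q)) refl (κ (suc e)) P₁ (D Q′) f))))))
        DP : D P ≈ P₁ + π b * D P₁
        DP = trans (D-cong P≈) (trans (D-* _ _) (+-congʳ (trans (*-congʳ (D-π b)) (*-identityˡ _))))
        DDP : D (D P) ≈ (D P₁ + D P₁) + π b * D (D P₁)
        DDP = trans (D-cong DP) (trans (D-+ _ _) (trans (+-congˡ (trans (D-* _ _)
          (+-congʳ (trans (*-congʳ (D-π b)) (*-identityˡ _))))) (sym (+-assoc _ _ _))))
        drop : ∀ x y → x + π b * y ≈[ π b ] x
        drop x y = B.trans (B.+-congˡ (B.trans (B.*-congʳ (∣⇒≈0 (1# , sym (*-identityʳ _)))) (B.zeroˡ y))) (B.+-identityʳ x)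
        conclusion : π b ∣ half-equation
        conclusion = divides (B.trans
          (B.*-congˡ (B.*-congʳ (B.trans (≈⇒≈[] DDP) (drop _ _))))
          (B.trans (≈⇒≈[] (solve 4 (λ k l x q → k :* l :* ((x :+ x) :* q) := con (+ 2) :* (l :* (k :* x) :* q)) refl k₁ k₂ (D P₁) Q′))
          (B.trans (B.*-congˡ rel₂)
          (B.trans (≈⇒≈[] (trans (solve 3 (λ k x q → con (+ 2) :* (k :* x :* q) := con (+ 2) :* k :* (x :* q)) refl (κ (suc e)) P₁ (D Q′))
              (*-congʳ (*-congʳ (sym κ-2)))))
            (B.*-congˡ (B.*-congʳ (B.sym (B.trans (≈⇒≈[] DP) (drop _ _)))))))))
          where
          κ-2 : κ 2 ≈ 1# + 1#
          κ-2 = trans (κ-suc 1) (+-congˡ κ-1)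

-- The first coefficient in which a polynomial differs from a power.

module Gaps {c ℓ} (K : CommutativeRing c ℓ) (𝒫 : PolynomialRing K) where

  open Polynomials K 𝒫
  open Relation.Binary.Reasoning.Setoid setoid

  ∏ : List K.Carrier → (K.Carrier → Carrier) → Carrier
  ∏ []       g = 1#
  ∏ (a ∷ as) g = g a * ∏ as g

  ∏-cong : ∀ {g h} as → (∀ a → g a ≈ h a) → ∏ as g ≈ ∏ as h
  ∏-cong []       e = refl
  ∏-cong (a ∷ as) e = *-cong (e a) (∏-cong as e)

  ∏-^ : ∀ {g} n as → ∏ as (λ a → g a ^ n) ≈ ∏ as g ^ n
  ∏-^ n []       = sym (1^ n)
    where
    1^ : ∀ n → 1# ^ n ≈ 1#
    1^ zero    = refl
    1^ (suc n) = trans (*-identityˡ _) (1^ n)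
  ∏-^ {g} n (a ∷ as) = trans (*-congˡ (∏-^ n as)) (sym (^-distrib-* (g a) _ n))

  monic-∏ : ∀ {N g} as → (∀ a → Monic N (g a)) → Monic (length as ℕ.* N) (∏ as g)
  monic-∏ []       t = top-1
  monic-∏ (a ∷ as) t = monic-* (t a) (monic-∏ as t)

  -- Composition, by Horner's scheme on the first N coefficients

  shift-cong : ∀ {f g} → f ≈ g → shift f ≈ shift g
  shift-cong e = ext λ i → K.trans (coef-shift _ i) (K.trans (coef-cong e (suc i)) (K.sym (coef-shift _ i)))

  shift-+ : ∀ f g → shift (f + g) ≈ shift f + shift g
  shift-+ f g = ext λ i → K.trans (coef-shift _ i) (K.trans (coef-+ f g (suc i))
    (K.sym (K.trans (coef-+ _ _ i) (K.+-cong (coef-shift f i) (coef-shift g i)))))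

  shift-C* : ∀ a f → shift (C a * f) ≈ C a * shift f
  shift-C* a f = ext λ i → K.trans (coef-shift _ i) (K.trans (coef-C* a f (suc i))
    (K.sym (K.trans (coef-C* a _ i) (K.*-congˡ (coef-shift f i)))))

  shift-X* : ∀ f → shift (X * f) ≈ f
  shift-X* f = ext λ i → K.trans (coef-shift _ i) (coef-X*₊ f i)

  shift-top : ∀ {N a f} → Top (suc N) a f → Top N a (shift f)
  shift-top t = mkTop (K.trans (coef-shift _ _) (top t))
    (deg λ i le → K.trans (coef-shift _ i) (vanish (above t) (suc i) (s≤s le)))

  comp : Carrier → ℕ → Carrier → Carrier
  comp u zero    f = 0#
  comp u (suc N) f = C (coef f 0) + u * comp u N (shift f)

  comp-cong : ∀ {u f g} N → f ≈ g → comp u N f ≈ comp u N g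
  comp-cong zero    e = refl
  comp-cong (suc N) e = +-cong (C-cong (coef-cong e 0)) (*-congˡ (comp-cong N (shift-cong e)))

  comp-+ : ∀ u N f g → comp u N (f + g) ≈ comp u N f + comp u N g
  comp-+ u zero    f g = sym (+-identityˡ 0#)
  comp-+ u (suc N) f g = begin
    C (coef (f + g) 0) + u * comp u N (shift (f + g))
      ≈⟨ +-cong (trans (C-cong (coef-+ f g 0)) (C-+ _ _)) (*-congˡ (trans (comp-cong N (shift-+ f g)) (comp-+ u N _ _))) ⟩
    (C (coef f 0) + C (coef g 0)) + u * (comp u N (shift f) + comp u N (shift g))
      ≈⟨ solve 5 (λ a b u x y → (a :+ b) :+ u :* (x :+ y) := (a :+ u :* x) :+ (b :+ u :* y)) refl _ _ u _ _ ⟩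
    comp u (suc N) f + comp u (suc N) g ∎

  comp-C* : ∀ u N a f → comp u N (C a * f) ≈ C a * comp u N f
  comp-C* u zero    a f = sym (zeroʳ _)
  comp-C* u (suc N) a f = begin
    C (coef (C a * f) 0) + u * comp u N (shift (C a * f))
      ≈⟨ +-cong (trans (C-cong (coef-C* a f 0)) (C-* _ _)) (*-congˡ (trans (comp-cong N (shift-C* a f)) (comp-C* u N a _))) ⟩
    C a * C (coef f 0) + u * (C a * comp u N (shift f))
      ≈⟨ solve 4 (λ a b u x → a :* b :+ u :* (a :* x) := a :* (b :+ u :* x)) refl (C a) _ u _ ⟩
    C a * comp u (suc N) f ∎

  comp-X* : ∀ u N f → comp u (suc N) (X * f) ≈ u * comp u N f
  comp-X* u N f = trans (+-cong (trans (C-cong (coef-X*₀ f)) C-0) (*-congˡ (comp-cong N (shift-X* f)))) (+-identityˡ _)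

  comp-X^* : ∀ u N k f → comp u (k ℕ.+ N) (X ^ k * f) ≈ u ^ k * comp u N f
  comp-X^* u N zero    f = trans (comp-cong N (*-identityˡ f)) (sym (*-identityˡ _))
  comp-X^* u N (suc k) f = begin
    comp u (suc (k ℕ.+ N)) (X * X ^ k * f)     ≈⟨ comp-cong (suc (k ℕ.+ N)) (*-assoc _ _ _) ⟩
    comp u (suc (k ℕ.+ N)) (X * (X ^ k * f))   ≈⟨ comp-X* u (k ℕ.+ N) _ ⟩
    u * comp u (k ℕ.+ N) (X ^ k * f)           ≈⟨ *-congˡ (comp-X^* u N k f) ⟩
    u * (u ^ k * comp u N f)                   ≈⟨ sym (*-assoc _ _ _) ⟩
    u ^ suc k * comp u N f                     ∎

  comp-stable : ∀ u N k f → f <° N → comp u (k ℕ.+ N) f ≈ comp u N f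
  comp-stable u zero    zero    f z = refl
  comp-stable u zero    (suc k) f z = trans (+-cong (trans (C-cong (vanish z 0 z≤n)) C-0)
    (trans (*-congˡ (comp-stable u zero k (shift f) (deg λ i _ → K.trans (coef-shift f i) (vanish z (suc i) z≤n)))) (zeroʳ u))) (+-identityˡ _)
  comp-stable u (suc N) k       f z = trans (reflexive (≡.cong (λ M → comp u M f) (ℕ.+-suc k N)))
    (+-congˡ (*-congˡ (comp-stable u N k (shift f) (deg λ i le → K.trans (coef-shift f i) (vanish z (suc i) (s≤s le))))))

  comp-Π : ∀ u as → comp u (suc (length as)) (Π as) ≈ ∏ as (λ a → u - C a)
  comp-Π u [] = begin
    C (coef 1# 0) + u * 0#  ≈⟨ +-cong (C-cong (top top-1)) (zeroʳ u) ⟩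
    C K.1# + 0#             ≈⟨ trans (+-identityʳ _) C-1 ⟩
    1#                      ∎
  comp-Π u (a ∷ as) = begin
    comp u (suc N) (π a * Π as)                              ≈⟨ comp-cong (suc N) split ⟩
    comp u (suc N) (X * Π as + C (K.- a) * Π as)             ≈⟨ comp-+ u (suc N) _ _ ⟩
    comp u (suc N) (X * Π as) + comp u (suc N) (C (K.- a) * Π as)
      ≈⟨ +-cong (comp-X* u N _) (trans (comp-C* u (suc N) _ _) (*-cong (C-neg a) (comp-stable u N 1 (Π as) (above (monic-Π as))))) ⟩
    u * comp u N (Π as) + - C a * comp u N (Π as)            ≈⟨ solve 3 (λ u a x → u :* x :+ (:- a) :* x := (u :- a) :* x) refl u (C a) _ ⟩
    (u - C a) * comp u N (Π as)                              ≈⟨ *-congˡ (comp-Π u as) ⟩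
    (u - C a) * ∏ as (λ a → u - C a)                         ∎
    where
    N = suc (length as)
    split : π a * Π as ≈ X * Π as + C (K.- a) * Π as
    split = trans (distribʳ _ _ _) (+-congˡ (*-congʳ (sym (C-neg a))))

  comp-X^ : ∀ u n → comp u (suc n) (X ^ n) ≈ u ^ n
  comp-X^ u n = begin
    comp u (suc n) (X ^ n)          ≈⟨ comp-cong (suc n) (sym (*-identityʳ _)) ⟩
    comp u (suc n) (X ^ n * 1#)     ≈⟨ reflexive (≡.cong (λ N → comp u N (X ^ n * 1#)) (ℕ.+-comm 1 n)) ⟩
    comp u (n ℕ.+ 1) (X ^ n * 1#)   ≈⟨ comp-X^* u 1 n 1# ⟩
    u ^ n * comp u 1 1#             ≈⟨ *-congˡ (comp-Π u []) ⟩
    u ^ n * 1#                      ≈⟨ *-identityʳ _ ⟩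
    u ^ n                           ∎

  -- As `u` is linear, the powers below the N-th contribute only below degree N.
  comp-top : ∀ {u v} → Top 1 v u → ∀ N {e f} → Top N e f → Top N (v K.^ N K.* e) (comp u (suc N) f)
  comp-top {u} {v} tu zero {e} {f} t = top-resp (K.trans (coef-C₀ _) (K.trans (top t) (K.sym (K.*-identityˡ e))))
    (trans (sym (+-identityʳ _)) (+-congˡ (sym (zeroʳ u)))) (top-coef (<°-C _))
  comp-top {u} {v} tu (suc N) {e} {f} t = top-resp (K.sym (K.*-assoc _ _ _)) (+-comm _ _)
    (top-+ˡ (top-* tu (comp-top tu N (shift-top t))) (<°-mono (s≤s z≤n) (<°-C _)))

  -- Diff k N e f g: the polynomials f and g of degree N agree down to degree
  -- N - k + 1, and the coefficient of f - g in degree N - k is e (0 if k > N).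
  -- The factor X^k replaces the subtraction N - k.
  record Diff (k N : ℕ) (e : K.Carrier) (f g : Carrier) : Set ℓ where
    constructor diff
    field top-diff : Top N e (X ^ k * (f - g))

  open Diff public

  diff-resp : ∀ {k N e e′ f f′ g g′} → e K.≈ e′ → f ≈ f′ → g ≈ g′ → Diff k N e f g → Diff k N e′ f′ g′
  diff-resp p q r (diff t) = diff (top-resp p (*-congˡ (+-cong q (-‿cong r))) t)

  diff-refl : ∀ k N f → Diff k N K.0# f f
  diff-refl k N f = diff (<°⇒top (<°-resp (sym (trans (*-congˡ (-‿inverseʳ f)) (zeroʳ _))) <°-0))

  diff-trans : ∀ {k N e e′ f g h} → Diff k N e f g → Diff k N e′ g h → Diff k N (e K.+ e′) f h
  diff-trans {k} {f = f} {g} {h} (diff s) (diff t) = diff (top-resp K.refl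
    (solve 4 (λ x f g h → x :* (f :- g) :+ x :* (g :- h) := x :* (f :- h)) refl (X ^ k) f g h) (top-+ s t))

  diff-+ : ∀ {k N e e′ f f₀ g g₀} → Diff k N e f f₀ → Diff k N e′ g g₀ → Diff k N (e K.+ e′) (f + g) (f₀ + g₀)
  diff-+ {k} {f = f} {f₀} {g} {g₀} (diff s) (diff t) = diff (top-resp K.refl
    (solve 5 (λ x f a g b → x :* (f :- a) :+ x :* (g :- b) := x :* ((f :+ g) :- (a :+ b))) refl (X ^ k) f f₀ g g₀) (top-+ s t))

  diff-C* : ∀ {k N e f g} a → Diff k N e f g → Diff k N (a K.* e) (C a * f) (C a * g)
  diff-C* {k} {f = f} {g} a (diff s) = diff (top-resp K.refl
    (solve 4 (λ x a f g → a :* (x :* (f :- g)) := x :* (a :* f :- a :* g)) refl (X ^ k) (C a) f g) (top-C* a s))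

  -- Expand f g - f₀ g₀ into f₀ (g - g₀) + (f - f₀) g₀ and the product of the two differences. The
  -- latter loses the gap twice, so it lies strictly lower; for this the gap must be positive, hence
  -- the index `suc k`.
  diff-* : ∀ {k M N a b e e′ f f₀ g g₀} → Top M a f₀ → Top N b g₀ →
           Diff (suc k) M e f f₀ → Diff (suc k) N e′ g g₀ →
           Diff (suc k) (M ℕ.+ N) (a K.* e′ K.+ e K.* b) (f * g) (f₀ * g₀)
  diff-* {k} {M} {N} {f = f} {f₀} {g} {g₀} s t (diff u) (diff v) = diff (top-resp K.refl
    (solve 5 (λ x f a g b → (a :* (x :* (g :- b)) :+ x :* (f :- a) :* b) :+ x :* (f :- a) :* (g :- b) := x :* (f :* g :- a :* b)) refl (X ^ suc k) f f₀ g g₀)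
    (top-+ˡ (top-+ (top-* s v) (top-* u t)) (<°-X^*⁻¹ k (<°-mono (ℕ.m≤n+m _ k) (<°-X*⁻¹ low)))))
    where
    low : X * (X ^ k * (X ^ suc k * (f - f₀) * (g - g₀))) <° suc (M ℕ.+ N)
    low = <°-resp (solve 4 (λ x y p q → x :* y :* p :* (x :* y :* q) := x :* (y :* (x :* y :* p :* q))) refl X (X ^ k) (f - f₀) (g - g₀))
            (<°-* (above u) (above v))

  diff-^ : ∀ {k N e f f₀} n → Monic N f₀ → Diff (suc k) N e f f₀ → Diff (suc k) (n ℕ.* N) (K.ι n K.* e) (f ^ n) (f₀ ^ n)
  diff-^ {k} {e = e} zero    s u = diff-resp (K.sym (K.zeroˡ e)) refl refl (diff-refl (suc k) 0 1#)
  diff-^ {k} {e = e} (suc n) s u = diff-resp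
    (K.solve 2 (λ e n → K.con (+ 1) K.:* (n K.:* e) K.:+ e K.:* K.con (+ 1) K.:= (K.con (+ 1) K.:+ n) K.:* e) K.refl e (K.ι n))
    refl refl (diff-* s (monic-^ n s) u (diff-^ n s u))

  diff-∏ : ∀ {k N e f f₀} as → (∀ a → Monic N (f₀ a)) → (∀ a → Diff (suc k) N e (f a) (f₀ a)) →
           Diff (suc k) (length as ℕ.* N) (K.ι (length as) K.* e) (∏ as f) (∏ as f₀)
  diff-∏ {k} {e = e} []       s u = diff-resp (K.sym (K.zeroˡ e)) refl refl (diff-refl (suc k) 0 1#)
  diff-∏ {k} {e = e} (a ∷ as) s u = diff-resp
    (K.solve 2 (λ e n → K.con (+ 1) K.:* (n K.:* e) K.:+ e K.:* K.con (+ 1) K.:= (K.con (+ 1) K.:+ n) K.:* e) K.refl e (K.ι (length as)))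
    refl refl (diff-* (s a) (monic-∏ as s) (u a) (diff-∏ as s u))

  -- Composing X^k (P - X^n) with u also turns the factor X^k into u^k, so the result is not yet of
  -- the form `Diff`; the translation and the negation each restore X^k in their own way.
  diff-comp : ∀ {k e u v} as → Top 1 v u → Diff k (length as) e (Π as) (X ^ length as) →
              Top (length as) (v K.^ length as K.* e) (u ^ k * (∏ as (λ a → u - C a) - u ^ length as))
  diff-comp {k} {e} {u} {v} as tu (diff t) = top-resp K.refl (begin
    comp u (suc n) (X ^ k * h)                             ≈⟨ sym (comp-stable u (suc n) k _ (above t)) ⟩
    comp u (k ℕ.+ suc n) (X ^ k * h)                       ≈⟨ comp-X^* u (suc n) k h ⟩
    u ^ k * comp u (suc n) h                               ≈⟨ *-congˡ (comp-+ u (suc n) _ _) ⟩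
    u ^ k * (comp u (suc n) (Π as) + comp u (suc n) (- X ^ n))
      ≈⟨ *-congˡ (+-cong (comp-Π u as) minus) ⟩
    u ^ k * (∏ as (λ a → u - C a) - u ^ n)                 ∎)
    (comp-top tu n t)
    where
    n = length as
    h = Π as - X ^ n
    -1* : ∀ x → C (K.- K.1#) * x ≈ - x
    -1* x = trans (*-congʳ (trans (C-neg _) (-‿cong C-1))) (solve 1 (λ x → (:- con (+ 1)) :* x := :- x) refl x)
    minus : comp u (suc n) (- X ^ n) ≈ - u ^ n
    minus = trans (comp-cong (suc n) (sym (-1* _))) (trans (comp-C* u (suc n) _ _) (trans (-1* _) (-‿cong (comp-X^ u n))))

  -- Cancelling the monic `f` recovers the bound N - k and the top coefficient of `h`, and the monic
  -- `g` restores the degree. For k > N the polynomial `h` is zero.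
  top-exchange : ∀ {k N e f g h} → Monic k f → Monic k g → Top N e (f * h) → Top N e (g * h)
  top-exchange {k} {N} {e} {f} {g} {h} s t u with k ℕ.≤? N
  ... | yes k≤N = top-resp e′≈e refl (≡.subst (λ N → Top N (K.1# K.* coef h j) (g * h)) (ℕ.m+[n∸m]≡n k≤N) (top-* t (top-coef h<)))
    where
    j = N ℕ.∸ k
    h< : h <° suc j
    h< = monic-cancel s (<°-mono (ℕ.≤-reflexive (≡.trans (≡.cong suc (≡.sym (ℕ.m+[n∸m]≡n k≤N))) (≡.sym (ℕ.+-suc k j)))) (above u))
    e′≈e : K.1# K.* coef h j K.≈ e
    e′≈e = top-unique (top-* s (top-coef h<)) (≡.subst (λ N → Top N e (f * h)) (≡.sym (ℕ.m+[n∸m]≡n k≤N)) u)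
  ... | no  k≰N = top-resp K.refl (trans (trans (*-congˡ h≈0) (zeroʳ f)) (sym (trans (*-congˡ h≈0) (zeroʳ g)))) u
    where
    h≈0 : h ≈ 0#
    h≈0 = <°0⇒≈0 (monic-cancel s (<°-mono (ℕ.≤-trans (ℕ.≰⇒> k≰N) (ℕ.≤-reflexive (≡.sym (ℕ.+-identityʳ k)))) (above u)))

  1^ : ∀ n → K.1# K.^ n K.≈ K.1#
  1^ zero    = K.refl
  1^ (suc n) = K.trans (K.*-identityˡ _) (1^ n)

  -- The reference polynomial is translated too: it is (X + z)^n, not X^n, from which the translate
  -- of P keeps the same gap.
  diff-translate : ∀ {k e} as → Diff k (length as) e (Π as) (X ^ length as) → ∀ z →
    Diff k (length as) e (∏ as (λ a → (X + C z) - C a)) ((X + C z) ^ length as)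
  diff-translate {k} {e} as t z = diff (top-exchange
    (≡.subst (λ N → Monic N ((X + C z) ^ k)) (ℕ.*-identityʳ k) (monic-^ k (monic-X+C z))) (monic-X^ k)
    (top-resp (K.trans (K.*-congʳ (1^ (length as))) (K.*-identityˡ e)) refl (diff-comp {k} as (monic-X+C z) t)))

  σ : ℕ → K.Carrier
  σ k = (K.- K.1#) K.^ k

  private
    σ² : ∀ k → σ k K.* σ k K.≈ K.1#
    σ² zero    = K.*-identityˡ _
    σ² (suc k) = K.trans (K.solve 1 (λ s → (K.:- K.con (+ 1)) K.:* s K.:* ((K.:- K.con (+ 1)) K.:* s) K.:= s K.:* s) K.refl (σ k)) (σ² k)

    -X^ : ∀ k → (- X) ^ k ≈ C (σ k) * X ^ k
    -X^ zero    = sym (trans (*-congʳ C-1) (*-identityˡ _))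
    -X^ (suc k) = begin
      (- X) * (- X) ^ k                  ≈⟨ *-congˡ (-X^ k) ⟩
      (- X) * (C (σ k) * X ^ k)          ≈⟨ solve 3 (λ x s y → (:- x) :* (s :* y) := (:- con (+ 1)) :* s :* (x :* y)) refl X (C (σ k)) (X ^ k) ⟩
      - 1# * C (σ k) * (X * X ^ k)       ≈⟨ *-congʳ (trans (*-congʳ (sym (trans (C-neg _) (-‿cong C-1)))) (sym (C-* _ _))) ⟩
      C (σ (suc k)) * X ^ suc k          ∎

    ∏-neg : ∀ as → ∏ as (λ a → - X - C a) ≈ C (σ (length as)) * ∏ as (λ a → X + C a)
    ∏-neg []       = sym (trans (*-congʳ C-1) (*-identityˡ _))
    ∏-neg (a ∷ as) = begin
      (- X - C a) * ∏ as (λ a → - X - C a)                         ≈⟨ *-congˡ (∏-neg as) ⟩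
      (- X - C a) * (C (σ (length as)) * ∏ as (λ a → X + C a))     ≈⟨ solve 4 (λ x a s y → (:- x :- a) :* (s :* y) := (:- con (+ 1)) :* s :* ((x :+ a) :* y)) refl X (C a) _ _ ⟩
      - 1# * C (σ (length as)) * ((X + C a) * ∏ as (λ a → X + C a)) ≈⟨ *-congʳ (trans (*-congʳ (sym (trans (C-neg _) (-‿cong C-1)))) (sym (C-* _ _))) ⟩
      C (σ (suc (length as))) * ((X + C a) * ∏ as (λ a → X + C a)) ∎

  -- Substituting -X contributes (-1)^(m-k) to the coefficient in question and (-1)^m to the whole
  -- product; after normalising, (-1)^k remains.
  diff-negate : ∀ {k e} as → Diff k (length as) e (Π as) (X ^ length as) →
    Diff k (length as) (σ k K.* e) (∏ as (λ a → X + C a)) (X ^ length as)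
  diff-negate {k} {e} as t = diff (top-resp coefficient polynomial (top-C* (σ k K.* σ m) (diff-comp {k} as top-neg t)))
    where
    m = length as
    top-neg : Top 1 (K.- K.1#) (- X)
    top-neg = top-resp (K.solve 0 ((K.:- K.con (+ 1)) K.:* K.con (+ 1) K.:= K.:- K.con (+ 1)) K.refl)
      (trans (*-cong (trans (C-neg _) (-‿cong C-1)) (*-identityʳ X)) (solve 1 (λ x → (:- con (+ 1)) :* x := :- x) refl X))
      (top-C* (K.- K.1#) (monic-X^ 1))
    coefficient : σ k K.* σ m K.* (σ m K.* e) K.≈ σ k K.* e
    coefficient = K.trans (K.solve 3 (λ s t e → s K.:* t K.:* (t K.:* e) K.:= t K.:* t K.:* (s K.:* e)) K.refl (σ k) (σ m) e)
      (K.trans (K.*-congʳ (σ² m)) (K.*-identityˡ _))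
    polynomial : C (σ k K.* σ m) * ((- X) ^ k * (∏ as (λ a → - X - C a) - (- X) ^ m)) ≈ X ^ k * (∏ as (λ a → X + C a) - X ^ m)
    polynomial = begin
      C (σ k K.* σ m) * ((- X) ^ k * (∏ as (λ a → - X - C a) - (- X) ^ m))
        ≈⟨ *-cong (C-* _ _) (*-cong (-X^ k) (+-cong (∏-neg as) (-‿cong (-X^ m)))) ⟩
      C (σ k) * C (σ m) * (C (σ k) * X ^ k * (C (σ m) * R - C (σ m) * X ^ m))
        ≈⟨ solve 5 (λ s t x r y → s :* t :* (s :* x :* (t :* r :- t :* y)) := s :* s :* (t :* t) :* (x :* (r :- y))) refl (C (σ k)) (C (σ m)) (X ^ k) R (X ^ m) ⟩
      C (σ k) * C (σ k) * (C (σ m) * C (σ m)) * (X ^ k * (R - X ^ m))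
        ≈⟨ *-congʳ (trans (*-cong (C² k) (C² m)) (*-identityˡ _)) ⟩
      1# * (X ^ k * (R - X ^ m))
        ≈⟨ *-identityˡ _ ⟩
      X ^ k * (R - X ^ m) ∎
      where
      R = ∏ as (λ a → X + C a)
      C² : ∀ k → C (σ k) * C (σ k) ≈ 1#
      C² k = trans (sym (C-* _ _)) (trans (C-cong (σ² k)) C-1)

  -- Vieta's formula for the coefficient just below the leading one.
  diff-sum : ∀ as → Diff 1 (length as) (K.- (foldr K._+_ K.0# as)) (Π as) (X ^ length as)
  diff-sum []       = diff-resp (K.solve 0 (K.con (+ 0) K.:= K.:- K.con (+ 0)) K.refl) refl refl (diff-refl 1 0 1#)
  diff-sum (a ∷ as) = diff-resp
    (K.solve 2 (λ a s → K.con (+ 1) K.:* (K.:- s) K.:+ (K.:- a) K.:* K.con (+ 1) K.:= K.:- (a K.:+ s)) K.refl a (foldr K._+_ K.0# as))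
    refl (*-congʳ (*-identityʳ X)) (diff-* (monic-X^ 1) (monic-X^ (length as)) linear (diff-sum as))
    where
    linear : Diff 1 1 (K.- a) (π a) (X ^ 1)
    linear = diff (top-resp (K.*-identityʳ _) (begin
      C (K.- a) * (X * 1#)          ≈⟨ *-congʳ (C-neg a) ⟩
      - C a * (X * 1#)              ≈⟨ solve 2 (λ a x → (:- a) :* (x :* con (+ 1)) := x :* con (+ 1) :* ((x :- a) :- x :* con (+ 1))) refl (C a) X ⟩
      X ^ 1 * (π a - X ^ 1)         ∎) (top-C* (K.- a) (monic-X^ 1)))

  -- Comparing coefficients of X^(mn-k) in X^(mn) - 1 = ∏_{z ∈ as} P(X + z), P = Π bs.
  product-relation : ∀ {k e e′} as bs → suc k ℕ.< length as ℕ.* length bs →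
    ∏ as (λ z → ∏ bs (λ b → (X + C z) - C b)) ≈ X ^ (length as ℕ.* length bs) - 1# →
    Diff (suc k) (length bs) e (Π bs) (X ^ length bs) →
    Diff (suc k) (length as) e′ (Π as) (X ^ length as) →
    K.ι (length as) K.* e K.+ K.ι (length bs) K.* (σ (suc k) K.* e′) K.≈ K.0#
  product-relation {k} {e} {e′} as bs lt R≈ tP tQ = top-unique (top-diff total) (top-diff direct)
    where
    m = length as
    n = length bs
    d = m ℕ.* n
    -- Each of the m factors deviates from its (X + z)^n by e, and to first order deviations in a
    -- product of monic polynomials add up.
    step₁ : Diff (suc k) d (K.ι m K.* e) (X ^ d - 1#) (∏ as (λ z → X + C z) ^ n)
    step₁ = diff-resp K.refl R≈ (∏-^ n as)
      (diff-∏ as (λ z → ≡.subst (λ N → Monic N ((X + C z) ^ n)) (ℕ.*-identityʳ n) (monic-^ n (monic-X+C z))) (diff-translate bs tP))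
    -- The roots of the product of the X + z are the negated nodes, whence the sign; the n-th power
    -- multiplies the deviation by n.
    step₂ : Diff (suc k) d (K.ι n K.* (σ (suc k) K.* e′)) (∏ as (λ z → X + C z) ^ n) (X ^ d)
    step₂ = diff-resp K.refl refl (^-assocʳ X m n)
      (≡.subst (λ N → Diff (suc k) N (K.ι n K.* (σ (suc k) K.* e′)) (∏ as (λ z → X + C z) ^ n) ((X ^ m) ^ n)) (ℕ.*-comm n m)
        (diff-^ n (monic-X^ m) (diff-negate as tQ)))
    total : Diff (suc k) d (K.ι m K.* e K.+ K.ι n K.* (σ (suc k) K.* e′)) (X ^ d - 1#) (X ^ d)
    total = diff-trans step₁ step₂
    -- The term -1 is not seen at this depth because suc k < d.
    direct : Diff (suc k) d K.0# (X ^ d - 1#) (X ^ d)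
    direct = diff (<°⇒top (<°-resp (solve 2 (λ x y → :- x := x :* ((y :- con (+ 1)) :- y)) refl (X ^ suc k) (X ^ d))
      (<°-mono lt (<°-neg (above (monic-X^ (suc k)))))))

-- The differential equation in terms of Euler operators.

module Equation {c ℓ} (K : CommutativeRing c ℓ) (𝒫 : PolynomialRing K) where

  open Polynomials K 𝒫
  open Gaps K 𝒫
  open Relation.Binary.Reasoning.Setoid setoid

  -- The Euler operators X d/dX and X² d²/dX². Unlike `D` they preserve degree bounds and have the
  -- powers of X as eigenvectors, so `Diff` applies without index shifts.
  θ φ : Carrier → Carrier
  θ f = X * D f
  φ f = θ (θ f) + C (K.- K.1#) * θ f

  θ-cong : ∀ {f g} → f ≈ g → θ f ≈ θ g
  θ-cong e = *-congˡ (D-cong e)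

  θ-C* : ∀ a f → θ (C a * f) ≈ C a * θ f
  θ-C* a f = trans (*-congˡ (D-C* a f)) (solve 3 (λ x a y → x :* (a :* y) := a :* (x :* y)) refl X (C a) (D f))

  θ-* : ∀ f g → θ (f * g) ≈ θ f * g + f * θ g
  θ-* f g = trans (*-congˡ (D-* f g))
    (solve 5 (λ x f f′ g g′ → x :* (f′ :* g :+ f :* g′) := x :* f′ :* g :+ f :* (x :* g′)) refl X f (D f) g (D g))

  θ-- : ∀ f g → θ (f - g) ≈ θ f - θ g
  θ-- f g = trans (*-congˡ (D-- f g)) (solve 3 (λ x f g → x :* (f :- g) := x :* f :- x :* g) refl X (D f) (D g))

  θ-X^ : ∀ n → θ (X ^ n) ≈ κ n * X ^ n
  θ-X^ zero    = trans (*-congˡ D-1) (trans (zeroʳ X) (sym (trans (*-congʳ C-0) (zeroˡ _))))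
  θ-X^ (suc n) = begin
    X * D (X ^ suc n)                    ≈⟨ *-congˡ (trans (D-^ X n) (*-congˡ (trans (*-congˡ D-X) (*-identityʳ _)))) ⟩
    X * (κ (suc n) * X ^ n)              ≈⟨ solve 3 (λ x k y → x :* (k :* y) := k :* (x :* y)) refl X (κ (suc n)) (X ^ n) ⟩
    κ (suc n) * X ^ suc n                ∎

  φ≈X²D² : ∀ f → φ f ≈ X * (X * D (D f))
  φ≈X²D² f = begin
    X * D (X * D f) + C (K.- K.1#) * (X * D f)      ≈⟨ +-cong (*-congˡ (D-X* (D f))) (*-congʳ (trans (C-neg _) (-‿cong C-1))) ⟩
    X * (D f + X * D (D f)) + - 1# * (X * D f)      ≈⟨ solve 3 (λ x d e → x :* (d :+ x :* e) :+ (:- con (+ 1)) :* (x :* d) := x :* (x :* e)) refl X (D f) (D (D f)) ⟩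
    X * (X * D (D f))                               ∎

  φ-X^ : ∀ n → φ (X ^ n) ≈ C (K.ι n K.* K.ι n K.- K.ι n) * X ^ n
  φ-X^ n = begin
    θ (θ (X ^ n)) + C (K.- K.1#) * θ (X ^ n)
      ≈⟨ +-cong (trans (θ-cong (θ-X^ n)) (trans (θ-C* _ _) (*-congˡ (θ-X^ n)))) (*-cong (trans (C-neg _) (-‿cong C-1)) (θ-X^ n)) ⟩
    κ n * (κ n * X ^ n) + - 1# * (κ n * X ^ n)
      ≈⟨ solve 2 (λ k x → k :* (k :* x) :+ (:- con (+ 1)) :* (k :* x) := (k :* k :- k) :* x) refl (κ n) (X ^ n) ⟩
    (κ n * κ n - κ n) * X ^ n
      ≈⟨ *-congʳ (sym (trans (C-- _ _) (+-congʳ (C-* _ _)))) ⟩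
    C (K.ι n K.* K.ι n K.- K.ι n) * X ^ n ∎

  coef-θ : ∀ f i → coef (θ f) i K.≈ K.ι i K.* coef f i
  coef-θ f zero    = K.trans (coef-X*₀ _) (K.sym (K.zeroˡ _))
  coef-θ f (suc i) = K.trans (coef-X*₊ _ i) (coef-D f i)

  top-θ : ∀ {N a f} → Top N a f → Top N (K.ι N K.* a) (θ f)
  top-θ {f = f} t = mkTop (K.trans (coef-θ f _) (K.*-congˡ (top t)))
    (deg λ i le → K.trans (coef-θ f i) (K.trans (K.*-congˡ (vanish (above t) i le)) (K.zeroʳ _)))

  -- On degree N - k the operator θ is multiplication by N - k. Since `Diff` only sees X^k (f - g),
  -- this is obtained from X^k θ h = θ (X^k h) - k X^k h.
  diff-θ : ∀ {k N e f g} → Diff k N e f g → Diff k N ((K.ι N K.- K.ι k) K.* e) (θ f) (θ g)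
  diff-θ {k} {N} {e} {f} {g} (diff t) = diff (top-resp
    (K.solve 3 (λ n k e → n K.:* e K.:+ (K.:- k) K.:* e K.:= (n K.:- k) K.:* e) K.refl (K.ι N) (K.ι k) e)
    (begin
      θ (X ^ k * (f - g)) + C (K.- K.ι k) * (X ^ k * (f - g))
        ≈⟨ +-cong (trans (θ-* _ _) (+-cong (*-congʳ (θ-X^ k)) (*-congˡ (θ-- f g)))) (*-congʳ (C-neg _)) ⟩
      (κ k * X ^ k * (f - g) + X ^ k * (θ f - θ g)) + - κ k * (X ^ k * (f - g))
        ≈⟨ solve 4 (λ k x h y → (k :* x :* h :+ x :* y) :+ (:- k) :* (x :* h) := x :* y) refl (κ k) (X ^ k) (f - g) (θ f - θ g) ⟩
      X ^ k * (θ f - θ g) ∎)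
    (top-+ (top-θ t) (top-C* (K.- K.ι k) t)))

  diff-φ : ∀ {k N e f g} → Diff k N e f g →
    Diff k N ((K.ι N K.- K.ι k) K.* ((K.ι N K.- K.ι k) K.* e) K.+ K.- K.1# K.* ((K.ι N K.- K.ι k) K.* e)) (φ f) (φ g)
  diff-φ t = diff-+ (diff-θ (diff-θ t)) (diff-C* (K.- K.1#) (diff-θ t))

  module Operator (n m : ℕ) where

    private
      N = K.ι n
      M = K.ι m
      α = M K.* (K.1# K.+ M)
      β = K.- ((K.1# K.+ K.1#) K.* (M K.* N K.- K.1#))
      γ = N K.* (K.1# K.+ N)

    -- X² times m(m+1) f″ g - 2(mn-1) f′ g′ + n(n+1) f g″.
    W : Carrier → Carrier → Carrier
    W f g = C α * (φ f * g) + (C β * (θ f * θ g) + C γ * (f * φ g))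

    -- The three constants satisfy m(m+1) n(n-1) - 2(mn-1) mn + n(n+1) m(m-1) = 0. Hence the leading
    -- terms give no information, and the first deviation from the powers decides.
    W-powers : W (X ^ n) (X ^ m) ≈ 0#
    W-powers = begin
      W (X ^ n) (X ^ m)
        ≈⟨ +-cong (*-congˡ (*-congʳ (φ-X^ n))) (+-cong (*-congˡ (*-cong (θ-X^ n) (θ-X^ m))) (*-congˡ (*-congˡ (φ-X^ m)))) ⟩
      C α * (C N₂ * x * y) + (C β * (C N * x * (C M * y)) + C γ * (x * (C M₂ * y)))
        ≈⟨ solve 9 (λ α β γ n m n₂ m₂ x y → α :* (n₂ :* x :* y) :+ (β :* (n :* x :* (m :* y)) :+ γ :* (x :* (m₂ :* y)))
             := (α :* n₂ :+ (β :* (n :* m) :+ γ :* m₂)) :* (x :* y)) refl (C α) (C β) (C γ) (C N) (C M) (C N₂) (C M₂) x y ⟩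
      (C α * C N₂ + (C β * (C N * C M) + C γ * C M₂)) * (x * y)
        ≈⟨ *-congʳ (sym (trans (C-+ _ _) (+-cong (C-* _ _) (trans (C-+ _ _) (+-cong (trans (C-* _ _) (*-congˡ (C-* _ _))) (C-* _ _)))))) ⟩
      C (α K.* N₂ K.+ (β K.* (N K.* M) K.+ γ K.* M₂)) * (x * y)
        ≈⟨ *-congʳ (trans (C-cong zero-constant) C-0) ⟩
      0# * (x * y)
        ≈⟨ zeroˡ _ ⟩
      0# ∎
      where
      x = X ^ n
      y = X ^ m
      N₂ = N K.* N K.- N
      M₂ = M K.* M K.- M
      zero-constant : α K.* N₂ K.+ (β K.* (N K.* M) K.+ γ K.* M₂) K.≈ K.0#
      zero-constant = K.solve 2 (λ n m → m K.:* (K.con (+ 1) K.:+ m) K.:* (n K.:* n K.:- n)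
        K.:+ ((K.:- ((K.con (+ 1) K.:+ K.con (+ 1)) K.:* (m K.:* n K.:- K.con (+ 1)))) K.:* (n K.:* m)
        K.:+ n K.:* (K.con (+ 1) K.:+ n) K.:* (m K.:* m K.:- m)) K.:= K.con (+ 0)) K.refl N M

    -- By bilinearity the first deviation of W f g from W (X^n) (X^m) is linear in e and e′. Both
    -- values are 0, so it vanishes; the formula is its simplified form.
    W-coefficient : ∀ {k e e′ f g} → Diff (suc k) n e f (X ^ n) → Diff (suc k) m e′ g (X ^ m) → W f g ≈ 0# →
      let k′ = K.ι (suc k) in
      k′ K.* (M K.* e K.* ((M K.+ K.1#) K.* (k′ K.+ K.1#) K.- (K.1# K.+ K.1#) K.* (N K.+ K.1#))
         K.+  N K.* e′ K.* ((N K.+ K.1#) K.* (k′ K.+ K.1#) K.- (K.1# K.+ K.1#) K.* (M K.+ K.1#))) K.≈ K.0#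
    W-coefficient {k} {e} {e′} {f} {g} s t W≈0 = K.trans
      (K.solve 5 (λ k n m e e′ →
         k K.:* (m K.:* e K.:* ((m K.:+ K.con (+ 1)) K.:* (k K.:+ K.con (+ 1)) K.:- (K.con (+ 1) K.:+ K.con (+ 1)) K.:* (n K.:+ K.con (+ 1)))
            K.:+ n K.:* e′ K.:* ((n K.:+ K.con (+ 1)) K.:* (k K.:+ K.con (+ 1)) K.:- (K.con (+ 1) K.:+ K.con (+ 1)) K.:* (m K.:+ K.con (+ 1))))
         K.:= m K.:* (K.con (+ 1) K.:+ m) K.:* ((n K.:* n K.:- n) K.:* e′ K.:+ ((n K.:- k) K.:* ((n K.:- k) K.:* e) K.:+ (K.:- K.con (+ 1)) K.:* ((n K.:- k) K.:* e)) K.:* K.con (+ 1))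
         K.:+ ((K.:- ((K.con (+ 1) K.:+ K.con (+ 1)) K.:* (m K.:* n K.:- K.con (+ 1)))) K.:* (n K.:* ((m K.:- k) K.:* e′) K.:+ ((n K.:- k) K.:* e) K.:* m)
         K.:+ n K.:* (K.con (+ 1) K.:+ n) K.:* (K.con (+ 1) K.:* ((m K.:- k) K.:* ((m K.:- k) K.:* e′) K.:+ (K.:- K.con (+ 1)) K.:* ((m K.:- k) K.:* e′)) K.:+ e K.:* (m K.:* m K.:- m))))
       K.refl (K.ι (suc k)) N M e e′)
      (top-unique (top-diff total) (top-diff (diff-resp K.refl (sym W≈0) (sym W-powers) (diff-refl (suc k) (n ℕ.+ m) 0#))))
      where
      top-θX^ : ∀ n → Top n (K.ι n) (θ (X ^ n))
      top-θX^ n = top-resp (K.*-identityʳ _) refl (top-θ (monic-X^ n))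
      top-φX^ : ∀ n → Top n (K.ι n K.* K.ι n K.- K.ι n) (φ (X ^ n))
      top-φX^ n = top-resp (K.*-identityʳ _) (sym (φ-X^ n)) (top-C* _ (monic-X^ n))
      total = diff-+ (diff-C* α (diff-* (top-φX^ n) (monic-X^ m) (diff-φ s) t))
             (diff-+ (diff-C* β (diff-* (top-θX^ n) (top-θX^ m) (diff-θ s) (diff-θ t)))
                     (diff-C* γ (diff-* (monic-X^ n) (top-φX^ m) s (diff-φ t))))

-- Equality of the two sizes, for lists in a field of characteristic p.

m+n≤m*n : ∀ {m n} → 2 ℕ.≤ m → 2 ℕ.≤ n → m ℕ.+ n ℕ.≤ m ℕ.* n
m+n≤m*n {suc l} {n} (s≤s 1≤l) 2≤n = begin
  suc l ℕ.+ n     ≡⟨ ℕ.+-comm (suc l) n ⟩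
  n ℕ.+ suc l     ≤⟨ ℕ.+-monoʳ-≤ n (ℕ.+-monoˡ-≤ l 1≤l) ⟩
  n ℕ.+ (l ℕ.+ l) ≡⟨ ≡.cong (λ x → n ℕ.+ (l ℕ.+ x)) (≡.sym (ℕ.+-identityʳ l)) ⟩
  n ℕ.+ 2 ℕ.* l   ≡⟨ ≡.cong (n ℕ.+_) (ℕ.*-comm 2 l) ⟩
  n ℕ.+ l ℕ.* 2   ≤⟨ ℕ.+-monoʳ-≤ n (ℕ.*-monoʳ-≤ l 2≤n) ⟩
  n ℕ.+ l ℕ.* n   ∎
  where open ℕ.≤-Reasoning

module Decompositions {c ℓ} (K : CommutativeRing c ℓ) (𝒫 : PolynomialRing K)
  (p : ℕ) (F : FieldOfCharacteristic p K) where

  open FieldOfCharacteristic F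
  open Polynomials K 𝒫
  open HansonPetridis K 𝒫 p F
  open Gaps K 𝒫
  open Equation K 𝒫
  open Relation.Binary.Reasoning.Setoid setoid

  unit-difference : ∀ {m n} → m ℕ.< p → n ℕ.< p → ¬ m ≡ n → K.IsUnit (K.ι m K.- K.ι n)
  unit-difference {zero}  {zero}  _ _ m≢n = ⊥-elim (m≢n ≡.refl)
  unit-difference {zero}  {suc n} _ n<p _ = K.unit-resp (K.sym (K.+-identityˡ _)) (K.unit-neg (ι-unit n<p))
  unit-difference {suc m} {zero}  m<p _ _ =
    K.unit-resp (K.solve 1 (λ x → x K.:= x K.:- K.con (+ 0)) K.refl _) (ι-unit m<p)
  unit-difference {suc m} {suc n} m<p n<p m≢n =
    K.unit-resp (K.solve 2 (λ x y → x K.:- y K.:= (K.con (+ 1) K.:+ x) K.:- (K.con (+ 1) K.:+ y)) K.refl (K.ι m) (K.ι n))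
      (unit-difference (ℕ.<⇒≤ m<p) (ℕ.<⇒≤ n<p) (λ m≡n → m≢n (≡.cong suc m≡n)))

  σ-cases : ∀ k → σ k K.≈ K.1# ⊎ σ k K.≈ K.- K.1#
  σ-cases zero = inj₁ K.refl
  σ-cases (suc k) with σ-cases k
  ... | inj₁ e = inj₂ (K.trans (K.*-congˡ e) (K.*-identityʳ _))
  ... | inj₂ e = inj₁ (K.trans (K.*-congˡ e) (K.solve 0 ((K.:- K.con (+ 1)) K.:* (K.:- K.con (+ 1)) K.:= K.con (+ 1)) K.refl))

  PowersAre : ℕ → K.Carrier → List K.Carrier → List K.Carrier → Set (c ⊔ ℓ)
  PowersAre d ε as bs = All (λ b → All (PowerIs d ε b) as) bs

  powers-swap : ∀ d {as bs} → PowersAre d K.1# as bs → PowersAre d (σ d) bs as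
  powers-swap d ps = All.All-swap (All.map (All.map (λ {z} h → power-swap h)) ps)
    where
    power-swap : ∀ {b z} → PowerIs d K.1# b z → PowerIs d (σ d) z b
    power-swap {b} {z} h = K.trans
      (K.^-congˡ d (K.solve 2 (λ b z → z K.:- b K.:= (K.:- K.con (+ 1)) K.:* (b K.:- z)) K.refl b z))
      (K.trans (K.^-distrib-* (K.- K.1#) (b K.- z) d) (K.trans (K.*-congˡ h) (K.*-identityʳ _)))

  -- All elements of `bs` are roots of one monic polynomial, (X - a)^d - ε.
  length-bound : ∀ e {ε a as bs} → Distinct bs → PowersAre (suc e) ε (a ∷ as) bs → length bs ℕ.≤ suc e
  length-bound e {ε} {a} {bs = bs} ds ps = monic-∣-degree 1≉0 (monic-Π bs) π^-top K.unit-1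
    (Π-∣ ds (All.map (λ { (h ∷ _) → divides (π^≈ε (suc e) h) }) ps))
    where
    π^-top : Monic (suc e) (π a ^ suc e - C ε)
    π^-top = top-+ˡ (≡.subst (λ N → Monic N (π a ^ suc e)) (ℕ.*-identityʳ (suc e)) (monic-^ (suc e) (monic-π a)))
      (<°-neg (<°-mono (s≤s z≤n) (<°-C ε)))

  -- A difference with a power equal to 1 is a unit, so P and Q share no root.
  Π-coprime-Π : ∀ d {as bs} → PowersAre (suc d) K.1# as bs → Coprime (Π as) (Π bs)
  Π-coprime-Π d []              = unit⇒coprime unit-1
  Π-coprime-Π d {as} (ps ∷ pss) = coprime-*ʳ
    (coprime-sym (Π-coprime (All.map (λ h → K.unit-factorˡ (K.unit-resp (K.sym h) K.unit-1)) ps))) (Π-coprime-Π d pss)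

  -- Of two distinct roots at most one is zero. The other one later rules out P = X^n.
  unit-root : ∀ {b bs} → Distinct (b ∷ bs) → 1 ℕ.≤ length bs → Σ K.Carrier λ a → K.IsUnit a × π a ∣ Π (b ∷ bs)
  unit-root {b} {b′ ∷ bs} ((u ∷ _) ∷ _) _ with b ≟ K.0#
  ... | no  b≉0 = b , unit? b b≉0 , (Π (b′ ∷ bs) , refl)
  ... | yes b≈0 = b′ , K.unit-resp (K.trans (K.-‿cong (K.+-congʳ b≈0)) (K.solve 1 (λ x → K.:- (K.con (+ 0) K.:- x) K.:= x) K.refl b′)) (K.unit-neg u)
                , ∣-*ˡ (π b) (Π bs , refl)

  module _ (e : ℕ) (a : K.Carrier) (as : List K.Carrier) (b : K.Carrier) (bs : List K.Carrier)
    (as-distinct : Distinct (a ∷ as)) (bs-distinct : Distinct (b ∷ bs))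
    (powers : PowersAre (suc (suc e)) K.1# (a ∷ as) (b ∷ bs))
    (small : suc (suc e) ℕ.+ suc (suc e) ℕ.≤ p) where

    private
      d = suc (suc e)
      m = suc (length as)
      n = suc (length bs)
      P = Π (b ∷ bs)
      Q = Π (a ∷ as)

      module S₁ = Stepanov e a as (b ∷ bs) K.1# K.unit-1 as-distinct bs-distinct powers
        (ℕ.≤-trans (ℕ.+-monoʳ-< d (length-bound (suc e) as-distinct (powers-swap d powers))) small)
      module S₂ = Stepanov e b bs (a ∷ as) (σ d) (K.unit-^ d (K.unit-neg K.unit-1)) bs-distinct as-distinct (powers-swap d powers)
        (ℕ.≤-trans (ℕ.+-monoʳ-< d (length-bound (suc e) bs-distinct powers)) small)

    sizes-≤ : m ℕ.* n ℕ.≤ d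
    sizes-≤ = S₁.size-bound

    open Operator n m

    W-zero : m ℕ.* n ≡ d → W P Q ≈ 0#
    W-zero mn≡d = begin
      W P Q
        ≈⟨ +-cong (*-cong C-α (*-congʳ (φ≈X²D² P))) (+-cong (*-congʳ C-β) (*-cong C-γ (*-congˡ (φ≈X²D² Q)))) ⟩
      κ m * κ (suc m) * (X * (X * D (D P)) * Q) + (- (κ 2 * κ (suc e)) * (X * D P * (X * D Q)) + κ n * κ (suc n) * (P * (X * (X * D (D Q)))))
        ≈⟨ solve 10 (λ α β γ x p p′ p″ q q′ q″ → α :* (x :* (x :* p″) :* q) :+ ((:- β) :* (x :* p′ :* (x :* q′)) :+ γ :* (p :* (x :* (x :* q″))))
              := x :* x :* ((α :* (p″ :* q) :- β :* (p′ :* q′)) :+ γ :* (p :* q″)))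
            refl (κ m * κ (suc m)) (κ 2 * κ (suc e)) (κ n * κ (suc n)) X P (D P) (D (D P)) Q (D Q) (D (D Q)) ⟩
      X * X * V
        ≈⟨ *-congˡ V≈0 ⟩
      X * X * 0#
        ≈⟨ zeroʳ _ ⟩
      0# ∎
      where
      V : Carrier
      V = S₁.half-equation + κ n * κ (suc n) * (P * D (D Q))
      C-α : C (K.ι m K.* (K.1# K.+ K.ι m)) ≈ κ m * κ (suc m)
      C-α = C-* _ _
      C-γ : C (K.ι n K.* (K.1# K.+ K.ι n)) ≈ κ n * κ (suc n)
      C-γ = C-* _ _
      ι-mn : K.ι m K.* K.ι n K.≈ K.1# K.+ K.ι (suc e)
      ι-mn = K.trans (K.sym (K.ι-* m n)) (K.reflexive (≡.cong K.ι mn≡d))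
      C-β : C (K.- ((K.1# K.+ K.1#) K.* (K.ι m K.* K.ι n K.- K.1#))) ≈ - (κ 2 * κ (suc e))
      C-β = trans (C-neg _) (-‿cong (trans (C-* _ _) (*-cong (C-cong (K.+-congˡ (K.sym (K.+-identityʳ _))))
        (C-cong (K.trans (K.+-congʳ ι-mn) (K.solve 1 (λ x → (K.con (+ 1) K.:+ x) K.:- K.con (+ 1) K.:= x) K.refl _))))))
      P∣V : P ∣ V
      P∣V = ∣-+ (S₁.P∣half-equation mn≡d) (∣-*ˡ _ (D (D Q) , refl))
      -- V is symmetric under exchanging P with Q and m with n, so the half equation of the
      -- exchanged situation applies after regrouping.
      Q∣V : Q ∣ V
      Q∣V = ∣-resp (solve 9 (λ α β γ p p′ p″ q q′ q″ → (γ :* (q″ :* p) :- β :* (q′ :* p′)) :+ α :* p″ :* q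
                                  := (α :* (p″ :* q) :- β :* (p′ :* q′)) :+ γ :* (p :* q″))
                refl (κ m * κ (suc m)) (κ 2 * κ (suc e)) (κ n * κ (suc n)) P (D P) (D (D P)) Q (D Q) (D (D Q)))
              (∣-+ (S₂.P∣half-equation (≡.trans (ℕ.*-comm n m) mn≡d)) (∣-*ˡ _ (1# , sym (*-identityʳ Q))))
      PQ∣V : Q * P ∣ V
      PQ∣V = coprime-*-∣ (Π-coprime-Π (suc e) powers) Q∣V P∣V
      P< : P <° suc n
      P< = above (monic-Π (b ∷ bs))
      Q< : Q <° suc m
      Q< = above (monic-Π (a ∷ as))
      -- Every product in V carries two derivatives, which keeps its degree below that of PQ.
      V< : V <° m ℕ.+ n
      V< = <°-+ (<°-+ (scale (<°-mono (ℕ.≤-reflexive (ℕ.+-comm n m)) (<°-* (<°-mono (ℕ.n≤1+n _) (<°-D (<°-D P<))) Q<)))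
                      (<°-neg (scale (<°-mono (ℕ.≤-trans (s≤s (ℕ.+-monoʳ-≤ (length bs) (ℕ.n≤1+n _))) (ℕ.≤-reflexive (ℕ.+-comm n m))) (<°-* (<°-D P<) (<°-D Q<))))))
                (scale (<°-mono (ℕ.≤-reflexive (≡.trans (≡.sym (ℕ.+-suc n (length as))) (ℕ.+-comm n m))) (<°-* P< (<°-mono (ℕ.n≤1+n _) (<°-D (<°-D Q<))))))
        where
        scale : ∀ {x y f N} → f <° N → C x * C y * f <° N
        scale z = <°-resp (sym (*-assoc _ _ _)) (<°-C* _ (<°-C* _ z))
      V≈0 : V ≈ 0#
      V≈0 = trans (proj₂ PQ∣V) (trans (*-congˡ (<°0⇒≈0 (monic-cancel (monic-* (monic-Π (a ∷ as)) (monic-Π (b ∷ bs)))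
        (<°-resp (proj₂ PQ∣V) (<°-mono (ℕ.≤-reflexive (≡.sym (ℕ.+-identityʳ (m ℕ.+ n)))) V<))))) (zeroʳ _))

    module _ (2≤m : 2 ℕ.≤ m) (2≤n : 2 ℕ.≤ n) (mn≡d : m ℕ.* n ≡ d)
      (sum-zero : foldr K._+_ K.0# (a ∷ as) K.≈ K.0#)
      (product : ∏ (a ∷ as) (λ z → ∏ (b ∷ bs) (λ b → (X + C z) - C b)) ≈ X ^ d - 1#) where

      private
        M = K.ι m
        N = K.ι n

        m+n≤d : m ℕ.+ n ℕ.≤ d
        m+n≤d = ℕ.≤-trans (m+n≤m*n 2≤m 2≤n) (ℕ.≤-reflexive mn≡d)

        4≤d : 4 ℕ.≤ d
        4≤d = ℕ.≤-trans (ℕ.+-mono-≤ 2≤m 2≤n) m+n≤d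

        -- Here m + n ≤ d and 3 ≤ d are fitted into d + d ≤ p. The bound serves the factor m + n + 2
        -- and, through m ≥ 2, the factor k + 3.
        2+m+n<p : 2 ℕ.+ (m ℕ.+ n) ℕ.< p
        2+m+n<p = ℕ.≤-trans (ℕ.+-mono-≤ (ℕ.≤-trans (ℕ.n≤1+n 3) 4≤d) m+n≤d) small

        m<p : m ℕ.< p
        m<p = ℕ.≤-<-trans (ℕ.≤-trans (ℕ.m≤m+n m n) (ℕ.m≤n+m _ 2)) 2+m+n<p

        3+n<p : 3 ℕ.+ n ℕ.< p
        3+n<p = ℕ.≤-<-trans (ℕ.m≤n⇒m≤1+n (ℕ.+-monoˡ-≤ n (s≤s 2≤m))) 2+m+n<p

        n<p : n ℕ.< p
        n<p = ℕ.≤-<-trans (ℕ.m≤n+m n 3) 3+n<p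

        n<d : n ℕ.< d
        n<d = ℕ.≤-trans (ℕ.+-monoˡ-≤ n (ℕ.<⇒≤ 2≤m)) m+n≤d

      -- P has the coefficients of X^n from degree n - k upwards, and Q those of X^m from degree m -
      -- k upwards. Multiplying by X^(k+1) avoids truncated subtraction, so k may exceed m.
      Agree : ℕ → Set ℓ
      Agree k = X ^ suc k * (P - X ^ n) <° suc n × X ^ suc k * (Q - X ^ m) <° suc m

      module _ (k : ℕ) (k<n : suc k ℕ.≤ n) (agree : Agree k) where

        private
          x y : K.Carrier
          x = coef (X ^ suc k * (P - X ^ n)) n
          y = coef (X ^ suc k * (Q - X ^ m)) m
          k′ = K.ι (suc k)

          tP : Diff (suc k) n x P (X ^ n)
          tP = diff (top-coef (proj₁ agree))

          tQ : Diff (suc k) m y Q (X ^ m)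
          tQ = diff (top-coef (proj₂ agree))

          k-unit : K.IsUnit k′
          k-unit = ι-unit (ℕ.≤-<-trans k<n n<p)

          relation : M K.* x K.+ N K.* (σ (suc k) K.* y) K.≈ K.0#
          relation = product-relation (a ∷ as) (b ∷ bs)
            (ℕ.≤-<-trans k<n (ℕ.<-≤-trans n<d (ℕ.≤-reflexive (≡.sym mn≡d))))
            (trans product (reflexive (≡.cong (λ N → X ^ N - 1#) (≡.sym mn≡d)))) tP tQ

          y⇐x : x K.≈ K.0# → y K.≈ K.0#
          y⇐x x≈0 = K.unit-cancel (K.unit-* (ι-unit n<p) (K.unit-^ (suc k) (K.unit-neg K.unit-1)))
            (K.trans (K.solve 4 (λ m n s y → n K.:* s K.:* y K.:= m K.:* K.con (+ 0) K.:+ n K.:* (s K.:* y)) K.refl M N (σ (suc k)) y)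
              (K.trans (K.+-congʳ (K.*-congˡ (K.sym x≈0))) relation))

          x⇐y : y K.≈ K.0# → x K.≈ K.0#
          x⇐y y≈0 = K.unit-cancel (ι-unit m<p)
            (K.trans (K.solve 4 (λ m n s x → m K.:* x K.:= m K.:* x K.:+ n K.:* (s K.:* K.con (+ 0))) K.refl M N (σ (suc k)) x)
              (K.trans (K.+-congˡ (K.*-congˡ (K.*-congˡ (K.sym y≈0)))) relation))

          E B : K.Carrier
          B = (N K.+ K.1#) K.* (k′ K.+ K.1#) K.- (K.1# K.+ K.1#) K.* (M K.+ K.1#)
          E = k′ K.* (M K.* x K.* ((M K.+ K.1#) K.* (k′ K.+ K.1#) K.- (K.1# K.+ K.1#) K.* (N K.+ K.1#)) K.+ N K.* y K.* B)

          E≈0 : E K.≈ K.0#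
          E≈0 = W-coefficient {k} {x} {y} {P} {Q} tP tQ (W-zero mn≡d)

          -- Here the product relation is M x + N y = 0. Subtracting k′ B times it from E removes y
          -- and leaves k′ M (M - N) (k′ + 3) x.
          even : ¬ m ≡ n → σ (suc k) K.≈ K.1# → x K.≈ K.0#
          even m≢n s≈1 = K.unit-cancel
            (K.unit-* k-unit (K.unit-* (ι-unit m<p) (K.unit-* (unit-difference m<p n<p m≢n)
              (ι-unit {3 ℕ.+ k} (ℕ.≤-<-trans (s≤s (s≤s (s≤s k<n))) 3+n<p)))))
            (K.trans (K.solve 5 (λ k n m x y →
                let b = (n K.:+ K.con (+ 1)) K.:* (k K.:+ K.con (+ 1)) K.:- (K.con (+ 1) K.:+ K.con (+ 1)) K.:* (m K.:+ K.con (+ 1)) in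
                k K.:* (m K.:* ((m K.:- n) K.:* (K.con (+ 1) K.:+ (K.con (+ 1) K.:+ (K.con (+ 1) K.:+ k))))) K.:* x K.:=
                k K.:* (m K.:* x K.:* ((m K.:+ K.con (+ 1)) K.:* (k K.:+ K.con (+ 1)) K.:- (K.con (+ 1) K.:+ K.con (+ 1)) K.:* (n K.:+ K.con (+ 1))) K.:+ n K.:* y K.:* b)
                  K.:- k K.:* b K.:* (m K.:* x K.:+ n K.:* (K.con (+ 1) K.:* y))) K.refl k′ N M x y)
              (vanish-combination (K.trans (K.+-congˡ (K.*-congˡ (K.*-congʳ (K.sym s≈1)))) relation)))
            where
            vanish-combination : ∀ {r} → r K.≈ K.0# → E K.- k′ K.* B K.* r K.≈ K.0#
            vanish-combination r≈0 = K.trans (K.+-cong E≈0 (K.-‿cong (K.trans (K.*-congˡ r≈0) (K.zeroʳ _)))) (K.-‿inverseʳ K.0#)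

          -- Here the product relation is M x - N y = 0. Adding k′ B times it to E removes y and
          -- leaves k′ M (M + N + 2) (k′ - 1) x; the last factor is nonzero because `k` is a
          -- successor.
          odd : ∀ {j} → k ≡ suc j → σ (suc k) K.≈ K.- K.1# → x K.≈ K.0#
          odd {j} ≡.refl s≈-1 = K.unit-cancel
            (K.unit-* k-unit (K.unit-* (ι-unit m<p) (K.unit-* (K.unit-resp (K.+-congˡ (K.+-congˡ (K.ι-+ m n))) (ι-unit {1 ℕ.+ (m ℕ.+ n)} 2+m+n<p))
              (ι-unit {j} (ℕ.<-trans ℕ.≤-refl (ℕ.≤-<-trans k<n n<p))))))
            (K.trans (K.solve 5 (λ k n m x y →
                let k′ = K.con (+ 1) K.:+ k
                    b = (n K.:+ K.con (+ 1)) K.:* (k′ K.:+ K.con (+ 1)) K.:- (K.con (+ 1) K.:+ K.con (+ 1)) K.:* (m K.:+ K.con (+ 1)) in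
                k′ K.:* (m K.:* ((K.con (+ 1) K.:+ (K.con (+ 1) K.:+ (m K.:+ n))) K.:* k)) K.:* x K.:=
                k′ K.:* (m K.:* x K.:* ((m K.:+ K.con (+ 1)) K.:* (k′ K.:+ K.con (+ 1)) K.:- (K.con (+ 1) K.:+ K.con (+ 1)) K.:* (n K.:+ K.con (+ 1))) K.:+ n K.:* y K.:* b)
                  K.:+ k′ K.:* b K.:* (m K.:* x K.:+ n K.:* ((K.:- K.con (+ 1)) K.:* y))) K.refl (K.ι k) N M x y)
              (vanish-combination (K.trans (K.+-congˡ (K.*-congˡ (K.*-congʳ (K.sym s≈-1)))) relation)))
            where
            vanish-combination : ∀ {r} → r K.≈ K.0# → E K.+ k′ K.* B K.* r K.≈ K.0#
            vanish-combination r≈0 = K.trans (K.+-cong E≈0 (K.trans (K.*-congˡ r≈0) (K.zeroʳ _))) (K.+-identityʳ K.0#)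

          -- In the first order below the leading term, y is minus the sum of the nodes, which has
          -- been made zero.
          centred : k ≡ 0 → y K.≈ K.0#
          centred ≡.refl = K.trans (top-unique (top-diff tQ) (top-diff (diff-sum (a ∷ as))))
            (K.trans (K.-‿cong sum-zero) (K.solve 0 (K.:- K.con (+ 0) K.:= K.con (+ 0)) K.refl))

          x≈0 : ¬ m ≡ n → x K.≈ K.0#
          x≈0 m≢n = cases k ≡.refl (σ-cases (suc k))
            where
            cases : ∀ j → k ≡ j → σ (suc k) K.≈ K.1# ⊎ σ (suc k) K.≈ K.- K.1# → x K.≈ K.0#
            cases zero    k≡0 _        = x⇐y (centred k≡0)
            cases (suc j) k≡  (inj₁ s) = even m≢n s
            cases (suc j) k≡  (inj₂ s) = odd k≡ s

        agree-next : ¬ m ≡ n → Agree (suc k)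
        agree-next m≢n = raise (proj₁ agree) (x≈0 m≢n) , raise (proj₂ agree) (y⇐x (x≈0 m≢n))
          where
          raise : ∀ {N h} → X ^ suc k * h <° suc N → coef (X ^ suc k * h) N K.≈ K.0# → X ^ suc (suc k) * h <° suc N
          raise lt e = <°-resp (sym (*-assoc _ _ _)) (<°-X* (<°-lower lt e))

      agree-all : ¬ m ≡ n → ∀ k → k ℕ.≤ n → Agree k
      agree-all m≢n zero    _   = monic-agree (monic-Π (b ∷ bs)) (monic-X^ n) , monic-agree (monic-Π (a ∷ as)) (monic-X^ m)
        where
        monic-agree : ∀ {N f g} → Monic N f → Monic N g → X ^ 1 * (f - g) <° suc N
        monic-agree {N} {f} {g} s t = <°-resp (*-congʳ (sym (*-identityʳ X))) (<°-X* (<°-lower (<°-+ (above s) (<°-neg (above t)))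
          (K.trans (coef-- f g N) (K.-‿≈0 (K.trans (top s) (K.sym (top t)))))))
      agree-all m≢n (suc k) k<n = agree-next k k<n (agree-all m≢n k (ℕ.<⇒≤ k<n)) m≢n

      P≈X^n : ¬ m ≡ n → P ≈ X ^ n
      P≈X^n m≢n = ≈-from-0 (<°0⇒≈0 (<°-X^*⁻¹ (suc n)
        (<°-mono (ℕ.≤-reflexive (≡.sym (ℕ.+-identityʳ (suc n)))) (proj₁ (agree-all m≢n n ℕ.≤-refl)))))

      sizes-equal : m ≡ n
      sizes-equal with m ℕ.≟ n
      ... | yes m≡n = m≡n
      -- If P were X^n, then X - r would divide X^n for a nonzero root r of P. But X is invertible
      -- modulo X - r, so X - r would divide 1.
      ... | no  m≢n = ⊥-elim (ℕ.<⇒≱ (s≤s z≤n) (monic-∣-degree 1≉0 (monic-π r) top-1 K.unit-1 πr∣1))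
        where
        root = unit-root bs-distinct (ℕ.s≤s⁻¹ 2≤n)
        r = proj₁ root
        X-coprime : Coprime (π r) X
        X-coprime = coprime-resp (mod (- 1# , solve 2 (λ x c → c :- x := (x :- c) :* (:- con (+ 1))) refl X (C r)))
          (unit⇒coprime (C-unit (proj₁ (proj₂ root))))
        πr∣1 : π r ∣ 1#
        πr∣1 = coprime-∣ (coprime-^ʳ n X-coprime)
          (∣-resp (trans (P≈X^n m≢n) (sym (*-identityʳ _))) (proj₂ (proj₂ root)))

  ∏-map : ∀ {f g} as → ∏ (map f as) g ≈ ∏ as (λ a → g (f a))
  ∏-map []       = refl
  ∏-map (a ∷ as) = *-congˡ (∏-map as)

  sum-translate : ∀ t as → foldr K._+_ K.0# (map (K._+ t) as) K.≈ foldr K._+_ K.0# as K.+ K.ι (length as) K.* t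
  sum-translate t []       = K.solve 1 (λ t → K.con (+ 0) K.:= K.con (+ 0) K.:+ K.con (+ 0) K.:* t) K.refl t
  sum-translate t (a ∷ as) = K.trans (K.+-congˡ (sum-translate t as))
    (K.solve 4 (λ a t s n → a K.:+ t K.:+ (s K.:+ n K.:* t) K.:= a K.:+ s K.:+ (K.con (+ 1) K.:+ n) K.:* t) K.refl a t _ (K.ι (length as)))

  -- Moving both lists by the same t changes no difference b - z, hence none of the hypotheses.
  sizes-equal-uncentred : ∀ e a as b bs → Distinct (a ∷ as) → Distinct (b ∷ bs) →
    PowersAre (suc (suc e)) K.1# (a ∷ as) (b ∷ bs) → suc (suc e) ℕ.+ suc (suc e) ℕ.≤ p →
    2 ℕ.≤ suc (length as) → 2 ℕ.≤ suc (length bs) → suc (length as) ℕ.* suc (length bs) ≡ suc (suc e) →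
    ∏ (a ∷ as) (λ z → ∏ (b ∷ bs) (λ b → (X + C z) - C b)) ≈ X ^ suc (suc e) - 1# →
    suc (length as) ≡ suc (length bs)
  sizes-equal-uncentred e a as b bs as-distinct bs-distinct powers small 2≤m 2≤n mn≡d product =
    ≡.subst₂ (λ x y → suc x ≡ suc y) #as #bs
      (sizes-equal e (τ a) (map τ as) (τ b) (map τ bs) (distinct as-distinct) (distinct bs-distinct)
        (All.map⁺ (All.map (λ ps → All.map⁺ (All.map (λ h → K.trans (K.^-congˡ (suc (suc e)) (cancel-τ _ _)) h) ps)) powers)) small
        (≡.subst (λ x → 2 ℕ.≤ suc x) (≡.sym #as) 2≤m) (≡.subst (λ x → 2 ℕ.≤ suc x) (≡.sym #bs) 2≤n)
        (≡.trans (≡.cong₂ (λ x y → suc x ℕ.* suc y) #as #bs) mn≡d)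
        (K.trans (sum-translate t (a ∷ as)) sum-zero)
        (trans (∏-map {τ} (a ∷ as)) (trans (∏-cong (a ∷ as) (λ z → trans (∏-map {τ} (b ∷ bs)) (∏-cong (b ∷ bs) (λ b → same-factor z b)))) product)))
    where
    S = foldr K._+_ K.0# (a ∷ as)
    m-unit : K.IsUnit (K.ι (suc (length as)))
    m-unit = ι-unit (ℕ.≤-trans (s≤s (length-bound (suc e) as-distinct (powers-swap (suc (suc e)) powers)))
      (ℕ.≤-trans (ℕ.+-monoˡ-≤ (suc (suc e)) (s≤s (z≤n {suc e}))) small))
    -- Minus the mean of the nodes; it exists because m ≤ d < p.
    t : K.Carrier
    t = K.- (proj₁ m-unit K.* S)
    τ : K.Carrier → K.Carrier
    τ = K._+ t
    #as = length-map τ as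
    #bs = length-map τ bs
    cancel-τ : ∀ x y → τ x K.- τ y K.≈ x K.- y
    cancel-τ x y = K.solve 3 (λ x y t → (x K.:+ t) K.:- (y K.:+ t) K.:= x K.:- y) K.refl x y t
    distinct : ∀ {xs} → Distinct xs → Distinct (map τ xs)
    distinct ds = AllPairs.map⁺ (AllPairs.map (λ u → K.unit-resp (K.sym (cancel-τ _ _)) u) ds)
    sum-zero : S K.+ K.ι (suc (length as)) K.* t K.≈ K.0#
    sum-zero = K.trans (K.solve 3 (λ s m i → s K.:+ m K.:* (K.:- (i K.:* s)) K.:= s K.:- m K.:* i K.:* s) K.refl S (K.ι (suc (length as))) (proj₁ m-unit))
      (K.-‿≈0 (K.sym (K.trans (K.*-congʳ (proj₂ m-unit)) (K.*-identityˡ S))))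
    same-factor : ∀ z b → (X + C (τ z)) - C (τ b) ≈ (X + C z) - C b
    same-factor z b = trans (+-cong (+-congˡ (C-+ z t)) (-‿cong (C-+ b t)))
      (solve 4 (λ x z b t → (x :+ (z :+ t)) :- (b :+ t) := (x :+ z) :- b) refl X (C z) (C b) (C t))

-- Fermat's theorem, the number of roots of unity, and the product over all sums.

length-filter-¬ : ∀ {a q} {A : Set a} {P : Pred A q} (P? : Decidable P) xs →
                  length (filter P? xs) ℕ.+ length (filter (λ x → ¬? (P? x)) xs) ≡ length xs
length-filter-¬ P? []       = ≡.refl
length-filter-¬ P? (x ∷ xs) with P? x
... | yes _ = ≡.cong suc (length-filter-¬ P? xs)
... | no  _ = ≡.trans (ℕ.+-suc _ _) (≡.cong suc (length-filter-¬ P? xs))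

module RootsOfUnity {c ℓ} (K : CommutativeRing c ℓ) (𝒫 : PolynomialRing K)
  (q : ℕ) (F : FieldOfCharacteristic (suc q) K) where

  open FieldOfCharacteristic F
  open Polynomials K 𝒫
  open Gaps K 𝒫
  open HansonPetridis K 𝒫 (suc q) F using (PowerIs)
  open Decompositions K 𝒫 (suc q) F
  open Relation.Binary.Reasoning.Setoid setoid

  private
    p = suc q

  -- Both sides have the same derivative and agree at 0 and in degree p.
  frobenius : (X + C K.1#) ^ p ≈ X ^ p + 1#
  frobenius = ≈-from-0 (ext λ i → K.trans (coef-zero i) (K.sym (coef-0 i)))
    where
    h = (X + C K.1#) ^ p - (X ^ p + 1#)
    κp≈0 : κ p ≈ 0#
    κp≈0 = trans (C-cong ι-zero) C-0
    D-power : ∀ f → D (f ^ p) ≈ 0#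
    D-power f = trans (D-^ f q) (trans (*-congʳ κp≈0) (zeroˡ _))
    Dh≈0 : D h ≈ 0#
    Dh≈0 = begin
      D h                                              ≈⟨ D-- _ _ ⟩
      D ((X + C K.1#) ^ p) - D (X ^ p + 1#)            ≈⟨ +-cong (D-power _) (-‿cong (trans (D-+ _ _) (+-cong (D-power X) D-1))) ⟩
      0# - (0# + 0#)                                   ≈⟨ solve 0 (con (+ 0) :- (con (+ 0) :+ con (+ 0)) := con (+ 0)) refl ⟩
      0#                                               ∎
    module Q₀ = CommutativeRing (quotient X)
    X≈0 : X ≈[ X ] 0#
    X≈0 = ∣⇒≈0 (1# , sym (*-identityʳ X))
    1^[] : ∀ n {u} → u ≈[ X ] 1# → u ^ n ≈[ X ] 1#
    1^[] zero    e = Q₀.refl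
    1^[] (suc n) e = Q₀.trans (Q₀.*-cong e (1^[] n e)) (Q₀.*-identityˡ 1#)
    X∣h : X ∣ h
    X∣h = divides (Q₀.trans (1^[] p (Q₀.trans (Q₀.+-cong X≈0 (≈⇒≈[] C-1)) (Q₀.+-identityˡ 1#)))
      (Q₀.sym (Q₀.trans (Q₀.+-congʳ (Q₀.trans (Q₀.*-congʳ X≈0) (Q₀.zeroˡ _))) (Q₀.+-identityˡ 1#))))
    monic-power : Monic p ((X + C K.1#) ^ p)
    monic-power = ≡.subst (λ N → Monic N ((X + C K.1#) ^ p)) (ℕ.*-identityʳ p) (monic-^ p (monic-X+C K.1#))
    monic-binomial : Monic p (X ^ p + 1#)
    monic-binomial = top-+ˡ (monic-X^ p) (<°-mono (s≤s z≤n) (above top-1))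
    h< : h <° p
    h< = <°-lower (<°-+ (above monic-power) (<°-neg (above monic-binomial)))
      (K.trans (coef-- _ _ p) (K.-‿≈0 (K.trans (top monic-power) (K.sym (top monic-binomial)))))
    coef-zero : ∀ i → coef h i K.≈ K.0#
    coef-zero zero    = K.trans (coef-cong (proj₂ X∣h) 0) (coef-X*₀ _)
    coef-zero (suc i) with suc i ℕ.<? p
    ... | yes i<p = K.unit-cancel (ι-unit i<p) (K.trans (K.sym (coef-D h i)) (K.trans (coef-cong Dh≈0 i) (coef-0 i)))
    ... | no  i≮p = vanish h< (suc i) (ℕ.≮⇒≥ i≮p)

  -- A constant that is a multiple of the monic X - a is zero for reasons of degree.
  C-injective[π] : ∀ {a x y} → C x ≈[ π a ] C y → x K.≈ y
  C-injective[π] {a} {x} {y} (mod (g , e)) = K.≈-from-0 (K.trans (K.sym (coef-C₀ _)) (K.trans (coef-cong C≈0 0) (coef-0 0)))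
    where
    C≈ : C (x K.- y) ≈ π a * g
    C≈ = trans (C-- x y) e
    C≈0 : C (x K.- y) ≈ 0#
    C≈0 = trans C≈ (trans (*-congˡ (<°0⇒≈0 (monic-cancel (monic-π a) (<°-resp C≈ (<°-C _))))) (zeroʳ _))

  -- Induction on n: read modulo X - x with x = ι n, `frobenius` says (x + 1)^p = x^p + 1.
  ι^p≈ι : ∀ n → K.ι n K.^ p K.≈ K.ι n
  ι^p≈ι zero    = K.zeroˡ _
  ι^p≈ι (suc n) = K.trans (C-injective[π] {x} (Qx.trans (Qx.sym (π∣-^ p X+1≈)) (Qx.trans (≈⇒≈[] frobenius)
      (Qx.trans (Qx.+-cong (π∣-^ p (X≈C[π] x)) (≈⇒≈[] (sym C-1))) (≈⇒≈[] (sym (C-+ _ _)))))))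
    (K.trans (K.+-congʳ (ι^p≈ι n)) (K.+-comm x K.1#))
    where
    x = K.ι n
    module Qx = CommutativeRing (quotient (π x))
    X+1≈ : X + C K.1# ≈[ π x ] C (K.1# K.+ x)
    X+1≈ = Qx.trans (Qx.+-congʳ (X≈C[π] x)) (≈⇒≈[] (trans (sym (C-+ _ _)) (C-cong (K.+-comm x K.1#))))

  fermat : ∀ {n} → suc n ℕ.< p → K.ι (suc n) K.^ q K.≈ K.1#
  fermat {n} n<p = K.≈-from-0 (K.unit-cancel (ι-unit n<p)
    (K.trans (K.solve 2 (λ x y → x K.:* (y K.:- K.con (+ 1)) K.:= x K.:* y K.:- x) K.refl (K.ι (suc n)) (K.ι (suc n) K.^ q))
      (K.-‿≈0 (ι^p≈ι (suc n)))))

  X^-1 : ℕ → Carrier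
  X^-1 n = X ^ n - 1#

  monic-X^-1 : ∀ n → Monic (suc n) (X^-1 (suc n))
  monic-X^-1 n = top-+ˡ (monic-X^ (suc n)) (<°-neg (<°-mono (s≤s z≤n) (above top-1)))

  X^-1≈[π] : ∀ a n → X^-1 n ≈[ π a ] C (a K.^ n K.- K.1#)
  X^-1≈[π] a n = Qa.trans (Qa.+-cong (π∣-^ n (X≈C[π] a)) (Qa.-‿cong (≈⇒≈[] (sym C-1)))) (≈⇒≈[] (sym (C-- _ _)))
    where module Qa = CommutativeRing (quotient (π a))

  π∣X^-1 : ∀ {a} n → a K.^ n K.≈ K.1# → π a ∣ X^-1 n
  π∣X^-1 {a} n e = ≈0⇒∣ (Qa.trans (X^-1≈[π] a n) (≈⇒≈[] (trans (C-cong (K.-‿≈0 e)) C-0)))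
    where module Qa = CommutativeRing (quotient (π a))

  nonzero : List K.Carrier
  nonzero = applyUpTo (λ i → K.ι (suc i)) q

  module _ (d r s : ℕ) (factor : q ≡ s ℕ.* suc d) (split : q ≡ suc d ℕ.+ r) where

    private
      is-root : Decidable (λ x → x K.^ suc d K.≈ K.1#)
      is-root x = (x K.^ suc d) ≟ K.1#

    roots non-roots : List K.Carrier
    roots     = filter is-root nonzero
    non-roots = filter (λ x → ¬? (is-root x)) nonzero

    private
      nonzero-distinct : Distinct nonzero
      nonzero-distinct = AllPairs.applyUpTo⁺₁ (λ i → K.ι (suc i)) q λ i<j j<q →
        unit-difference (s≤s (ℕ.<-trans i<j j<q)) (s≤s j<q) (λ e → ℕ.<⇒≢ i<j (ℕ.suc-injective e))

      nonzero-fermat : All (λ x → x K.^ q K.≈ K.1#) nonzero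
      nonzero-fermat = All.applyUpTo⁺₁ (λ i → K.ι (suc i)) q (λ i<q → fermat (s≤s i<q))

      roots-distinct : Distinct roots
      roots-distinct = AllPairs.filter⁺ is-root nonzero-distinct

      X^d-1∣X^q-1 : X^-1 (suc d) ∣ X^-1 q
      X^d-1∣X^q-1 = ∣-resp (+-congʳ (trans (^-assocʳ X (suc d) s) (reflexive (≡.cong (X ^_) (≡.trans (ℕ.*-comm (suc d) s) (≡.sym factor))))))
        (divides (powers s))
        where
        module Qd = CommutativeRing (quotient (X^-1 (suc d)))
        powers : ∀ n → (X ^ suc d) ^ n ≈[ X^-1 (suc d) ] 1#
        powers zero    = Qd.refl
        powers (suc n) = Qd.trans (Qd.*-cong (mod (1# , sym (*-identityʳ _))) (powers n)) (Qd.*-identityˡ 1#)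

      J : Carrier
      J = proj₁ X^d-1∣X^q-1

      X^q-1-monic : Monic (suc d ℕ.+ r) (X^-1 (suc d) * J)
      X^q-1-monic = top-resp K.refl (trans (reflexive (≡.cong X^-1 (≡.sym split))) (proj₂ X^d-1∣X^q-1)) (monic-X^-1 (d ℕ.+ r))

      J-monic : Monic r J
      J-monic = mkTop (K.trans (K.sym (K.*-identityˡ _)) (top-unique (top-* (monic-X^-1 d) (top-coef J<)) X^q-1-monic)) J<
        where
        J< : J <° suc r
        J< = monic-cancel (monic-X^-1 d) (<°-mono (ℕ.≤-reflexive (≡.sym (ℕ.+-suc (suc d) r))) (above X^q-1-monic))

      non-roots-∣J : All (λ x → π x ∣ J) non-roots
      non-roots-∣J = All.zipWith (λ { {x} (x^q≈1 , x^d≉1) →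
          coprime-∣ (coprime-resp (Q.sym x (X^-1≈[π] x (suc d))) (unit⇒coprime (C-unit (unit? _ (λ e → x^d≉1 (K.≈-from-0 e))))))
            (∣-resp (proj₂ X^d-1∣X^q-1) (π∣X^-1 q x^q≈1)) })
        (All.filter⁺ (λ x → ¬? (is-root x)) nonzero-fermat , All.all-filter (λ x → ¬? (is-root x)) nonzero)
        where module Q x = CommutativeRing (quotient (π x))

      non-roots-≤ : length non-roots ℕ.≤ r
      non-roots-≤ = monic-∣-degree 1≉0 (monic-Π non-roots) J-monic K.unit-1
        (Π-∣ (AllPairs.filter⁺ (λ x → ¬? (is-root x)) nonzero-distinct) non-roots-∣J)

      Πroots∣ : Π roots ∣ X^-1 (suc d)
      Πroots∣ = Π-∣ roots-distinct (All.map (π∣X^-1 (suc d)) (All.all-filter is-root nonzero))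

    -- All q nonzero residues are roots of X^q - 1, which is X^(suc d) - 1 times a monic J of degree
    -- r. Those that are no roots of the first factor are roots of J, so there are at most r of
    -- them, and at least suc d are left.
    length-roots : length roots ≡ suc d
    length-roots = ℕ.≤-antisym (monic-∣-degree 1≉0 (monic-Π roots) (monic-X^-1 d) K.unit-1 Πroots∣)
      (ℕ.+-cancelʳ-≤ r (suc d) (length roots) (≤-via (≡.trans (length-filter-¬ is-root nonzero) (length-applyUpTo (λ i → K.ι (suc i)) q))))
      where
      ≤-via : length roots ℕ.+ length non-roots ≡ q → suc d ℕ.+ r ℕ.≤ length roots ℕ.+ r
      ≤-via e = ℕ.≤-trans (ℕ.≤-reflexive (≡.trans (≡.sym split) (≡.sym e))) (ℕ.+-monoʳ-≤ (length roots) non-roots-≤)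

    roots-are-roots : All (λ x → x K.^ suc d K.≈ K.1#) roots
    roots-are-roots = All.all-filter is-root nonzero

    X^-1≈Πroots : X^-1 (suc d) ≈ Π roots
    X^-1≈Πroots = trans (monic-∣-same (≡.subst (λ N → Monic N (Π roots)) length-roots (monic-Π roots)) (monic-X^-1 d) Πroots∣)
      (trans (*-congʳ C-1) (*-identityˡ _))

    Covers : List K.Carrier → List K.Carrier → Set (c ⊔ ℓ)
    Covers as bs = ∀ x → x K.^ suc d K.≈ K.1# → Σ K.Carrier λ z → Σ K.Carrier λ b → z ∈ as × b ∈ bs × x K.≈ b K.- z

    private
      ∏-∣ : ∀ {g z as} → z ∈ as → g z ∣ ∏ as g
      ∏-∣ {g} {as = z ∷ as} (here ≡.refl) = ∏ as g , refl
      ∏-∣ {g} {as = a ∷ as} (there z∈as)  = ∣-*ˡ (g a) (∏-∣ {g} z∈as)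

    module _ {as bs : List K.Carrier} (cover : Covers as bs) where

      private
        R : Carrier
        R = ∏ as (λ z → ∏ bs (λ b → (X + C z) - C b))

        R-monic : Monic (length as ℕ.* length bs) R
        R-monic = ≡.subst (λ N → Monic (length as ℕ.* N) R) (ℕ.*-identityʳ (length bs))
          (monic-∏ as (λ z → monic-∏ bs (λ b → top-+ˡ (monic-X+C z) (<°-neg (<°-C b)))))

        Πroots∣R : Π roots ∣ R
        Πroots∣R = Π-∣ roots-distinct (All.map (λ {x} h → root-∣ x (cover x h)) roots-are-roots)
          where
          root-∣ : ∀ x → (Σ K.Carrier λ z → Σ K.Carrier λ b → z ∈ as × b ∈ bs × x K.≈ b K.- z) → π x ∣ R
          root-∣ x (z , b , z∈as , b∈bs , x≈) = ∣-trans
            (∣-respˡ (trans (solve 3 (λ x z b → (x :+ z) :- b := x :- (b :- z)) refl X (C z) (C b))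
                            (+-congˡ (-‿cong (trans (sym (C-- b z)) (C-cong (K.sym x≈))))))
              (∏-∣ {λ b → (X + C z) - C b} b∈bs))
            (∏-∣ {λ z → ∏ bs (λ b → (X + C z) - C b)} z∈as)

      -- A root of unity b - z is a root of the factor X + z - b of `R`. Hence the product over all
      -- distinct roots of unity divides `R`, whose degree is the number of pairs.
      cover-≤ : suc d ℕ.≤ length as ℕ.* length bs
      cover-≤ = ≡.subst (ℕ._≤ length as ℕ.* length bs) length-roots
        (monic-∣-degree 1≉0 (monic-Π roots) R-monic K.unit-1 Πroots∣R)

      cover-product : length as ℕ.* length bs ≡ suc d → R ≈ X^-1 (suc d)
      cover-product e = trans (monic-∣-same (monic-Π roots) (≡.subst (λ N → Monic N R) (≡.trans e (≡.sym length-roots)) R-monic) Πroots∣R)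
        (trans (*-congʳ C-1) (trans (*-identityˡ _) (sym X^-1≈Πroots)))

  equal-sizes : ∀ e r s as bs → q ≡ s ℕ.* suc (suc e) → (split : q ≡ suc (suc e) ℕ.+ r) → suc (suc e) ℕ.≤ r →
    Distinct as → Distinct bs → PowersAre (suc (suc e)) K.1# as bs →
    (∀ x → x K.^ suc (suc e) K.≈ K.1# → Σ K.Carrier λ z → Σ K.Carrier λ b → z ∈ as × b ∈ bs × x K.≈ b K.- z) →
    1 ℕ.< length as → 1 ℕ.< length bs →
    length as ℕ.* length as ≡ suc (suc e) × length bs ℕ.* length bs ≡ suc (suc e)
  equal-sizes e r s (a ∷ as) (b ∷ bs) factor split d≤r as-distinct bs-distinct powers cover 2≤m 2≤n =
    ≡.trans (≡.cong (m ℕ.*_) m≡n) mn≡d , ≡.trans (≡.cong (ℕ._* n) (≡.sym m≡n)) mn≡d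
    where
    d = suc (suc e)
    m = suc (length as)
    n = suc (length bs)
    -- The hypothesis d ≤ r, with r = p - 1 - d, is 2d ≤ p - 1.
    small : d ℕ.+ d ℕ.≤ p
    small = ℕ.m≤n⇒m≤1+n (ℕ.≤-trans (ℕ.+-monoʳ-≤ d d≤r) (ℕ.≤-reflexive (≡.sym split)))
    mn≡d : m ℕ.* n ≡ d
    mn≡d = ℕ.≤-antisym (sizes-≤ e a as b bs as-distinct bs-distinct powers small) (cover-≤ (suc e) r s factor split cover)
    m≡n : m ≡ n
    m≡n = sizes-equal-uncentred e a as b bs as-distinct bs-distinct powers small 2≤m 2≤n mn≡d
      (cover-product (suc e) r s factor split cover mn≡d)

open import Data.Fin as Fin using (Fin; toℕ)
import Data.Fin.Properties as Fin
open import Data.Fin.Subset using (Subset; ∣_∣; inside; outside) renaming (_∈_ to _∈ˢ_)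
import Data.Integer.Divisibility.Signed as Signed
open import Data.Integer.DivMod using (_%ℕ_; _/ℕ_; a≡a%ℕn+[a/ℕn]*n; n%ℕd<d)
open import Data.List.Membership.Propositional.Properties using (∈-map⁺)
open import Data.Nat.Coprimality using (prime⇒coprime; coprime-Bézout)
import Data.Nat.Divisibility as ℕ
open import Data.Nat.DivMod using (_%_; _/_; _mod_; m≡m%n+[m/n]*n; m%n<n)
open import Data.Nat.GCD using (module Bézout)
open import Data.Nat.Primality using (Prime; prime⇒nonTrivial)
open import Data.Vec using ([]; _∷_; here; there)
open Bézout.Identity using (+-; -+)

-- Subsets as lists, and the field of residues modulo p.

elements : ∀ {n} → Subset n → List (Fin n)
elements []            = []
elements (inside ∷ s)  = Fin.zero ∷ map Fin.suc (elements s)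
elements (outside ∷ s) = map Fin.suc (elements s)

length-elements : ∀ {n} (s : Subset n) → length (elements s) ≡ ∣ s ∣
length-elements []            = ≡.refl
length-elements (inside ∷ s)  = ≡.cong suc (≡.trans (length-map Fin.suc (elements s)) (length-elements s))
length-elements (outside ∷ s) = ≡.trans (length-map Fin.suc (elements s)) (length-elements s)

all-elements : ∀ {n} (s : Subset n) → All (_∈ˢ s) (elements s)
all-elements []            = []
all-elements (inside ∷ s)  = here ∷ All.map⁺ (All.map there (all-elements s))
all-elements (outside ∷ s) = All.map⁺ (All.map there (all-elements s))

∈-elements : ∀ {n} {s : Subset n} {x} → x ∈ˢ s → x ∈ elements s
∈-elements {s = inside ∷ s}  here      = here ≡.refl
∈-elements {s = inside ∷ s}  (there h) = there (∈-map⁺ Fin.suc (∈-elements h))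
∈-elements {s = outside ∷ s} (there h) = ∈-map⁺ Fin.suc (∈-elements h)

elements-distinct : ∀ {n} (s : Subset n) → AllPairs (λ x y → ¬ x ≡ y) (elements s)
elements-distinct []            = []
elements-distinct (inside ∷ s)  = All.map⁺ (All.universal (λ _ ()) _)
  ∷ AllPairs.map⁺ (AllPairs.map (λ x≢y e → x≢y (Fin.suc-injective e)) (elements-distinct s))
elements-distinct (outside ∷ s) = AllPairs.map⁺ (AllPairs.map (λ x≢y e → x≢y (Fin.suc-injective e)) (elements-distinct s))

module ResidueField (q : ℕ) (p-prime : Prime (suc q)) where

  private
    p : ℕ
    p = suc q

    module Z where
      open CommutativeRing ℤ.+-*-commutativeRing public
      open Ideals ℤ.+-*-commutativeRing public

  -- Residues are represented by arbitrary integers with congruence as equality, so that a Bézout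
  -- identity can be read directly as an inverse.
  K : CommutativeRing _ _
  K = Z.quotient (+ p)

  open CommutativeRing K hiding (zero)
  open Ideals K using (ι; IsUnit; unit-resp)

  private
    ι≡+ : ∀ n → ι n ≡ + n
    ι≡+ zero    = ≡.refl
    ι≡+ (suc n) = ≡.cong (ℤ._+_ (+ 1)) (ι≡+ n)

    %ℕ-≈ : ∀ x → x ≈ + (x %ℕ p)
    %ℕ-≈ x = Z.mod (x /ℕ p , ≡.trans (≡.cong (ℤ._- + (x %ℕ p)) (a≡a%ℕn+[a/ℕn]*n x p))
      (Z.solve 3 (λ r t p → (r Z.:+ t Z.:* p) Z.:- r Z.:= p Z.:* t) ≡.refl (+ (x %ℕ p)) (x /ℕ p) (+ p)))

    pos-+* : ∀ {u v w x y} → u ℕ.+ v ℕ.* w ≡ x ℕ.* y → + u ℤ.+ + v ℤ.* + w ≡ + x ℤ.* + y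
    pos-+* {u} {v} {w} {x} {y} e = ≡.trans (≡.cong (λ z → + u ℤ.+ z) (≡.sym (ℤ.pos-* v w))) (≡.trans (≡.cong +_ e) (ℤ.pos-* x y))

    -- The Bézout identity with p comes in two sign forms, 1 + y n = x p and 1 + x p = y n; they
    -- give the inverses -y and y.
    +-unit : ∀ {n} → suc n ℕ.< p → IsUnit (+ suc n)
    +-unit {n} n<p with coprime-Bézout (prime⇒coprime {n = suc n} p-prime n<p)
    ... | +- x y eq = ℤ.- + y , Z.mod (ℤ.- + x ,
          ≡.trans (Z.solve 2 (λ n y → n Z.:* (Z.:- y) Z.:- Z.con (+ 1) Z.:= Z.:- (Z.con (+ 1) Z.:+ y Z.:* n)) ≡.refl (+ suc n) (+ y))
         (≡.trans (≡.cong ℤ.-_ (pos-+* {1} {y} {suc n} {x} {p} eq))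
                  (Z.solve 2 (λ x p → Z.:- (x Z.:* p) Z.:= p Z.:* (Z.:- x)) ≡.refl (+ x) (+ p))))
    ... | -+ x y eq = + y , Z.mod (+ x ,
          ≡.trans (≡.cong (ℤ._- + 1) (≡.trans (ℤ.*-comm (+ suc n) (+ y)) (≡.sym (pos-+* {1} {x} {p} {y} {suc n} eq))))
                  (Z.solve 2 (λ x p → (Z.con (+ 1) Z.:+ x Z.:* p) Z.:- Z.con (+ 1) Z.:= p Z.:* x) ≡.refl (+ x) (+ p)))

    _≟_ : ∀ x y → Dec (x ≈ y)
    x ≟ y with (+ p) Signed.∣? (x ℤ.- y)
    ... | yes (Signed.divides t e) = yes (Z.mod (t , ≡.trans e (ℤ.*-comm t (+ p))))
    ... | no ¬d = no λ { (Z.mod (t , e)) → ¬d (Signed.divides t (≡.trans e (ℤ.*-comm (+ p) t))) }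

    unit? : ∀ x → ¬ x ≈ 0# → IsUnit x
    unit? x x≉0 with x %ℕ p | %ℕ-≈ x | n%ℕd<d x p
    ... | zero  | x≈ | _   = ⊥-elim (x≉0 x≈)
    ... | suc n | x≈ | n<p = unit-resp {+ suc n} {x} (sym x≈) (+-unit n<p)

    1≉0 : ¬ 1# ≈ 0#
    1≉0 (Z.mod (t , e)) = ℕ.nonTrivial⇒≢1 {{prime⇒nonTrivial p-prime}}
      (ℕ.∣1⇒≡1 (Signed.∣⇒∣ᵤ (Signed.divides {+ p} {+ 1} t (≡.trans e (ℤ.*-comm (+ p) t)))))

    _⁻¹ : Carrier → Carrier
    x ⁻¹ with x ≟ 0#
    -- A default value; zero is not a unit, so the inverse law never meets it.
    ... | yes _   = 0#
    ... | no  x≉0 = proj₁ (unit? x x≉0)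

    ⁻¹-inverse : ∀ x → IsUnit x → x * x ⁻¹ ≈ 1#
    ⁻¹-inverse x (y , xy≈1) with x ≟ 0#
    ... | yes x≈0 = ⊥-elim (1≉0 (trans (sym xy≈1) (trans (*-congʳ {y} x≈0) (zeroˡ y))))
    ... | no  x≉0 = proj₂ (unit? x x≉0)

  abstract
    field-structure : FieldOfCharacteristic p K
    field-structure = record
      { _⁻¹ = _⁻¹ ; ⁻¹-inverse = λ {x} → ⁻¹-inverse x ; 1≉0 = 1≉0
      ; ι-unit = λ {n} n<p → unit-resp {+ suc n} {ι (suc n)} (reflexive (≡.sym (ι≡+ (suc n)))) (+-unit n<p)
      ; ι-zero = trans (reflexive (ι≡+ p)) (Z.∣⇒≈0 {+ p} {+ p} (+ 1 , ≡.sym (ℤ.*-identityʳ (+ p))))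
      ; unit? = unit? ; _≟_ = _≟_ }

  ι-surjective : ∀ x → Σ ℕ λ n → x ≈ ι n
  ι-surjective x = x %ℕ p , trans (%ℕ-≈ x) (reflexive (≡.sym (ι≡+ (x %ℕ p))))

-- From sumsets of residues to lists in the field.

module Sumsets {c ℓ} (K : CommutativeRing c ℓ) (q : ℕ) (F : FieldOfCharacteristic (suc q) K)
  (ι-surjective : ∀ x → Σ ℕ λ n → CommutativeRing._≈_ K x (IntegerCoefficients.ι K n)) where

  private
    p : ℕ
    p = suc q

    𝒫 : PolynomialRing K
    𝒫 = FiniteSequences.polynomialRing K

    module K where
      open CommutativeRing K public
      open Ideals K public

  open FieldOfCharacteristic F using (1≉0; ι-zero)
  open Polynomials K 𝒫 using (Distinct)
  open Decompositions K 𝒫 p F using (unit-difference; PowersAre)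
  open RootsOfUnity K 𝒫 q F using (equal-sizes)

  ι-% : ∀ k → K.ι k K.≈ K.ι (k % p)
  ι-% k = K.trans (K.reflexive (≡.cong K.ι (m≡m%n+[m/n]*n k p)))
    (K.trans (K.ι-+ (k % p) (k / p ℕ.* p)) (K.trans
      (K.+-congˡ (K.trans (K.ι-* (k / p) p) (K.trans (K.*-congˡ ι-zero) (K.zeroʳ _)))) (K.+-identityʳ _)))

  toℕ-mod : ∀ k → toℕ (k mod p) ≡ k % p
  toℕ-mod k = Fin.toℕ-fromℕ< (m%n<n k p)

  ι-mod : ∀ k → K.ι k K.≈ K.ι (toℕ (k mod p))
  ι-mod k = K.trans (ι-% k) (K.reflexive (≡.cong K.ι (≡.sym (toℕ-mod k))))

  toℕ-unit : ∀ {x y : Fin p} → ¬ x ≡ y → K.IsUnit (K.ι (toℕ x) K.- K.ι (toℕ y))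
  toℕ-unit {x} {y} x≢y = unit-difference (Fin.toℕ<n x) (Fin.toℕ<n y) (λ eq → x≢y (Fin.toℕ-injective eq))

  ι-injective-mod : ∀ {j k} → K.ι j K.≈ K.ι k → j mod p ≡ k mod p
  ι-injective-mod {j} {k} e with (j mod p) Fin.≟ (k mod p)
  ... | yes eq  = eq
  ... | no  neq = ⊥-elim (1≉0 (K.trans (K.sym (proj₂ u)) (K.trans (K.*-congʳ
          (K.-‿≈0 (K.trans (K.sym (ι-mod j)) (K.trans e (ι-mod k))))) (K.zeroˡ _))))
    where u = toℕ-unit neq

  ι-^ : ∀ k n → K.ι (k ℕ.^ n) K.≈ K.ι k K.^ n
  ι-^ k zero    = K.+-identityʳ _
  ι-^ k (suc n) = K.trans (K.ι-* k (k ℕ.^ n)) (K.*-congˡ (ι-^ k n))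

  module _ (e : ℕ) (A B : Subset p) (sumset : SumsetEq A B (IsRootOfUnity (suc (suc e)))) where

    private
      d : ℕ
      d = suc (suc e)

      -- Negating the elements of A turns the sum a + b into the difference `pos b - neg a`, the
      -- form in which the polynomial argument is phrased.
      neg pos : Fin p → K.Carrier
      neg a = K.- K.ι (toℕ a)
      pos b = K.ι (toℕ b)

      as bs : List K.Carrier
      as = map neg (elements A)
      bs = map pos (elements B)

      as-distinct : Distinct as
      as-distinct = AllPairs.map⁺ (AllPairs.map (λ {x} {y} x≢y → K.unit-resp
        (K.solve 2 (λ x y → K.:- (x K.:- y) K.:= (K.:- x) K.:- (K.:- y)) K.refl (pos x) (pos y)) (K.unit-neg (toℕ-unit x≢y)))
        (elements-distinct A))

      bs-distinct : Distinct bs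
      bs-distinct = AllPairs.map⁺ (AllPairs.map toℕ-unit (elements-distinct B))

      sum-≈ : ∀ (a b : Fin p) → pos b K.- neg a K.≈ pos (a +𝔽 b)
      sum-≈ a b = K.trans (K.solve 2 (λ a b → b K.:- (K.:- a) K.:= a K.:+ b) K.refl (pos a) (pos b))
        (K.trans (K.sym (K.ι-+ (toℕ a) (toℕ b))) (ι-mod (toℕ a ℕ.+ toℕ b)))

      root⇒ : ∀ (x : Fin p) → IsRootOfUnity d x → pos x K.^ d K.≈ K.1#
      root⇒ x h = K.trans (K.sym (ι-^ (toℕ x) d)) (K.trans (ι-mod (toℕ x ℕ.^ d))
        (K.trans (K.reflexive (≡.cong pos h)) (K.trans (K.sym (ι-mod 1)) (K.+-identityʳ _))))

      powers : PowersAre d K.1# as bs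
      powers = All.map⁺ (All.map (λ {b} b∈B → All.map⁺ (All.map (λ {a} a∈A →
        K.trans (K.^-congˡ d (sum-≈ a b)) (root⇒ (a +𝔽 b) (proj₂ (sumset (a +𝔽 b)) (a , b , a∈A , b∈B , ≡.refl)))) (all-elements A))) (all-elements B))

      cover : ∀ x → x K.^ d K.≈ K.1# → Σ K.Carrier λ z → Σ K.Carrier λ b → z ∈ as × b ∈ bs × x K.≈ b K.- z
      cover x h = decompose (proj₁ (sumset y) y-root)
        where
        k : ℕ
        k = proj₁ (ι-surjective x)
        y : Fin p
        y = k mod p
        x≈y : x K.≈ pos y
        x≈y = K.trans (proj₂ (ι-surjective x)) (ι-mod k)
        y-root : IsRootOfUnity d y
        y-root = ι-injective-mod {toℕ y ℕ.^ d} {1}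
          (K.trans (ι-^ (toℕ y) d) (K.trans (K.^-congˡ d (K.sym x≈y)) (K.trans h (K.sym (K.+-identityʳ _)))))
        decompose : (Σ (𝔽 p) λ a → Σ (𝔽 p) λ b → a ∈ˢ A × b ∈ˢ B × (a +𝔽 b) ≡ y) →
          Σ K.Carrier λ z → Σ K.Carrier λ b → z ∈ as × b ∈ bs × x K.≈ b K.- z
        decompose (a , b , a∈A , b∈B , eq) = neg a , pos b
          , ∈-map⁺ neg (∈-elements a∈A) , ∈-map⁺ pos (∈-elements b∈B)
          , K.trans x≈y (K.trans (K.reflexive (≡.cong pos (≡.sym eq))) (K.sym (sum-≈ a b)))

      #as : length as ≡ ∣ A ∣
      #as = ≡.trans (length-map neg (elements A)) (length-elements A)

      #bs : length bs ≡ ∣ B ∣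
      #bs = ≡.trans (length-map pos (elements B)) (length-elements B)

    sumset-sizes : ∀ r s → q ≡ s ℕ.* suc (suc e) → q ≡ suc (suc e) ℕ.+ r → suc (suc e) ℕ.≤ r → 1 ℕ.< ∣ A ∣ → 1 ℕ.< ∣ B ∣ →
      ∣ A ∣ ℕ.* ∣ A ∣ ≡ suc (suc e) × ∣ B ∣ ℕ.* ∣ B ∣ ≡ suc (suc e)
    sumset-sizes r s factor split d≤r 1<A 1<B = ≡.subst₂ (λ x y → x ℕ.* x ≡ d × y ℕ.* y ≡ d) #as #bs
      (equal-sizes e r s as bs factor split d≤r as-distinct bs-distinct powers cover
        (≡.subst (1 ℕ.<_) (≡.sym #as) 1<A) (≡.subst (1 ℕ.<_) (≡.sym #bs) 1<B))

open import Data.Nat using (_*_; _∸_; _<_; NonZero)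
open import Data.Nat.Divisibility using (_∣_)

theorem2 : (p : ℕ) .{{_ : NonZero p}} → Prime p → (d : ℕ) → d ∣ p ∸ 1 → 1 < d → d < p ∸ 1 →
    (A B : Subset p) → SumsetEq A B (IsRootOfUnity d) → 1 < ∣ A ∣ → 1 < ∣ B ∣ →
    (∣ A ∣ * ∣ A ∣ ≡ d) × (∣ B ∣ * ∣ B ∣ ≡ d)
theorem2 (suc q) p-prime (suc (suc e)) (ℕ.divides s q≡sd) (s≤s (s≤s z≤n)) d<q A B sumset 1<A 1<B = cases s q≡sd
  where
  open ResidueField q p-prime
  open Sumsets K q field-structure ι-surjective
  d : ℕ
  d = suc (suc e)
  cases : ∀ s → q ≡ s * d → (∣ A ∣ * ∣ A ∣ ≡ d) × (∣ B ∣ * ∣ B ∣ ≡ d)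
  cases zero          q≡ = ⊥-elim (ℕ.n≮0 (≡.subst (d <_) q≡ d<q))
  cases (suc zero)    q≡ = ⊥-elim (ℕ.<-irrefl (≡.sym (≡.trans q≡ (ℕ.+-identityʳ d))) d<q)
  -- A cofactor of at least 2 leaves p - 1 - d ≥ d. This is where d < p - 1 becomes 2d ≤ p - 1, on
  -- which the invertibility claims rest.
  cases (suc (suc s)) q≡ = sumset-sizes e A B sumset (suc s * d) (suc (suc s)) q≡ q≡ (ℕ.m≤m+n d (s * d)) 1<A 1<B
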